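{- Let $k \ge 2$ be a fixed integer. For every $\epsilon > 0$, there is a deterministic algorithm solving $k$-SAT in time $O^*\left(\left(\frac{2(k-1)}{k}+\epsilon\right)^n\right)$, where $n$ is the number of variables of the input formula.
   Context: A literal is a Boolean variable $x$ or its complement $\bar x$. A clause is a finite set of literals over pairwise distinct variables (read as a disjunction), and a CNF formula is a finite set of clauses (read as a conjunction). A $(\le k)$-CNF formula is a CNF formula all of whose clauses have size at most $k$. $k$-SAT is the problem of deciding, given a $(\le k)$-CNF formula $F$ over $n$ variables, whether there is a truth assignment to its variables satisfying $F$ (i.e. satisfying at least one literal in every clause). $O^*$ suppresses factors polynomial in $n$; $k$ and $\epsilon$ are constants, and the algorithm may depend on them. -}

module Defs where

open import Algebra.Definitions.RawSemiring using (_^_)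
open import Data.Bool using (Bool; true; false)
open import Data.Fin using (Fin; zero; suc; toℕ)
open import Data.Integer using (+_)
open import Data.List using (List; []; _∷_; length; map)
open import Data.List.Relation.Binary.BagAndSetEquality using (_∼[_]_; set)
open import Data.List.Relation.Unary.All using (All)
open import Data.List.Relation.Unary.AllPairs using (AllPairs)
open import Data.List.Relation.Unary.Any using (Any)
open import Data.List.Relation.Unary.Unique.Propositional using (Unique)
open import Data.Nat as ℕ using (ℕ; zero; suc; NonZero)
open import Data.Product using (_×_; _,_; ∃; ∃₂)
open import Data.Rational as ℚ using (ℚ; _/_)
open import Data.Vec using (Vec; []; _∷_; lookup)
open import Function.Bundles using (_⇔_)
open import Relation.Binary.PropositionalEquality using (_≡_; refl)
open import Relation.Nullary using (¬_)

------------------------------------------------------------------------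
-- CNF formulas

record Literal (n : ℕ) : Set where
  constructor literal
  field
    var  : Fin n
    sign : Bool         -- true for x, false for its complement

-- Finite sets are represented by listings without repetition.

record Clause (n : ℕ) : Set where
  constructor clause
  field
    literals : List (Literal n)
    distinct : Unique (map Literal.var literals)

record CNF (n : ℕ) : Set where
  constructor cnf
  field
    clauses  : List (Clause n)
    distinct : AllPairs (λ C D → ¬ (Clause.literals C ∼[ set ] Clause.literals D))
                        clauses

_≤-CNF : ℕ → ∀ {n} → CNF n → Set
(k ≤-CNF) F = All (λ C → length (Clause.literals C) ℕ.≤ k) (CNF.clauses F)

Assignment : ℕ → Set
Assignment n = Fin n → Bool

_satisfies_ : ∀ {n} → Assignment n → CNF n → Set
α satisfies F =
  All (λ C → Any (λ l → α (Literal.var l) ≡ Literal.sign l) (Clause.literals C))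
      (CNF.clauses F)

Satisfiable : ∀ {n} → CNF n → Set
Satisfiable F = ∃ λ α → α satisfies F

------------------------------------------------------------------------
-- Model of computation: first-order pure Lisp over binary trees.
--
-- A program is a finite family of mutually recursive functions; values
-- are binary trees with a single atom.  Each evaluation step inspects or
-- allocates at most one cell, or builds an argument frame whose size is
-- fixed by the program.  With trees represented by pointers (and shared),
-- a unit-cost RAM or pointer machine therefore executes every step in
-- constant time.

infixr 5 _∙_

data Tree : Set where
  nil : Tree
  _∙_ : Tree → Tree → Tree

head tail : Tree → Tree
head nil     = nil
head (x ∙ y) = x
tail nil     = nil
tail (x ∙ y) = y

-- Expr ar v: expressions with v variables in scope (de Bruijn indices),
-- over function symbols g of arity ar g.

data Expr {f : ℕ} (ar : Fin f → ℕ) (v : ℕ) : Set where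
  var      : Fin v → Expr ar v
  constant : Tree → Expr ar v
  cons     : Expr ar v → Expr ar v → Expr ar v
  hd tl    : Expr ar v → Expr ar v
  ite      : Expr ar v → Expr ar v → Expr ar v → Expr ar v
  let′     : Expr ar v → Expr ar (suc v) → Expr ar v
  call     : (g : Fin f) → Vec (Expr ar v) (ar g) → Expr ar v

record Program : Set where
  constructor program
  field
    functions : ℕ
    arity     : Fin functions → ℕ
    body      : (g : Fin functions) → Expr arity (arity g)
    main      : Expr arity 1

-- P , ρ ⊢ e ⇓ x ∶ t: in environment ρ, e evaluates to x in t steps, where
-- t counts the evaluated expression occurrences.  In a conditional, nil is
-- false and every other tree is true.

infix 4 _,_⊢_⇓_∶_ _,_⊢_⇓*_∶_

mutual

  data _,_⊢_⇓_∶_ (P : Program) {v : ℕ} (ρ : Vec Tree v) :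
                 Expr (Program.arity P) v → Tree → ℕ → Set where

    var : ∀ i → P , ρ ⊢ var i ⇓ lookup ρ i ∶ 1

    constant : ∀ x → P , ρ ⊢ constant x ⇓ x ∶ 1

    cons : ∀ {e₁ e₂ x y s t} →
           P , ρ ⊢ e₁ ⇓ x ∶ s → P , ρ ⊢ e₂ ⇓ y ∶ t →
           P , ρ ⊢ cons e₁ e₂ ⇓ x ∙ y ∶ suc (s ℕ.+ t)

    hd : ∀ {e x t} → P , ρ ⊢ e ⇓ x ∶ t → P , ρ ⊢ hd e ⇓ head x ∶ suc t

    tl : ∀ {e x t} → P , ρ ⊢ e ⇓ x ∶ t → P , ρ ⊢ tl e ⇓ tail x ∶ suc t

    ite-true : ∀ {c e₁ e₂ x y z s t} →
               P , ρ ⊢ c ⇓ x ∙ y ∶ s → P , ρ ⊢ e₁ ⇓ z ∶ t →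
               P , ρ ⊢ ite c e₁ e₂ ⇓ z ∶ suc (s ℕ.+ t)

    ite-false : ∀ {c e₁ e₂ z s t} →
                P , ρ ⊢ c ⇓ nil ∶ s → P , ρ ⊢ e₂ ⇓ z ∶ t →
                P , ρ ⊢ ite c e₁ e₂ ⇓ z ∶ suc (s ℕ.+ t)

    let′ : ∀ {e₁ e₂ x y s t} →
           P , ρ ⊢ e₁ ⇓ x ∶ s → P , x ∷ ρ ⊢ e₂ ⇓ y ∶ t →
           P , ρ ⊢ let′ e₁ e₂ ⇓ y ∶ suc (s ℕ.+ t)

    call : ∀ {g es xs y s t} →
           P , ρ ⊢ es ⇓* xs ∶ s → P , xs ⊢ Program.body P g ⇓ y ∶ t →
           P , ρ ⊢ call g es ⇓ y ∶ suc (s ℕ.+ t)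

  data _,_⊢_⇓*_∶_ (P : Program) {v : ℕ} (ρ : Vec Tree v) :
                  ∀ {m} → Vec (Expr (Program.arity P) v) m → Vec Tree m → ℕ → Set where

    [] : P , ρ ⊢ [] ⇓* [] ∶ 0

    _∷_ : ∀ {m e x s t} {es : Vec _ m} {xs : Vec Tree m} →
          P , ρ ⊢ e ⇓ x ∶ s → P , ρ ⊢ es ⇓* xs ∶ t →
          P , ρ ⊢ e ∷ es ⇓* x ∷ xs ∶ s ℕ.+ t

mutual

  ⇓-deterministic : ∀ {P v} {ρ : Vec Tree v} {e x y s t} →
                    P , ρ ⊢ e ⇓ x ∶ s → P , ρ ⊢ e ⇓ y ∶ t → x ≡ y × s ≡ t
  ⇓-deterministic (var i)      (var .i)      = refl , refl
  ⇓-deterministic (constant x) (constant .x) = refl , refl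
  ⇓-deterministic (cons p q) (cons p′ q′)
    with refl , refl ← ⇓-deterministic p p′
    with refl , refl ← ⇓-deterministic q q′ = refl , refl
  ⇓-deterministic (hd p) (hd p′)
    with refl , refl ← ⇓-deterministic p p′ = refl , refl
  ⇓-deterministic (tl p) (tl p′)
    with refl , refl ← ⇓-deterministic p p′ = refl , refl
  ⇓-deterministic (ite-true p q) (ite-true p′ q′)
    with refl , refl ← ⇓-deterministic p p′
    with refl , refl ← ⇓-deterministic q q′ = refl , refl
  ⇓-deterministic (ite-false p q) (ite-false p′ q′)
    with refl , refl ← ⇓-deterministic p p′
    with refl , refl ← ⇓-deterministic q q′ = refl , refl
  ⇓-deterministic (ite-true p _) (ite-false p′ _)
    with () , _ ← ⇓-deterministic p p′
  ⇓-deterministic (ite-false p _) (ite-true p′ _)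
    with () , _ ← ⇓-deterministic p p′
  ⇓-deterministic (let′ p q) (let′ p′ q′)
    with refl , refl ← ⇓-deterministic p p′
    with refl , refl ← ⇓-deterministic q q′ = refl , refl
  ⇓-deterministic (call p q) (call p′ q′)
    with refl , refl ← ⇓*-deterministic p p′
    with refl , refl ← ⇓-deterministic q q′ = refl , refl

  ⇓*-deterministic : ∀ {P v m} {ρ : Vec Tree v} {es : Vec _ m} {xs ys s t} →
                     P , ρ ⊢ es ⇓* xs ∶ s → P , ρ ⊢ es ⇓* ys ∶ t → xs ≡ ys × s ≡ t
  ⇓*-deterministic [] [] = refl , refl
  ⇓*-deterministic (p ∷ ps) (p′ ∷ ps′)
    with refl , refl ← ⇓-deterministic p p′
    with refl , refl ← ⇓*-deterministic ps ps′ = refl , refl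

_on_returns_in-steps_ : Program → Tree → Tree → ℕ → Set
P on x returns y in-steps t = P , (x ∷ []) ⊢ Program.main P ⇓ y ∶ t

------------------------------------------------------------------------
-- Input and output encodings

encodeBool : Bool → Tree
encodeBool false = nil
encodeBool true  = nil ∙ nil

-- Unary: every number encoded is at most n, so this costs only a factor
-- polynomial in n.
encodeℕ : ℕ → Tree
encodeℕ zero    = nil
encodeℕ (suc i) = nil ∙ encodeℕ i

encodeList : ∀ {A : Set} → (A → Tree) → List A → Tree
encodeList enc []       = nil
encodeList enc (x ∷ xs) = enc x ∙ encodeList enc xs

encodeLiteral : ∀ {n} → Literal n → Tree
encodeLiteral (literal x b) = encodeℕ (toℕ x) ∙ encodeBool b

encodeClause : ∀ {n} → Clause n → Tree
encodeClause C = encodeList encodeLiteral (Clause.literals C)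

encodeCNF : ∀ {n} → CNF n → Tree
encodeCNF {n} F = encodeℕ n ∙ encodeList encodeClause (CNF.clauses F)

------------------------------------------------------------------------
-- Deciding k-SAT in a given time

_Solves_-SAT-InTime_ : Program → ℕ → (ℕ → ℕ) → Set
P Solves k -SAT-InTime T =
  ∀ {n} (F : CNF n) → (k ≤-CNF) F →
  ∃₂ λ answer t →
    P on encodeCNF F returns encodeBool answer in-steps t
    × (answer ≡ true ⇔ Satisfiable F)
    × t ℕ.≤ T n

infixr 8 _^ℚ_
_^ℚ_ : ℚ → ℕ → ℚ
_^ℚ_ = _^_ ℚ.+-*-rawSemiring

-- Every polynomial in n is bounded on ℕ by some c · (1 + n)ᵈ.
_∈O*_ : (ℕ → ℕ) → (ℕ → ℚ) → Set
T ∈O* f = ∃₂ λ c d → ∀ n → + T n / 1 ℚ.≤ (+ (c ℕ.* suc n ℕ.^ d) / 1) ℚ.* f n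

base : (k : ℕ) .{{_ : NonZero k}} → ℚ
base k = + (2 ℕ.* (k ℕ.∸ 1)) / k

{-# OPTIONS --safe #-}
module Submission where

open import Defs
open import Algebra.Bundles using (CommutativeMonoid)
open import Data.Bool using (Bool; true; false; T; not; _∧_; _∨_)
open import Data.Bool.ListAction using (any)
open import Data.Empty using (⊥)
open import Data.Fin as Fin using (Fin; zero; suc; toℕ; fromℕ<; combine)
open import Data.Fin.Properties as Fin using (toℕ<n; toℕ-fromℕ<; fromℕ<-toℕ; combine-injective; injective⇒≤)
open import Data.Integer as ℤ using (-[1+_])
import Data.Integer.Properties as ℤ
open import Data.List using (List; []; _∷_; _++_; length; lookup; map)
open import Data.List.Membership.Propositional using (_∈_)
open import Data.List.Membership.Propositional.Properties using (∈-lookup)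
open import Data.List.Properties using (length-map)
open import Data.List.Relation.Binary.BagAndSetEquality using (_∼[_]_; set)
open import Data.List.Relation.Unary.All as All using (All; []; _∷_)
import Data.List.Relation.Unary.All.Properties as All
open import Data.List.Relation.Unary.AllPairs as AllPairs using (AllPairs; []; _∷_)
open import Data.List.Relation.Unary.Any as Any using (Any; here; there)
open import Data.Nat using (ℕ; zero; suc; _+_; _*_; _∸_; _^_; _/_; _%_; _⊔_; _≤_; _<_; _≤ᵇ_; _≟_; _≤?_; _<?_;
  z≤n; s≤s; NonZero; >-nonZero; >-nonZero⁻¹)
open import Data.Nat.DivMod using (m/n*n≤m; m≡m%n+[m/n]*n; m%n<n)
open import Data.Nat.ListAction using (sum)
open import Data.Nat.ListAction.Properties using (sum-++)
open import Data.Nat.Properties hiding (_≟_; _≤?_; _<?_)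
open import Data.Nat.Tactic.RingSolver using (solve-∀)
open import Data.Product using (_×_; _,_; ∃; ∃₂; proj₁; proj₂)
open import Data.Rational as ℚ using (ℚ; 0ℚ; ↥_; ↧_; ↧ₙ_; toℚᵘ)
import Data.Rational.Properties as ℚ
open import Data.Rational.Unnormalised as ℚᵘ using (mkℚᵘ; *≡*; *≤*)
import Data.Rational.Unnormalised.Properties as ℚᵘ
open import Data.Sum using (_⊎_; inj₁; inj₂)
open import Data.Vec as Vec using (Vec; []; _∷_; replicate)
open import Function using (_∘_)
open import Function.Bundles using (mk⇔)
import Function.Properties.Equivalence as ⇔
open import Relation.Binary.PropositionalEquality
open import Relation.Nullary using (¬_; yes; no; contradiction)
open import Algebra.Properties.CommutativeSemigroup
  (CommutativeMonoid.commutativeSemigroup ℚ.*-1-commutativeMonoid) using (interchange)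

-- Derandomised Schöning walk.  Let λ be slightly above k - 1 and let w be a
-- uniformly random word in [k]ᵗ.  For every word u, the weight λ^(t - 2 d(w , u))
-- has mean μᵗ with μ > 1, and by symmetry some distance s, the same for all u,
-- carries a 1 / (t + 1) share of this mean.  For large t, a greedily chosen code
-- covering every word at distance exactly s therefore has at most λ^(t - 2 s)
-- words, with t - 2 s > 0.  Given t disjoint violated clauses, flip one literal in
-- each according to a codeword: for some codeword this gets t - 2 s steps closer
-- to a given model, so a model at distance r is found with λʳ branches.  If a
-- maximal family of disjoint violated clauses has fewer than t members, fix its
-- variables in all possible ways; from then on every violated clause has at most
-- k - 1 unfixed literals, and backtracking takes (k - 1)ʳ branches.  The same
-- covering argument for bits and the weight λ^(- d) yields starting assignments,
-- block by block, at a total cost of about (2 λ / (λ + 1))ⁿ, and 2 λ / (λ + 1)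
-- tends to 2 (k - 1) / k as λ tends to k - 1.

-- Arithmetic

-- For `λ = A / B` and `κ = k - 1`, a letter has mean weight `(λ² + κ) / (k λ)`, which is 1 at
-- `λ = κ`: there nothing would pay for the polynomial overhead of a greedy code. Taking `λ`
-- strictly above `κ` gives μ > 1, and `ε` pays for the difference. Both codes depend on `k` and `ε`
-- only, so their existence suffices: they are constants of the program, and no running time goes
-- into finding them. The variables of a maximal family are fixed at most once on each path of the
-- recursion, because backtracking never returns to the walk; the constant factor of this step is
-- therefore not raised to a power. Backtracking over a radius `g` costs about `κ ^ g`, below the
-- `λ ^ g` of the walk, so one bound serves both alternatives. A starting word at distance `s` costs
-- a further walk of `λ ^ s`, so the code `C` of starting words has to keep `|C| * λ ^ s` small;
-- this is what the weight `λ ^ (- s)` measures. All inequalities are kept in ℕ: `λ = A / B` and the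
-- target base `X / Y` are cleared of denominators and of negative exponents.

bernoulli : ∀ a b x → a ^ x * (a + x * b) ≤ a * (a + b) ^ x
bernoulli a b zero = ≤-reflexive (lem a)
  where
  lem : ∀ a → 1 * (a + 0) ≡ a * 1
  lem = solve-∀
bernoulli a b (suc x) = begin
  a * a ^ x * (a + (b + x * b))                        ≤⟨ m≤m+n _ _ ⟩
  a * a ^ x * (a + (b + x * b)) + a ^ x * (x * b * b)  ≡⟨ lem a b x (a ^ x) ⟩
  (a + b) * (a ^ x * (a + x * b))                      ≤⟨ *-monoʳ-≤ (a + b) (bernoulli a b x) ⟩
  (a + b) * (a * (a + b) ^ x)                          ≡⟨ lem′ a b ((a + b) ^ x) ⟩
  a * ((a + b) * (a + b) ^ x)                          ∎
  where
  open ≤-Reasoning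
  lem : ∀ a b x p → a * p * (a + (b + x * b)) + p * (x * b * b) ≡ (a + b) * (p * (a + x * b))
  lem = solve-∀
  lem′ : ∀ a b p → (a + b) * (a * p) ≡ a * ((a + b) * p)
  lem′ = solve-∀

-- By Bernoulli's inequality, `(1 + b / a) ^ suc x` reaches 2 as soon as `suc x` increments of
-- relative size `b / a` add up to 1.
doubling : ∀ a b x → a ≤ suc x * b → 2 * a ^ suc x ≤ (a + b) ^ suc x
doubling zero        b x a≤xb = z≤n
doubling a@(suc _)   b x a≤xb = *-cancelˡ-≤ a (begin
  a * (2 * a ^ suc x)            ≡⟨ lem a (a ^ suc x) ⟩
  a ^ suc x * (a + a)            ≤⟨ *-monoʳ-≤ (a ^ suc x) (+-monoʳ-≤ a a≤xb) ⟩
  a ^ suc x * (a + suc x * b)    ≤⟨ bernoulli a b (suc x) ⟩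
  a * (a + b) ^ suc x            ∎)
  where
  open ≤-Reasoning
  lem : ∀ a p → a * (2 * p) ≡ p * (a + a)
  lem = solve-∀

*-^-distrib : ∀ m n o → (m * n) ^ o ≡ m ^ o * n ^ o
*-^-distrib m n zero    = refl
*-^-distrib m n (suc o) = trans (cong (m * n *_) (*-^-distrib m n o)) (lem m n (m ^ o) (n ^ o))
  where
  lem : ∀ m n p q → m * n * (p * q) ≡ m * p * (n * q)
  lem = solve-∀

doublings : ∀ a b x l → a ≤ suc x * b → 2 ^ l * a ^ (suc x * l) ≤ (a + b) ^ (suc x * l)
doublings a b x l a≤xb = begin
  2 ^ l * a ^ (suc x * l)       ≡⟨ cong (2 ^ l *_) (^-*-assoc a (suc x) l) ⟨
  2 ^ l * (a ^ suc x) ^ l       ≡⟨ *-^-distrib 2 (a ^ suc x) l ⟨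
  (2 * a ^ suc x) ^ l           ≤⟨ ^-monoˡ-≤ l (doubling a b x a≤xb) ⟩
  ((a + b) ^ suc x) ^ l         ≡⟨ ^-*-assoc (a + b) (suc x) l ⟩
  (a + b) ^ (suc x * l)         ∎
  where open ≤-Reasoning

n<2^n : ∀ n → n < 2 ^ n
n<2^n zero    = s≤s z≤n
n<2^n (suc n) = begin
  suc (suc n)           ≡⟨ +-comm 1 (suc n) ⟩
  suc n + 1             ≤⟨ +-mono-≤ (n<2^n n) (≤-trans (s≤s z≤n) (n<2^n n)) ⟩
  2 ^ n + 2 ^ n         ≡⟨ cong (2 ^ n +_) (+-identityʳ _) ⟨
  2 ^ suc n             ∎
  where open ≤-Reasoning

-- With u = 4w, 2ᵘ ≥ (w + 1)⁴ beats the quadratic once w + 1 exceeds c (4D + 1)².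
exponential-beats-quadratic : ∀ c D E → D < E → ∃ λ t → c * (suc t * suc t) * D ^ t < E ^ t
exponential-beats-quadratic c zero    E@(suc _) D<E = 1 , ≤-trans (≤-reflexive (cong suc (*-zeroʳ (c * 4)))) (m^n>0 E 1)
-- Since `(1 + 1 / D) ^ D ≥ 2`, the exponent `D * u` gives `(D + 1) ^ (D * u)` a lead of at least
-- `2 ^ u` over `D ^ (D * u)`.
exponential-beats-quadratic c D@(suc D′) E D<E = D * u , (begin-strict
  c * (suc (D * u) * suc (D * u)) * D ^ (D * u)  <⟨ *-monoˡ-< (D ^ (D * u)) {{m^n≢0 D (D * u)}} quadratic< ⟩
  2 ^ u * D ^ (D * u)                            ≤⟨ doublings D 1 D′ u (≤-reflexive (sym (*-identityʳ D))) ⟩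
  (D + 1) ^ (D * u)                              ≤⟨ ^-monoˡ-≤ (D * u) (≤-trans (≤-reflexive (+-comm D 1)) D<E) ⟩
  E ^ (D * u)                                    ∎)
  where
  open ≤-Reasoning
  q w u : ℕ
  q = suc (4 * D)
  w = c * (q * q)
  u = w * 4
  v : ℕ
  v = suc w
  lem : ∀ D w → suc (D * (w * 4)) + 4 * D + w ≡ suc (4 * D) * suc w
  lem = solve-∀
  lem′ : ∀ c q v → c * (q * v * (q * v)) ≡ (c * (q * q)) * (v * v)
  lem′ = solve-∀
  lem″ : ∀ v → v * (v * v) ≤ v * (v * (v * (v * 1)))
  lem″ zero = z≤n
  lem″ v@(suc v′) = *-monoʳ-≤ v (*-monoʳ-≤ v (≤-trans (m≤m*n v v) (≤-reflexive (cong (v *_) (sym (*-identityʳ v))))))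
  arg : suc (D * u) ≤ q * v
  arg = ≤-trans (≤-trans (m≤m+n _ (4 * D)) (m≤m+n _ w)) (≤-reflexive (lem D w))
  quadratic< : c * (suc (D * u) * suc (D * u)) < 2 ^ u
  quadratic< = begin-strict
    c * (suc (D * u) * suc (D * u))  ≤⟨ *-monoʳ-≤ c (*-mono-≤ arg arg) ⟩
    c * (q * v * (q * v))            ≡⟨ lem′ c q v ⟩
    w * (v * v)                      <⟨ *-monoˡ-< (v * v) (n<1+n w) ⟩
    v * (v * v)                      ≤⟨ lem″ v ⟩
    v ^ 4                            ≤⟨ ^-monoˡ-≤ 4 (n<2^n w) ⟩
    (2 ^ w) ^ 4                      ≡⟨ ^-*-assoc 2 w 4 ⟩
    2 ^ u                            ∎

-- Covering codes

ΣFin : ∀ q → (Fin q → ℕ) → ℕ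
ΣFin zero    f = 0
ΣFin (suc q) f = f zero + ΣFin q (f ∘ suc)

ΣWords : ∀ q t → (Vec (Fin q) t → ℕ) → ℕ
ΣWords q zero    f = f []
ΣWords q (suc t) f = ΣFin q (λ x → ΣWords q t (f ∘ (x ∷_)))

+-interchange : ∀ a b c d → a + b + (c + d) ≡ a + c + (b + d)
+-interchange = solve-∀

ΣFin-cong : ∀ q {f g : Fin q → ℕ} → (∀ x → f x ≡ g x) → ΣFin q f ≡ ΣFin q g
ΣFin-cong zero    f≗g = refl
ΣFin-cong (suc q) f≗g = cong₂ _+_ (f≗g zero) (ΣFin-cong q (f≗g ∘ suc))

ΣFin-const : ∀ q c → ΣFin q (λ _ → c) ≡ q * c
ΣFin-const zero    c = refl
ΣFin-const (suc q) c = cong (c +_) (ΣFin-const q c)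

ΣFin-+ : ∀ q (f g : Fin q → ℕ) → ΣFin q (λ x → f x + g x) ≡ ΣFin q f + ΣFin q g
ΣFin-+ zero    f g = refl
ΣFin-+ (suc q) f g = trans (cong (f zero + g zero +_) (ΣFin-+ q (f ∘ suc) (g ∘ suc)))
                           (+-interchange (f zero) (g zero) _ _)

ΣFin-swap : ∀ q r (f : Fin q → Fin r → ℕ) →
            ΣFin q (λ x → ΣFin r (f x)) ≡ ΣFin r (λ y → ΣFin q (λ x → f x y))
ΣFin-swap zero    r f = sym (trans (ΣFin-const r 0) (*-zeroʳ r))
ΣFin-swap (suc q) r f = trans (cong (ΣFin r (f zero) +_) (ΣFin-swap q r (f ∘ suc)))
                              (sym (ΣFin-+ r (f zero) _))

ΣWords-cong : ∀ q t {f g : Vec (Fin q) t → ℕ} → (∀ w → f w ≡ g w) → ΣWords q t f ≡ ΣWords q t g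
ΣWords-cong q zero    f≗g = f≗g []
ΣWords-cong q (suc t) f≗g = ΣFin-cong q (λ x → ΣWords-cong q t (f≗g ∘ (x ∷_)))

ΣWords-const : ∀ q t c → ΣWords q t (λ _ → c) ≡ q ^ t * c
ΣWords-const q zero    c = sym (+-identityʳ c)
ΣWords-const q (suc t) c = trans (ΣFin-cong q (λ _ → ΣWords-const q t c))
                          (trans (ΣFin-const q (q ^ t * c)) (sym (*-assoc q (q ^ t) c)))

ΣWords-+ : ∀ q t (f g : Vec (Fin q) t → ℕ) →
           ΣWords q t (λ w → f w + g w) ≡ ΣWords q t f + ΣWords q t g
ΣWords-+ q zero    f g = refl
ΣWords-+ q (suc t) f g = trans (ΣFin-cong q (λ x → ΣWords-+ q t (f ∘ (x ∷_)) (g ∘ (x ∷_))))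
                               (ΣFin-+ q _ _)

ΣFin-ΣWords-swap : ∀ p q t (f : Fin p → Vec (Fin q) t → ℕ) →
                   ΣFin p (λ x → ΣWords q t (f x)) ≡ ΣWords q t (λ w → ΣFin p (λ x → f x w))
ΣFin-ΣWords-swap p q zero    f = refl
ΣFin-ΣWords-swap p q (suc t) f =
  trans (ΣFin-swap p q (λ x y → ΣWords q t (f x ∘ (y ∷_))))
        (ΣFin-cong q (λ y → ΣFin-ΣWords-swap p q t (λ x → f x ∘ (y ∷_))))

ΣWords-swap : ∀ p s q t (f : Vec (Fin p) s → Vec (Fin q) t → ℕ) →
              ΣWords p s (λ v → ΣWords q t (f v)) ≡ ΣWords q t (λ w → ΣWords p s (λ v → f v w))
ΣWords-swap p zero    q t f = refl
ΣWords-swap p (suc s) q t f =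
  trans (ΣFin-cong p (λ x → ΣWords-swap p s q t (f ∘ (x ∷_))))
        (ΣFin-ΣWords-swap p q t _)

ΣWords-0 : ∀ q t {f : Vec (Fin q) t → ℕ} → ΣWords q t f ≡ 0 → ∀ w → f w ≡ 0
ΣWords-0 q zero    Σf≡0 []      = Σf≡0
ΣWords-0 q (suc t) Σf≡0 (x ∷ w) = ΣWords-0 q t (ΣFin-0 q Σf≡0 x) w
  where
  ΣFin-0 : ∀ q {f : Fin q → ℕ} → ΣFin q f ≡ 0 → ∀ x → f x ≡ 0
  ΣFin-0 (suc q) {f} eq zero    = m+n≡0⇒m≡0 (f zero) eq
  ΣFin-0 (suc q) {f} eq (suc x) = ΣFin-0 q (m+n≡0⇒n≡0 (f zero) eq) x

ΣFin-maximum : ∀ q (f : Fin (suc q) → ℕ) → ∃ λ x → ΣFin (suc q) f ≤ suc q * f x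
ΣFin-maximum zero    f = zero , ≤-refl
ΣFin-maximum (suc q) f with ΣFin-maximum q (f ∘ suc)
... | x , Σ≤ with f zero ≤? f (suc x)
... | yes f0≤fx = suc x , +-mono-≤ f0≤fx Σ≤
... | no  f0≰fx = zero , +-monoʳ-≤ (f zero) (≤-trans Σ≤ (*-monoʳ-≤ (suc q) (<⇒≤ (≰⇒> f0≰fx))))

ΣWords-maximum : ∀ q t (f : Vec (Fin (suc q)) t → ℕ) →
                 ∃ λ w → ΣWords (suc q) t f ≤ suc q ^ t * f w
ΣWords-maximum q zero    f = [] , m≤m+n _ 0
ΣWords-maximum q (suc t) f with ΣFin-maximum q (λ x → ΣWords (suc q) t (f ∘ (x ∷_)))
... | x , Σ≤ with ΣWords-maximum q t (f ∘ (x ∷_))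
... | w , Σ≤′ = x ∷ w , ≤-trans Σ≤ (≤-trans (*-monoʳ-≤ (suc q) Σ≤′)
                          (≤-reflexive (sym (*-assoc (suc q) (suc q ^ t) _))))

-- `diff` admits equal letters, so `Differ s` bounds the Hamming distance by `s`, which is the form
-- in which the walk uses a codeword. The test `differ?` is exact, so that the words passing it can
-- be counted.
data Differ {q} : ∀ {t} → ℕ → Vec (Fin q) t → Vec (Fin q) t → Set where
  []   : Differ 0 [] []
  same : ∀ {t s x} {v w : Vec (Fin q) t} → Differ s v w → Differ s (x ∷ v) (x ∷ w)
  diff : ∀ {t s x y} {v w : Vec (Fin q) t} → Differ s v w → Differ (suc s) (x ∷ v) (y ∷ w)

differ? : ∀ {q t} → ℕ → Vec (Fin q) t → Vec (Fin q) t → Bool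
differ? s       (x ∷ v) (y ∷ w) with x Fin.≟ y
differ? s       (x ∷ v) (y ∷ w) | yes _ = differ? s v w
differ? zero    (x ∷ v) (y ∷ w) | no _  = false
differ? (suc s) (x ∷ v) (y ∷ w) | no _  = differ? s v w
differ? zero    []      []      = true
differ? (suc s) []      []      = false

differ?-sound : ∀ {q t} s (v w : Vec (Fin q) t) → differ? s v w ≡ true → Differ s v w
differ?-sound s       (x ∷ v) (y ∷ w) eq with x Fin.≟ y
differ?-sound s       (x ∷ v) (y ∷ w) eq | yes refl = same (differ?-sound s v w eq)
differ?-sound (suc s) (x ∷ v) (y ∷ w) eq | no _     = diff (differ?-sound s v w eq)
differ?-sound zero    []      []      _  = []

⟦_⟧ : Bool → ℕ
⟦ true ⟧  = 1
⟦ false ⟧ = 0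

-- This is the binomial coefficient of `t` over `s` times `κ ^ s`, by recursion on the first letter
-- so as to match `differ?`.
sphere : ℕ → ℕ → ℕ → ℕ
sphere κ zero    zero    = 1
sphere κ zero    (suc s) = 0
sphere κ (suc t) zero    = sphere κ t zero
sphere κ (suc t) (suc s) = sphere κ t (suc s) + κ * sphere κ t s

ΣFin-split : ∀ κ (y : Fin (suc κ)) (f : Fin (suc κ) → ℕ) {a b} →
             (∀ x → x ≡ y → f x ≡ a) → (∀ x → x ≢ y → f x ≡ b) → ΣFin (suc κ) f ≡ a + κ * b
ΣFin-split κ zero f {a} {b} f≡a f≡b =
  cong₂ _+_ (f≡a zero refl)
            (trans (ΣFin-cong κ (λ x → f≡b (suc x) λ ())) (ΣFin-const κ b))
ΣFin-split (suc κ) (suc y) f {a} {b} f≡a f≡b = begin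
  f zero + ΣFin (suc κ) (f ∘ suc)
    ≡⟨ cong₂ _+_ (f≡b zero λ ())
                 (ΣFin-split κ y (f ∘ suc) (λ x x≡y → f≡a (suc x) (cong suc x≡y))
                    (λ x x≢y → f≡b (suc x) λ { refl → x≢y refl })) ⟩
  b + (a + κ * b)
    ≡⟨ lem a b κ ⟩
  a + suc κ * b ∎
  where
  open ≡-Reasoning
  lem : ∀ a b κ → b + (a + κ * b) ≡ a + (b + κ * b)
  lem = solve-∀

-- At each position one letter agrees with `u` and `κ` letters do not, whatever `u` is. This
-- independence of `u` is the symmetry that lets one distance serve all words.
sphere-size : ∀ κ t s (u : Vec (Fin (suc κ)) t) →
              ΣWords (suc κ) t (λ w → ⟦ differ? s w u ⟧) ≡ sphere κ t s
sphere-size κ zero    zero    [] = refl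
sphere-size κ zero    (suc s) [] = refl
sphere-size κ (suc t) zero (y ∷ u) =
  trans (ΣFin-split κ y _ matched mismatched)
        (trans (cong (sphere κ t 0 +_) (*-zeroʳ κ)) (+-identityʳ _))
  where
  matched : ∀ x → x ≡ y → ΣWords (suc κ) t (λ w → ⟦ differ? 0 (x ∷ w) (y ∷ u) ⟧) ≡ sphere κ t 0
  matched x x≡y with x Fin.≟ y
  ... | yes _  = sphere-size κ t zero u
  ... | no x≢y = contradiction x≡y x≢y
  mismatched : ∀ x → x ≢ y → ΣWords (suc κ) t (λ w → ⟦ differ? 0 (x ∷ w) (y ∷ u) ⟧) ≡ 0
  mismatched x x≢y with x Fin.≟ y
  ... | yes x≡y = contradiction x≡y x≢y
  ... | no _    = trans (ΣWords-const (suc κ) t 0) (*-zeroʳ (suc κ ^ t))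
sphere-size κ (suc t) (suc s) (y ∷ u) = ΣFin-split κ y _ matched mismatched
  where
  matched : ∀ x → x ≡ y →
          ΣWords (suc κ) t (λ w → ⟦ differ? (suc s) (x ∷ w) (y ∷ u) ⟧) ≡ sphere κ t (suc s)
  matched x x≡y with x Fin.≟ y
  ... | yes _  = sphere-size κ t (suc s) u
  ... | no x≢y = contradiction x≡y x≢y
  mismatched : ∀ x → x ≢ y →
            ΣWords (suc κ) t (λ w → ⟦ differ? (suc s) (x ∷ w) (y ∷ u) ⟧) ≡ sphere κ t s
  mismatched x x≢y with x Fin.≟ y
  ... | yes x≡y = contradiction x≡y x≢y
  ... | no _    = sphere-size κ t s u

-- The s-th term of the expansion of (a + κ b) ^ t.
weight : ℕ → ℕ → ℕ → ℕ → ℕ → ℕ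
weight κ a b zero    zero    = 1
weight κ a b zero    (suc s) = 0
weight κ a b (suc t) zero    = a * weight κ a b t zero
weight κ a b (suc t) (suc s) = a * weight κ a b t (suc s) + κ * b * weight κ a b t s

-- In effect `weight = sphere * a ^ (t - s) * b ^ s`. The factor `a ^ s` on both sides avoids the
-- subtraction; for `s > t` both sides vanish.
sphere-weight : ∀ κ a b t s → sphere κ t s * a ^ t * b ^ s ≡ weight κ a b t s * a ^ s
sphere-weight κ a b zero    zero    = refl
sphere-weight κ a b zero    (suc s) = refl
sphere-weight κ a b (suc t) zero    =
  trans (lem (sphere κ t 0) a (a ^ t))
        (trans (cong (a *_) (sphere-weight κ a b t zero)) (sym (*-assoc a _ 1)))
  where
  lem : ∀ N a p → N * (a * p) * 1 ≡ a * (N * p * 1)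
  lem = solve-∀
sphere-weight κ a b (suc t) (suc s) =
  trans (lem (sphere κ t (suc s)) (sphere κ t s) κ a b (a ^ t) (b ^ s))
        (trans (cong₂ (λ x y → a * x + κ * b * a * y)
                  (sphere-weight κ a b t (suc s)) (sphere-weight κ a b t s))
               (lem′ (weight κ a b t (suc s)) (weight κ a b t s) κ a b (a ^ s)))
  where
  lem : ∀ N N′ κ a b p r →
        (N + κ * N′) * (a * p) * (b * r) ≡ a * (N * p * (b * r)) + κ * b * a * (N′ * p * r)
  lem = solve-∀
  lem′ : ∀ W W′ κ a b p →
         a * (W * (a * p)) + κ * b * a * (W′ * p) ≡ (a * W + κ * b * W′) * (a * p)
  lem′ = solve-∀

ΣFin-* : ∀ q c (f : Fin q → ℕ) → ΣFin q (λ x → c * f x) ≡ c * ΣFin q f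
ΣFin-* zero    c f = sym (*-zeroʳ c)
ΣFin-* (suc q) c f = trans (cong (c * f zero +_) (ΣFin-* q c (f ∘ suc)))
                           (sym (*-distribˡ-+ c (f zero) _))

ΣFin-toℕ-mono : ∀ q (f : ℕ → ℕ) → ΣFin q (f ∘ toℕ) ≤ ΣFin (suc q) (f ∘ toℕ)
ΣFin-toℕ-mono zero    f = z≤n
ΣFin-toℕ-mono (suc q) f = +-monoʳ-≤ (f 0) (ΣFin-toℕ-mono q (f ∘ suc))

weight-sum : ∀ κ a b t → (a + κ * b) ^ t ≤ ΣFin (suc t) (weight κ a b t ∘ toℕ)
weight-sum κ a b zero    = s≤s z≤n
weight-sum κ a b (suc t) = begin
  (a + κ * b) * (a + κ * b) ^ t
    ≤⟨ *-monoʳ-≤ (a + κ * b) (weight-sum κ a b t) ⟩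
  (a + κ * b) * S
    ≡⟨ *-distribʳ-+ S a (κ * b) ⟩
  a * S + κ * b * S
    -- One more index, at which the weight vanishes, lets the sum split into `W 0` and a sum over
    -- indices shifted by one.
    ≤⟨ +-monoˡ-≤ (κ * b * S) (*-monoʳ-≤ a (ΣFin-toℕ-mono (suc t) (weight κ a b t))) ⟩
  a * (W 0 + ΣFin (suc t) (W ∘ suc ∘ toℕ)) + κ * b * S
    ≡⟨ cong (_+ κ * b * S) (*-distribˡ-+ a (W 0) _) ⟩
  a * W 0 + a * ΣFin (suc t) (W ∘ suc ∘ toℕ) + κ * b * S
    ≡⟨ +-assoc (a * W 0) _ _ ⟩
  a * W 0 + (a * ΣFin (suc t) (W ∘ suc ∘ toℕ) + κ * b * S)
    ≡⟨ cong (a * W 0 +_) (cong₂ _+_ (ΣFin-* (suc t) a (W ∘ suc ∘ toℕ)) (ΣFin-* (suc t) (κ * b) (W ∘ toℕ))) ⟨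
  a * W 0 + (ΣFin (suc t) (λ x → a * W (suc (toℕ x))) + ΣFin (suc t) (λ x → κ * b * W (toℕ x)))
    ≡⟨ cong (a * W 0 +_) (ΣFin-+ (suc t) (λ x → a * W (suc (toℕ x))) (λ x → κ * b * W (toℕ x))) ⟨
  ΣFin (suc (suc t)) (weight κ a b (suc t) ∘ toℕ) ∎
  where
  open ≤-Reasoning
  W : ℕ → ℕ
  W = weight κ a b t
  S : ℕ
  S = ΣFin (suc t) (W ∘ toℕ)

popular-radius : ∀ κ a b t → ∃ λ s → (a + κ * b) ^ t ≤ suc t * weight κ a b t s
popular-radius κ a b t with ΣFin-maximum t (weight κ a b t ∘ toℕ)
... | x , Σ≤ = toℕ x , ≤-trans (weight-sum κ a b t) Σ≤

Covers : ∀ {q t} → ℕ → List (Vec (Fin q) t) → Set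
Covers {q} {t} s C = ∀ u → Any (λ w → Differ s w u) C

module Greedy (κ t s d : ℕ) (sphere+d : sphere κ t s + d ≡ suc κ ^ t) where

  N = suc κ ^ t
  Word = Vec (Fin (suc κ)) t

  ∣_∣ : (Word → Bool) → ℕ
  ∣ U ∣ = ΣWords (suc κ) t (⟦_⟧ ∘ U)

  uncovered : List Word → Word → Bool
  uncovered []      u = true
  uncovered (w ∷ C) u = uncovered C u ∧ not (differ? s w u)

  uncovered-sound : ∀ C u → uncovered C u ≡ false → Any (λ w → Differ s w u) C
  uncovered-sound (w ∷ C) u eq with uncovered C u in eq′ | differ? s w u in eq″
  ... | _     | true  = here (differ?-sound s w u eq″)
  ... | false | false = there (uncovered-sound C u eq′)

  split : ∀ a b → ⟦ a ∧ not b ⟧ + ⟦ a ⟧ * ⟦ b ⟧ ≡ ⟦ a ⟧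
  split false b     = refl
  split true  false = refl
  split true  true  = refl

  ΣWords-* : ∀ q t c (f : Vec (Fin q) t → ℕ) → ΣWords q t (λ w → c * f w) ≡ c * ΣWords q t f
  ΣWords-* q zero    c f = refl
  ΣWords-* q (suc t) c f = trans (ΣFin-cong q (λ x → ΣWords-* q t c (f ∘ (x ∷_)))) (ΣFin-* q c _)

  -- By double counting, some word covers at least the average share of the uncovered words.
  step : ∀ U → ∃ λ w → N * ∣ (λ u → U u ∧ not (differ? s w u)) ∣ ≤ d * ∣ U ∣
  step U with ΣWords-maximum κ t (λ w → ΣWords (suc κ) t (λ u → ⟦ U u ⟧ * ⟦ differ? s w u ⟧))
  ... | w , Σ≤ = w , +-cancelʳ-≤ (N * covered w) (N * ∣ U′ ∣) (d * ∣ U ∣) (begin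
    N * ∣ U′ ∣ + N * covered w    ≡⟨ *-distribˡ-+ N ∣ U′ ∣ (covered w) ⟨
    N * (∣ U′ ∣ + covered w)      ≡⟨ cong (N *_) (ΣWords-+ (suc κ) t _ _) ⟨
    N * ΣWords (suc κ) t (λ u → ⟦ U u ∧ not (differ? s w u) ⟧ + ⟦ U u ⟧ * ⟦ differ? s w u ⟧)
                                  ≡⟨ cong (N *_) (ΣWords-cong (suc κ) t (λ u → split (U u) (differ? s w u))) ⟩
    N * ∣ U ∣                     ≡⟨ cong (_* ∣ U ∣) (trans (sym sphere+d) (+-comm (sphere κ t s) d)) ⟩
    (d + sphere κ t s) * ∣ U ∣    ≡⟨ *-distribʳ-+ ∣ U ∣ d _ ⟩
    d * ∣ U ∣ + sphere κ t s * ∣ U ∣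
      ≡⟨ cong (d * ∣ U ∣ +_) (ΣWords-* (suc κ) t (sphere κ t s) (⟦_⟧ ∘ U)) ⟨
    d * ∣ U ∣ + ΣWords (suc κ) t (λ u → sphere κ t s * ⟦ U u ⟧)
      ≡⟨ cong (d * ∣ U ∣ +_) (ΣWords-cong (suc κ) t column) ⟩
    d * ∣ U ∣ + ΣWords (suc κ) t (λ u → ΣWords (suc κ) t (λ w → ⟦ U u ⟧ * ⟦ differ? s w u ⟧))
      ≡⟨ cong (d * ∣ U ∣ +_) (ΣWords-swap (suc κ) t (suc κ) t _) ⟩
    d * ∣ U ∣ + ΣWords (suc κ) t covered
      ≤⟨ +-monoʳ-≤ (d * ∣ U ∣) Σ≤ ⟩
    d * ∣ U ∣ + N * covered w     ∎)
    where
    open ≤-Reasoning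
    covered : Word → ℕ
    covered w = ΣWords (suc κ) t (λ u → ⟦ U u ⟧ * ⟦ differ? s w u ⟧)
    U′ : Word → Bool
    U′ u = U u ∧ not (differ? s w u)
    column : ∀ u → sphere κ t s * ⟦ U u ⟧ ≡ ΣWords (suc κ) t (λ w → ⟦ U u ⟧ * ⟦ differ? s w u ⟧)
    column u = trans (*-comm (sphere κ t s) ⟦ U u ⟧)
                     (trans (cong (⟦ U u ⟧ *_) (sym (sphere-size κ t s u)))
                            (sym (ΣWords-* (suc κ) t ⟦ U u ⟧ _)))

  -- Each chosen word leaves at most a share `d / N` of the uncovered words, where `d` counts the
  -- words outside one sphere; initially all `N` words are uncovered.
  greedy : ∀ m → ∃ λ C → length C ≡ m × N ^ m * ∣ uncovered C ∣ ≤ d ^ m * N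
  greedy zero    = [] , refl , ≤-reflexive (cong (_+ 0) (trans (ΣWords-const (suc κ) t 1) (*-identityʳ N)))
  greedy (suc m) with greedy m
  ... | C , ∣C∣≡m , small with step (uncovered C)
  ... | w , shrinks = w ∷ C , cong suc ∣C∣≡m , (begin
    N * N ^ m * ∣ uncovered (w ∷ C) ∣     ≡⟨ lem N (N ^ m) _ ⟩
    N ^ m * (N * ∣ uncovered (w ∷ C) ∣)   ≤⟨ *-monoʳ-≤ (N ^ m) shrinks ⟩
    N ^ m * (d * ∣ uncovered C ∣)         ≡⟨ lem′ (N ^ m) d _ ⟩
    d * (N ^ m * ∣ uncovered C ∣)         ≤⟨ *-monoʳ-≤ d small ⟩
    d * (d ^ m * N)                       ≡⟨ *-assoc d (d ^ m) N ⟨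
    d * d ^ m * N                         ∎)
    where
    open ≤-Reasoning
    lem : ∀ a b c → a * b * c ≡ b * (a * c)
    lem = solve-∀
    lem′ : ∀ a b c → a * (b * c) ≡ b * (a * c)
    lem′ = solve-∀

  -- The hypothesis leaves fewer than one word uncovered, hence none.
  covers : ∀ m → d ^ m * N < N ^ m → ∃ λ C → length C ≡ m × Covers s C
  covers m dᵐN<Nᵐ with greedy m
  ... | C , ∣C∣≡m , small = C , ∣C∣≡m , λ u → uncovered-sound C u (⟦⟧-0 _ (ΣWords-0 (suc κ) t none u))
    where
    ⟦⟧-0 : ∀ b → ⟦ b ⟧ ≡ 0 → b ≡ false
    ⟦⟧-0 false _ = refl
    vanishes : ∀ c → N ^ m * c ≤ d ^ m * N → c ≡ 0
    vanishes zero    _     = refl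
    vanishes (suc c) Nᵐ*c≤ = contradiction (≤-trans (m≤m*n (N ^ m) (suc c)) Nᵐ*c≤) (<⇒≱ dᵐN<Nᵐ)
    none : ∣ uncovered C ∣ ≡ 0
    none = vanishes ∣ uncovered C ∣ small

sphere≤ : ∀ κ t s → sphere κ t s ≤ suc κ ^ t
sphere≤ κ zero    zero    = s≤s z≤n
sphere≤ κ zero    (suc s) = z≤n
sphere≤ κ (suc t) zero    = ≤-trans (sphere≤ κ t zero) (m≤m+n _ _)
sphere≤ κ (suc t) (suc s) = +-mono-≤ (sphere≤ κ t (suc s)) (*-monoʳ-≤ κ (sphere≤ κ t s))

-- Here `a` and `b` weigh an agreeing and a disagreeing letter. A greedy code needs about
-- `N / S * L` words, for spheres of size `S`, and at the popular distance `S` is at least `(a + κ *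
-- b) ^ t / (suc t * a ^ (t - s) * b ^ s)`. The bound multiplies the two estimates.
covering-code : ∀ κ t a b .{{_ : NonZero a}} → ∃₂ λ s (C : List (Vec (Fin (suc κ)) t)) →
  Covers s C ×
  length C * (a + κ * b) ^ t * a ^ s ≤ 2 * suc (suc κ * t) * suc t * suc κ ^ t * a ^ t * b ^ s
covering-code κ t a b = main
  where
  N = suc κ ^ t
  L = suc (suc κ * t)
  lem : ∀ x t W p → x * (t * W) * p ≡ x * t * (W * p)
  lem = solve-∀
  lem′ : ∀ x L t S p q → x * L * t * (S * p * q) ≡ x * S * (L * t * p * q)
  lem′ = solve-∀
  lem″ : ∀ N L t p q → (N + N) * (L * t * p * q) ≡ 2 * L * t * N * p * q
  lem″ = solve-∀
  main : _
  main with popular-radius κ a b t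
  ... | s , popular with sphere κ t s in eq
  ... | zero = contradiction (≤-trans (m^n>0 (a + κ * b) {{nz}} t) (≤-trans popular (≤-reflexive W*t≡0))) (λ ())
    where
    nz : NonZero (a + κ * b)
    nz = >-nonZero (≤-trans (>-nonZero⁻¹ a) (m≤m+n a _))
    W≡0 : weight κ a b t s ≡ 0
    W≡0 = m*n≡0⇒m≡0 (weight κ a b t s) (a ^ s) {{m^n≢0 a s}}
      (trans (sym (sphere-weight κ a b t s)) (cong (λ S → S * a ^ t * b ^ s) eq))
    W*t≡0 : suc t * weight κ a b t s ≡ 0
    W*t≡0 = trans (cong (suc t *_) W≡0) (*-zeroʳ (suc t))
  ... | S@(suc S′) = s , proj₁ code , proj₂ (proj₂ code) , (begin
    length (proj₁ code) * (a + κ * b) ^ t * a ^ s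
      ≡⟨ cong (λ m → m * (a + κ * b) ^ t * a ^ s) (proj₁ (proj₂ code)) ⟩
    suc x * L * (a + κ * b) ^ t * a ^ s
      ≤⟨ *-monoˡ-≤ (a ^ s) (*-monoʳ-≤ (suc x * L) popular) ⟩
    suc x * L * (suc t * weight κ a b t s) * a ^ s
      ≡⟨ lem (suc x * L) (suc t) (weight κ a b t s) (a ^ s) ⟩
    suc x * L * suc t * (weight κ a b t s * a ^ s)
      ≡⟨ cong (suc x * L * suc t *_) (sphere-weight κ a b t s) ⟨
    suc x * L * suc t * (sphere κ t s * a ^ t * b ^ s)
      ≡⟨ lem′ (suc x) L (suc t) (sphere κ t s) (a ^ t) (b ^ s) ⟩
    suc x * sphere κ t s * (L * suc t * a ^ t * b ^ s)
      ≤⟨ *-monoˡ-≤ (L * suc t * a ^ t * b ^ s) xS≤2N ⟩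
    (N + N) * (L * suc t * a ^ t * b ^ s)
      ≡⟨ lem″ N L (suc t) (a ^ t) (b ^ s) ⟩
    2 * L * suc t * N * a ^ t * b ^ s ∎)
    where
    open ≤-Reasoning
    x d m : ℕ
    -- With `suc x` above the exact quotient of `N` by `S`, every `suc x` greedy choices at least
    -- halve the uncovered words, and `L` halvings finish because `N < 2 ^ L`. Rounding up at most
    -- doubles the size: `suc x * S ≤ 2 * N`.
    x = N / S
    d = N ∸ sphere κ t s
    m = suc x * L
    S+d : sphere κ t s + d ≡ N
    S+d = m+[n∸m]≡n (sphere≤ κ t s)
    xS≤2N : suc x * sphere κ t s ≤ N + N
    xS≤2N = +-mono-≤ (sphere≤ κ t s) (≤-trans (≤-reflexive (cong (x *_) eq)) (m/n*n≤m N S))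
    d≤xS : d ≤ suc x * sphere κ t s
    d≤xS = ≤-trans (m∸n≤m N (sphere κ t s)) (≤-trans (≤-reflexive (m≡m%n+[m/n]*n N S))
             (≤-trans (+-monoˡ-≤ (x * S) (<⇒≤ (m%n<n N S))) (≤-reflexive (cong (suc x *_) (sym eq)))))
    N<2^L : N < 2 ^ L
    N<2^L = ≤-<-trans (^-monoˡ-≤ t (<⇒≤ (n<2^n (suc κ))))
              (≤-<-trans (≤-reflexive (^-*-assoc 2 (suc κ) t)) (^-monoʳ-< 2 (s≤s (s≤s z≤n)) (n<1+n (suc κ * t))))
    small : d ^ m * N < N ^ m
    small with d in d≡
    ... | zero = m^n>0 N {{m^n≢0 (suc κ) t}} m
    ... | d@(suc _) = begin-strict
      d ^ m * N          <⟨ *-monoʳ-< (d ^ m) {{m^n≢0 d m}} N<2^L ⟩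
      d ^ m * 2 ^ L      ≡⟨ *-comm (d ^ m) (2 ^ L) ⟩
      2 ^ L * d ^ m      ≤⟨ doublings d (sphere κ t s) x L (subst (_≤ suc x * sphere κ t s) d≡ d≤xS) ⟩
      (d + sphere κ t s) ^ m
        ≡⟨ cong (_^ m) (trans (cong (_+ sphere κ t s) (sym d≡)) (trans (+-comm _ (sphere κ t s)) S+d)) ⟩
      N ^ m              ∎
    code = Greedy.covers κ t s d S+d m small

covers-nonempty : ∀ {κ t s} {C : List (Vec (Fin (suc κ)) t)} → Covers s C → NonZero (length C)
covers-nonempty {t = t} {C = C} covers with C | covers (replicate t zero)
... | _ ∷ _ | _ = _

-- Codes for the walk and for the starting assignments

overhead : ∀ q t → 2 * suc (q * t) * suc t ≤ 2 * suc q * (suc t * suc t)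
overhead q t = begin
  2 * suc (q * t) * suc t      ≤⟨ *-monoˡ-≤ (suc t) (*-monoʳ-≤ 2 (m≤m+n (suc (q * t)) (q + t))) ⟩
  2 * (suc (q * t) + (q + t)) * suc t  ≡⟨ lem q t ⟩
  2 * suc q * (suc t * suc t)  ∎
  where
  open ≤-Reasoning
  lem : ∀ q t → 2 * (suc (q * t) + (q + t)) * suc t ≡ 2 * suc q * (suc t * suc t)
  lem = solve-∀

length-with-overhead : ∀ q D E → D < E → ∃ λ t → 2 * suc (q * t) * suc t * D ^ t < E ^ t
length-with-overhead q D E D<E with exponential-beats-quadratic (2 * suc q) D E D<E
... | t , small = t , ≤-<-trans (*-monoˡ-≤ (D ^ t) (overhead q t)) small

-- With `λ = A / B`, the code has at most `λ ^ suc gain` words. Writing the word length as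
-- `suc gain + (radius + radius)` builds in that it exceeds twice the radius.
record WalkCode (κ A B : ℕ) : Set where
  field
    radius gain : ℕ
    code        : List (Vec (Fin (suc κ)) (suc gain + (radius + radius)))
    covers      : Covers radius code
    size        : length code * B ^ suc gain ≤ A ^ suc gain

module _ (κ A B : ℕ) .{{_ : NonZero A}} (B≤A : B ≤ A)
         (drift : suc κ * A * B < A * A + κ * (B * B)) where

  -- The weights `A * A` and `B * B` are `λ` and its inverse, both times `A * B`. Thus `drift` says
  -- that μ > 1, and a suitable word length absorbs the polynomial overhead.
  walkCode : WalkCode κ A B
  walkCode with length-with-overhead (suc κ) (suc κ * A * B) (A * A + κ * (B * B)) drift
  ... | t , short with covering-code κ t (A * A) (B * B) {{m*n≢0 A A}}
  ... | s , C , covers , size = main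
    where
    open ≤-Reasoning
    P = 2 * suc (suc κ * t) * suc t
    c = length C
    instance
      c≢0 : NonZero c
      c≢0 = covers-nonempty covers
    lem : ∀ P q a b c e → P * q * a * (c * b * e) ≡ c * (P * (q * a * b)) * e
    lem = solve-∀
    lem′ : ∀ P q a b → P * q * (a * a) * b ≡ P * q * a * (a * b)
    lem′ = solve-∀
    square : ∀ m n → (m * m) ^ n ≡ m ^ (n + n)
    square m n = trans (*-^-distrib m m n) (sym (^-distribˡ-+-* m n n))
    -- This is `c < λ ^ (t - 2 s)` with the subtraction cleared, as `t > 2 s` is not yet known.
    balance : c * B ^ t * A ^ (s + s) < A ^ t * B ^ (s + s)
    balance = *-cancelˡ-< (P * suc κ ^ t * A ^ t) (c * B ^ t * A ^ (s + s)) (A ^ t * B ^ (s + s)) (begin-strict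
      P * suc κ ^ t * A ^ t * (c * B ^ t * A ^ (s + s))
        ≡⟨ lem P (suc κ ^ t) (A ^ t) (B ^ t) c _ ⟩
      c * (P * (suc κ ^ t * A ^ t * B ^ t)) * A ^ (s + s)
        ≡⟨ cong₂ (λ x y → c * (P * x) * y)
             (trans (*-^-distrib (suc κ * A) B t) (cong (_* B ^ t) (*-^-distrib (suc κ) A t)))
             (square A s) ⟨
      c * (P * (suc κ * A * B) ^ t) * (A * A) ^ s
        <⟨ *-monoˡ-< ((A * A) ^ s) {{m^n≢0 (A * A) s {{m*n≢0 A A}}}} (*-monoʳ-< c short) ⟩
      c * (A * A + κ * (B * B)) ^ t * (A * A) ^ s
        ≤⟨ size ⟩
      P * suc κ ^ t * (A * A) ^ t * (B * B) ^ s
        ≡⟨ cong₂ (λ x y → P * suc κ ^ t * x * y) (*-^-distrib A A t) (square B s) ⟩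
      P * suc κ ^ t * (A ^ t * A ^ t) * B ^ (s + s)
        ≡⟨ lem′ P (suc κ ^ t) (A ^ t) _ ⟩
      P * suc κ ^ t * A ^ t * (A ^ t * B ^ (s + s)) ∎)
    -- As `λ ≥ 1` and the code is nonempty, the strict inequality forces `t > 2 s`. The word length
    -- is abstracted so that it can then be matched with `suc j + (s + s)`.
    gains : ∀ {t} (C : List (Vec (Fin (suc κ)) t)) → NonZero (length C) → Covers s C →
            length C * B ^ t * A ^ (s + s) < A ^ t * B ^ (s + s) → WalkCode κ A B
    gains {t} C nonempty covers balance with suc (s + s) ≤? t
    ... | no t≤2s = contradiction balance (≤⇒≯ (begin
      A ^ t * B ^ (s + s)             ≡⟨ cong (λ x → A ^ t * B ^ x) (m+[n∸m]≡n t≤s+s) ⟨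
      A ^ t * B ^ (t + e)             ≡⟨ cong (A ^ t *_) (^-distribˡ-+-* B t e) ⟩
      A ^ t * (B ^ t * B ^ e)         ≤⟨ *-monoʳ-≤ (A ^ t) (*-monoʳ-≤ (B ^ t) (^-monoˡ-≤ e B≤A)) ⟩
      A ^ t * (B ^ t * A ^ e)         ≡⟨ lem″ (A ^ t) (B ^ t) (A ^ e) ⟩
      B ^ t * (A ^ t * A ^ e)         ≡⟨ cong (B ^ t *_) (^-distribˡ-+-* A t e) ⟨
      B ^ t * A ^ (t + e)             ≡⟨ cong (λ x → B ^ t * A ^ x) (m+[n∸m]≡n t≤s+s) ⟩
      B ^ t * A ^ (s + s)             ≤⟨ *-monoˡ-≤ (A ^ (s + s)) (m≤n*m (B ^ t) (length C) {{nonempty}}) ⟩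
      length C * B ^ t * A ^ (s + s)  ∎))
      where
      t≤s+s : t ≤ s + s
      t≤s+s = ≮⇒≥ t≤2s
      e : ℕ
      e = s + s ∸ t
      lem″ : ∀ a b c → a * (b * c) ≡ b * (a * c)
      lem″ = solve-∀
    ... | yes 2s<t with t ∸ suc (s + s) in eq
    ... | j with trans (sym (m+[n∸m]≡n 2s<t)) (trans (cong (suc (s + s) +_) eq) (cong suc (+-comm (s + s) j)))
    ... | refl = record
      { radius = s ; gain = j ; code = C ; covers = covers
      ; size = <⇒≤ (*-cancelʳ-< (A ^ (s + s) * B ^ (s + s)) (length C * B ^ suc j) (A ^ suc j) (begin-strict
          length C * B ^ suc j * (A ^ (s + s) * B ^ (s + s))
            ≡⟨ lem″ (length C) (B ^ suc j) (A ^ (s + s)) (B ^ (s + s)) ⟩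
          length C * (B ^ suc j * B ^ (s + s)) * A ^ (s + s)
            ≡⟨ cong (λ x → length C * x * A ^ (s + s)) (^-distribˡ-+-* B (suc j) (s + s)) ⟨
          length C * B ^ (suc j + (s + s)) * A ^ (s + s)
            <⟨ balance ⟩
          A ^ (suc j + (s + s)) * B ^ (s + s)
            ≡⟨ cong (_* B ^ (s + s)) (^-distribˡ-+-* A (suc j) (s + s)) ⟩
          A ^ suc j * A ^ (s + s) * B ^ (s + s)
            ≡⟨ *-assoc (A ^ suc j) _ _ ⟩
          A ^ suc j * (A ^ (s + s) * B ^ (s + s)) ∎)) }
      where
      lem″ : ∀ c b a′ b′ → c * b * (a′ * b′) ≡ c * (b * b′) * a′
      lem″ = solve-∀
    main : WalkCode κ A B
    main = gains C c≢0 covers balance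

-- The two sides differ by (A - B) (A - κ B), where A = κ B + 1.
drift : ∀ κ B .{{_ : NonZero κ}} → let A = suc (κ * B) in suc κ * A * B < A * A + κ * (B * B)
drift (suc κ) B = ≤-trans (s≤s (m≤m+n _ (κ * B))) (≤-reflexive (lem κ B))
  where
  lem : ∀ κ B → suc (suc (suc κ) * suc (suc κ * B) * B + κ * B)
                ≡ suc (suc κ * B) * suc (suc κ * B) + suc κ * (B * B)
  lem = solve-∀

-- In terms of `λ = A / B`, the field `size` bounds the number of codewords times the cost
-- `λ ^ radius` of walking away from them by `(X / Y) ^ suc block⁻`, the share of the running time
-- granted to one block.
record StartCode (A B X Y : ℕ) : Set where
  field
    radius block⁻ : ℕ
    code          : List (Vec (Fin 2) (suc block⁻))
    covers        : Covers radius code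
    size          : length code * A ^ radius * Y ^ suc block⁻ ≤ X ^ suc block⁻ * B ^ radius

startCode : ∀ A B X Y .{{_ : NonZero A}} → 2 * A * Y < (A + 1 * B) * X → StartCode A B X Y
startCode A B X Y D<E with length-with-overhead 2 (2 * A * Y) ((A + 1 * B) * X) D<E
-- The overhead alone is at least 2, so the word length found is never 0.
... | zero  , s≤s ()
-- Weights `A` and `B` for an equal and a different bit give `|C| * λ ^ s` of about
-- `(2 λ / (λ + 1)) ^ b`; the gap up to `X / Y` absorbs the overhead `P`.
... | b@(suc b⁻) , short with covering-code 1 b A B
... | s , C , covers , size = record
  { radius = s ; block⁻ = b⁻ ; code = C ; covers = covers
  ; size = *-cancelˡ-≤ ((A + 1 * B) ^ b) {{m^n≢0 (A + 1 * B) b {{A+B≢0}}}} (begin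
      (A + 1 * B) ^ b * (length C * A ^ s * Y ^ b)
        ≡⟨ lem ((A + 1 * B) ^ b) (length C) (A ^ s) (Y ^ b) ⟩
      length C * (A + 1 * B) ^ b * A ^ s * Y ^ b
        ≤⟨ *-monoˡ-≤ (Y ^ b) size ⟩
      P * 2 ^ b * A ^ b * B ^ s * Y ^ b
        ≡⟨ lem′ P (2 ^ b) (A ^ b) (B ^ s) (Y ^ b) ⟩
      P * (2 ^ b * A ^ b * Y ^ b) * B ^ s
        ≡⟨ cong (λ x → P * x * B ^ s) (trans (*-^-distrib (2 * A) Y b) (cong (_* Y ^ b) (*-^-distrib 2 A b))) ⟨
      P * (2 * A * Y) ^ b * B ^ s
        ≤⟨ *-monoˡ-≤ (B ^ s) (<⇒≤ short) ⟩
      ((A + 1 * B) * X) ^ b * B ^ s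
        ≡⟨ cong (_* B ^ s) (*-^-distrib (A + 1 * B) X b) ⟩
      (A + 1 * B) ^ b * X ^ b * B ^ s
        ≡⟨ *-assoc ((A + 1 * B) ^ b) _ _ ⟩
      (A + 1 * B) ^ b * (X ^ b * B ^ s) ∎) }
  where
  open ≤-Reasoning
  P : ℕ
  P = 2 * suc (2 * b) * suc b
  A+B≢0 : NonZero (A + 1 * B)
  A+B≢0 = >-nonZero (≤-trans (>-nonZero⁻¹ A) (m≤m+n A _))
  lem : ∀ e c a y → e * (c * a * y) ≡ c * e * a * y
  lem = solve-∀
  lem′ : ∀ p q a b y → p * q * a * b * y ≡ p * (q * a * y) * b
  lem′ = solve-∀

-- For `A = κ * B + 1`, the summand 1 costs an extra `2 * Y` on the left. Multiplying the
-- hypothesis, whose integer gap is at least 1, by `B` yields a gap of `B`; this is why `B = 2 * Y`.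
rate : ∀ κ X Y → 2 * κ * Y < suc κ * X →
       2 * suc (κ * (2 * Y)) * Y < (suc (κ * (2 * Y)) + 1 * (2 * Y)) * X
rate κ X Y below = begin-strict
  2 * suc (κ * (2 * Y)) * Y                        <⟨ n<1+n _ ⟩
  1 + 2 * suc (κ * (2 * Y)) * Y                    ≤⟨ +-monoˡ-≤ _ (1≤X X below) ⟩
  X + 2 * suc (κ * (2 * Y)) * Y                    ≡⟨ lem κ X Y ⟩
  2 * Y * suc (2 * κ * Y) + X                      ≤⟨ +-monoˡ-≤ X (*-monoʳ-≤ (2 * Y) below) ⟩
  2 * Y * (suc κ * X) + X                          ≡⟨ lem′ κ X Y ⟩
  (suc (κ * (2 * Y)) + 1 * (2 * Y)) * X            ∎
  where
  open ≤-Reasoning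
  1≤X : ∀ X → 2 * κ * Y < suc κ * X → 1 ≤ X
  1≤X zero    below = contradiction (≤-trans below (≤-reflexive (*-zeroʳ (suc κ)))) (λ ())
  1≤X (suc X) below = s≤s z≤n
  lem : ∀ κ X Y → X + 2 * suc (κ * (2 * Y)) * Y ≡ 2 * Y * suc (2 * κ * Y) + X
  lem = solve-∀
  lem′ : ∀ κ X Y → 2 * Y * (suc κ * X) + X ≡ (suc (κ * (2 * Y)) + 1 * (2 * Y)) * X
  lem′ = solve-∀

-- Bounded evaluation

truth : Tree → Bool
truth nil     = false
truth (_ ∙ _) = true

check : ∀ {c d} → T (c ≤ᵇ d) → c ≤ d
check {c} {d} = ≤ᵇ⇒≤ c d

tls nils : ∀ {f} {ar : Fin f → ℕ} {v} → ℕ → Expr ar v → Expr ar v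
tls zero    e = e
tls (suc j) e = tl (tls j e)
nils zero    e = e
nils (suc j) e = cons (constant nil) (nils j e)

-- The number of steps is bounded by a numeral, which Agda computes, plus a
-- list of symbolic summands.
record Within (t c : ℕ) (ds : List ℕ) : Set where
  constructor within
  field
    steps≤ : t ≤ c + sum ds

one-more : ∀ {t c ds} → Within t c ds → Within (suc t) (suc c) ds
one-more (within t≤) = within (s≤s t≤)

joined : ∀ {s t c c′ ds ds′} → Within s c ds → Within t c′ ds′ → Within (s + t) (c + c′) (ds ++ ds′)
joined {c = c} {c′} {ds} {ds′} (within s≤) (within t≤) = within (≤-trans (+-mono-≤ s≤ t≤) (≤-reflexive
  (trans (lem c (sum ds) c′ (sum ds′)) (cong (c + c′ +_) (sym (sum-++ ds ds′))))))
  where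
  lem : ∀ a b c d → a + b + (c + d) ≡ a + c + (b + d)
  lem = solve-∀

module Evaluation (P : Program) where

  open Program P

  record Eval {v} (ρ : Vec Tree v) (e : Expr arity v) (x : Tree) (c : ℕ) (ds : List ℕ) : Set where
    constructor eval
    field
      steps      : ℕ
      derivation : P , ρ ⊢ e ⇓ x ∶ steps
      bounded    : Within steps c ds

  record EvalArgs {v m} (ρ : Vec Tree v) (es : Vec (Expr arity v) m) (xs : Vec Tree m)
                  (c : ℕ) (ds : List ℕ) : Set where
    constructor evalArgs
    field
      steps      : ℕ
      derivation : P , ρ ⊢ es ⇓* xs ∶ steps
      bounded    : Within steps c ds

  record Runs (g : Fin functions) (xs : Vec Tree (arity g)) (y : Tree) (b : ℕ) : Set where
    constructor runs
    field
      steps      : ℕ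
      derivation : P , xs ⊢ body g ⇓ y ∶ steps
      bounded    : steps ≤ b

  private variable
    v m c c′ : ℕ
    ds ds′ : List ℕ
    ρ : Vec Tree v
    x y z : Tree
    e e₁ e₂ e₃ : Expr arity v

  varᴱ : ∀ i → Eval ρ (var i) (Vec.lookup ρ i) 1 []
  varᴱ i = eval 1 (var i) (within ≤-refl)

  constᴱ : ∀ x → Eval ρ (constant x) x 1 []
  constᴱ x = eval 1 (constant x) (within ≤-refl)

  consᴱ : Eval ρ e₁ x c ds → Eval ρ e₂ y c′ ds′ → Eval ρ (cons e₁ e₂) (x ∙ y) (suc (c + c′)) (ds ++ ds′)
  consᴱ (eval s p s≤) (eval t q t≤) = eval (suc (s + t)) (cons p q) (one-more (joined s≤ t≤))

  hdᴱ : Eval ρ e x c ds → Eval ρ (hd e) (head x) (suc c) ds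
  hdᴱ (eval s p s≤) = eval (suc s) (hd p) (one-more s≤)

  tlᴱ : Eval ρ e x c ds → Eval ρ (tl e) (tail x) (suc c) ds
  tlᴱ (eval s p s≤) = eval (suc s) (tl p) (one-more s≤)

  iteᵀ : Eval ρ e₁ x c ds → truth x ≡ true → Eval ρ e₂ y c′ ds′ →
         Eval ρ (ite e₁ e₂ e₃) y (suc (c + c′)) (ds ++ ds′)
  iteᵀ {x = _ ∙ _} (eval s p s≤) _ (eval t q t≤) =
    eval (suc (s + t)) (ite-true p q) (one-more (joined s≤ t≤))

  iteᶠ : Eval ρ e₁ x c ds → truth x ≡ false → Eval ρ e₃ y c′ ds′ →
         Eval ρ (ite e₁ e₂ e₃) y (suc (c + c′)) (ds ++ ds′)
  iteᶠ {x = nil} (eval s p s≤) _ (eval t q t≤) =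
    eval (suc (s + t)) (ite-false p q) (one-more (joined s≤ t≤))

  letᴱ : Eval ρ e₁ x c ds → Eval (x ∷ ρ) e₂ y c′ ds′ →
         Eval ρ (let′ e₁ e₂) y (suc (c + c′)) (ds ++ ds′)
  letᴱ (eval s p s≤) (eval t q t≤) = eval (suc (s + t)) (let′ p q) (one-more (joined s≤ t≤))

  []ᴱ : EvalArgs ρ [] [] 0 []
  []ᴱ = evalArgs 0 [] (within z≤n)

  infixr 5 _∷ᴱ_
  _∷ᴱ_ : ∀ {es : Vec (Expr arity v) m} {xs} {ρ : Vec Tree v} →
         Eval ρ e x c ds → EvalArgs ρ es xs c′ ds′ →
         EvalArgs ρ (e ∷ es) (x ∷ xs) (c + c′) (ds ++ ds′)
  eval s p s≤ ∷ᴱ evalArgs t q t≤ = evalArgs (s + t) (p ∷ q) (joined s≤ t≤)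

  callᴱ : ∀ {g b es xs} → EvalArgs ρ es xs c ds → Runs g xs y b →
          Eval ρ (call g es) y (suc c) (ds ++ b ∷ [])
  callᴱ {c = c} {ds = ds} {b = b} (evalArgs s p s≤) (runs t q t≤) =
    eval (suc (s + t)) (call p q)
      (subst (λ c → Within (suc (s + t)) (suc c) (ds ++ b ∷ [])) (+-identityʳ c)
        (one-more (joined {c′ = 0} {ds′ = b ∷ []} s≤ (within (≤-trans t≤ (m≤m+n b 0))))))

  numeral≤ : c ≤ c′ → Eval ρ e x c ds → Eval ρ e x c′ ds
  numeral≤ c≤c′ (eval s p (within s≤)) = eval s p (within (≤-trans s≤ (+-monoˡ-≤ _ c≤c′)))

  value≡ : x ≡ y → Eval ρ e x c ds → Eval ρ e y c ds
  value≡ refl ev = ev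

  runs-body : ∀ {g xs b} → Eval xs (body g) y c ds → c + sum ds ≤ b → Runs g xs y b
  runs-body (eval s p (within s≤)) ≤b = runs s p (≤-trans s≤ ≤b)

  runs≤ : ∀ {g xs b b′} → b ≤ b′ → Runs g xs y b → Runs g xs y b′
  runs≤ b≤b′ (runs s p s≤) = runs s p (≤-trans s≤ b≤b′)

  -- The tail of `nil` is `nil`, so repeated tails of a unary number compute truncated subtraction.
  tls-encodeℕ : ∀ j {r} {ρ : Vec Tree v} → Eval ρ e (encodeℕ r) c ds →
                Eval ρ (tls j e) (encodeℕ (r ∸ j)) c (j ∷ ds)
  tls-encodeℕ zero (eval s p (within s≤)) = eval s p (within s≤)
  tls-encodeℕ {c = c} {ds = ds} (suc j) {r} ev with tls-encodeℕ j ev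
  ... | eval s p (within s≤) = eval (suc s) (subst (λ x → P , _ ⊢ _ ⇓ x ∶ suc s) (tail-encode (r ∸ j) r j refl) (tl p))
        (within (≤-trans (s≤s s≤) (≤-reflexive (sym (+-suc c _)))))
    where
    tail-encode : ∀ x r j → r ∸ j ≡ x → tail (encodeℕ x) ≡ encodeℕ (r ∸ suc j)
    tail-encode x r zero    refl = tail-pred r
      where
      tail-pred : ∀ r → tail (encodeℕ r) ≡ encodeℕ (r ∸ 1)
      tail-pred zero    = refl
      tail-pred (suc r) = refl
    tail-encode x zero    (suc j) refl = refl
    tail-encode x (suc r) (suc j) eq   = tail-encode x r j eq

  nils-encodeℕ : ∀ j {r} {ρ : Vec Tree v} → Eval ρ e (encodeℕ r) c ds →
                 Eval ρ (nils j e) (encodeℕ (j + r)) c (2 * j ∷ ds)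
  nils-encodeℕ zero (eval s p (within s≤)) = eval s p (within s≤)
  nils-encodeℕ {c = c} {ds = ds} (suc j) {r} ev with nils-encodeℕ j ev
  ... | eval s p (within s≤) = eval (suc (1 + s)) (cons (constant nil) p)
        (within (≤-trans (s≤s (s≤s s≤)) (≤-reflexive (lem c j (sum ds)))))
    where
    lem : ∀ c j d → 2 + (c + (2 * j + d)) ≡ c + (2 * suc j + d)
    lem = solve-∀

at : ℕ → Tree → Tree
at zero    σ = head σ
at (suc i) σ = at i (tail σ)

upd : ℕ → Tree → Tree → Tree
upd zero    x σ = x ∙ tail σ
upd (suc i) x σ = head σ ∙ upd i x (tail σ)

val fixed : Tree → ℕ → Bool
val   σ i = truth (head (at i σ))
fixed σ i = truth (tail (at i σ))

at-upd : ∀ i x σ → at i (upd i x σ) ≡ x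
at-upd zero    x σ = refl
at-upd (suc i) x σ = at-upd i x (tail σ)

at-upd-≢ : ∀ i j x σ → i ≢ j → at j (upd i x σ) ≡ at j σ
at-upd-≢ zero    zero    x σ i≢j with () ← i≢j refl
at-upd-≢ zero    (suc j) x σ i≢j = refl
at-upd-≢ (suc i) zero    x σ i≢j = refl
at-upd-≢ (suc i) (suc j) x σ i≢j = at-upd-≢ i j x (tail σ) (i≢j ∘ cong suc)

-- The program

pattern v₀ = var zero
pattern v₁ = var (suc zero)
pattern v₂ = var (suc (suc zero))
pattern v₃ = var (suc (suc (suc zero)))
pattern v₄ = var (suc (suc (suc (suc zero))))
pattern v₅ = var (suc (suc (suc (suc (suc zero)))))
pattern v₆ = var (suc (suc (suc (suc (suc (suc zero))))))

pattern getᶠ     = zero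
pattern putᶠ     = suc getᶠ
pattern testᶠ    = suc putᶠ
pattern findᶠ    = suc testᶠ
pattern searchᶠ  = suc findᶠ
pattern tryᶠ     = suc searchᶠ
pattern bruteᶠ   = suc tryᶠ
pattern markᶠ    = suc bruteᶠ
pattern collectᶠ = suc markᶠ
pattern branchᶠ  = suc collectᶠ
pattern flipsᶠ   = suc branchᶠ
pattern walkᶠ    = suc flipsᶠ
pattern startᶠ   = suc walkᶠ
pattern startsᶠ  = suc startᶠ
pattern prependᶠ = suc startsᶠ

yes′ : Tree
yes′ = nil ∙ nil

arities : Fin 15 → ℕ
arities getᶠ     = 2
arities putᶠ     = 3
arities testᶠ    = 3
arities findᶠ    = 3
arities searchᶠ  = 3
arities tryᶠ     = 4
arities bruteᶠ   = 4
arities markᶠ    = 2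
arities collectᶠ = 6
arities branchᶠ  = 5
arities flipsᶠ   = 3
arities walkᶠ    = 3
arities startᶠ   = 4
arities startsᶠ  = 5
arities prependᶠ = 2

-- A state σ is a list of cells (value ∙ fixed), indexed by the variables; cells
-- beyond its end read as nil, that is, false and not fixed.  The functions with a
-- radius and a formula among their arguments decide whether the formula has a
-- model within the radius of σ that agrees with σ on the fixed variables.  The
-- comment above each body names its arguments v₀, v₁, ….
module SearchProgram (clauses gain block radius : ℕ) (walkTable startTable : Tree) where

  private
    E : ℕ → Set
    E = Expr arities

    no-E yes-E : ∀ {v} → E v
    no-E  = constant nil
    yes-E = constant yes′

    _or_ : ∀ {v} → E v → E v → E v
    e₁ or e₂ = ite e₁ yes-E e₂

  bodies : (g : Fin 15) → E (arities g)
  -- index, state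
  bodies getᶠ  = ite v₀ (call getᶠ (tl v₀ ∷ tl v₁ ∷ [])) (hd v₁)
  -- index, cell, state
  bodies putᶠ  = ite v₀ (cons (hd v₂) (call putᶠ (tl v₀ ∷ v₁ ∷ tl v₂ ∷ []))) (cons v₁ (tl v₂))
  -- clause, state, flag: are all literals false (and, if flagged, not fixed)?
  bodies testᶠ = ite v₀
    (let′ (call getᶠ (hd (hd v₀) ∷ v₁ ∷ []))
      (ite (ite (hd v₀) (tl (hd v₁)) (ite (tl (hd v₁)) no-E yes-E)) no-E
        (ite (ite v₃ (tl v₀) no-E) no-E
          (call testᶠ (tl v₁ ∷ v₂ ∷ v₃ ∷ [])))))
    yes-E
  -- clauses, state, flag
  bodies findᶠ = ite v₀
    (ite (call testᶠ (hd v₀ ∷ v₁ ∷ v₂ ∷ [])) (cons no-E (hd v₀))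
      (call findᶠ (tl v₀ ∷ v₁ ∷ v₂ ∷ [])))
    no-E
  -- radius, state, formula: backtracking that fixes every flipped variable
  bodies searchᶠ = let′ (call findᶠ (v₂ ∷ v₁ ∷ no-E ∷ []))
    (ite v₀ (ite v₁ (call tryᶠ (tl v₀ ∷ tl v₁ ∷ v₂ ∷ v₃ ∷ [])) no-E) yes-E)
  -- clause, radius, state, formula
  bodies tryᶠ = ite v₀
    (ite (tl (call getᶠ (hd (hd v₀) ∷ v₂ ∷ [])))
      (call tryᶠ (tl v₀ ∷ v₁ ∷ v₂ ∷ v₃ ∷ []))
      (call searchᶠ (v₁ ∷ call putᶠ (hd (hd v₀) ∷ cons (tl (hd v₀)) yes-E ∷ v₂ ∷ []) ∷ v₃ ∷ [])
        or call tryᶠ (tl v₀ ∷ v₁ ∷ v₂ ∷ v₃ ∷ [])))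
    no-E
  -- list of clauses, radius, state, formula: tries all values of the variables of the list
  bodies bruteᶠ = ite v₀
    (ite (hd v₀)
      (call bruteᶠ (cons (tl (hd v₀)) (tl v₀) ∷ v₁ ∷
         call putᶠ (hd (hd (hd v₀)) ∷ constant (yes′ ∙ yes′) ∷ v₂ ∷ []) ∷ v₃ ∷ [])
       or
       call bruteᶠ (cons (tl (hd v₀)) (tl v₀) ∷ v₁ ∷
         call putᶠ (hd (hd (hd v₀)) ∷ constant (nil ∙ yes′) ∷ v₂ ∷ []) ∷ v₃ ∷ []))
      (call bruteᶠ (tl v₀ ∷ v₁ ∷ v₂ ∷ v₃ ∷ [])))
    (call searchᶠ (v₁ ∷ v₂ ∷ v₃ ∷ []))
  -- clause, state
  bodies markᶠ = ite v₀
    (call markᶠ (tl v₀ ∷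
      call putᶠ (hd (hd v₀) ∷ cons (hd (call getᶠ (hd (hd v₀) ∷ v₁ ∷ []))) yes-E ∷ v₁ ∷ []) ∷ []))
    v₁
  -- number of missing clauses, collected clauses, marked state, radius, state, formula
  bodies collectᶠ = ite v₀
    (let′ (call findᶠ (v₅ ∷ v₂ ∷ yes-E ∷ []))
      (ite v₀
        (call collectᶠ (tl v₁ ∷ cons (tl v₀) v₂ ∷ call markᶠ (tl v₀ ∷ v₃ ∷ []) ∷ v₄ ∷ v₅ ∷ v₆ ∷ []))
        (call bruteᶠ (v₂ ∷ v₄ ∷ v₃ ∷ v₆ ∷ []))))
    (call branchᶠ (constant walkTable ∷ v₁ ∷ v₃ ∷ v₄ ∷ v₅ ∷ []))
  -- codewords, collected clauses, radius, state, formula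
  bodies branchᶠ = ite v₀
    (call walkᶠ (tls gain v₂ ∷ call flipsᶠ (hd v₀ ∷ v₁ ∷ v₃ ∷ []) ∷ v₄ ∷ [])
      or call branchᶠ (tl v₀ ∷ v₁ ∷ v₂ ∷ v₃ ∷ v₄ ∷ []))
    no-E
  -- codeword, collected clauses, state
  bodies flipsᶠ = ite v₁
    (call flipsᶠ (tl v₀ ∷ tl v₁ ∷
      let′ (call getᶠ (hd v₀ ∷ hd v₁ ∷ []))
        (ite v₀ (call putᶠ (hd v₀ ∷ cons (tl v₀) no-E ∷ v₃ ∷ [])) v₃) ∷ []))
    v₂
  -- radius, state, formula
  bodies walkᶠ = ite v₀
    (call collectᶠ (constant (encodeℕ clauses) ∷ no-E ∷ v₁ ∷ v₀ ∷ v₁ ∷ v₂ ∷ []))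
    (call searchᶠ (no-E ∷ v₁ ∷ v₂ ∷ []))
  -- number of missing variables, radius, state, formula
  bodies startᶠ = ite v₀
    (call startsᶠ (constant startTable ∷ tls block v₀ ∷ nils radius v₁ ∷ v₂ ∷ v₃ ∷ []))
    (call walkᶠ (v₁ ∷ v₂ ∷ v₃ ∷ []))
  -- codewords, number of missing variables, radius, state, formula
  bodies startsᶠ = ite v₀
    (call startᶠ (v₁ ∷ v₂ ∷ call prependᶠ (hd v₀ ∷ v₃ ∷ []) ∷ v₄ ∷ [])
      or call startsᶠ (tl v₀ ∷ v₁ ∷ v₂ ∷ v₃ ∷ v₄ ∷ []))
    no-E
  -- codeword, state
  bodies prependᶠ = ite v₀ (cons (hd v₀) (call prependᶠ (tl v₀ ∷ v₁ ∷ []))) v₁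

  searchProgram : Program
  -- The search begins with all variables missing, radius 0 and the empty state; radius and state
  -- grow together, block by block.
  searchProgram = program 15 arities bodies (call startᶠ (hd v₀ ∷ no-E ∷ no-E ∷ tl v₀ ∷ []))

-- Clauses, codewords and states as trees, and the subroutines on them

_≡ᵇ_ : Bool → Bool → Bool
true  ≡ᵇ b = b
false ≡ᵇ b = not b

Lits : ℕ → Set
Lits n = List (Literal n)

module _ {n : ℕ} where

  open Literal using (sign)

  encᶜ : Lits n → Tree
  encᶜ = encodeList encodeLiteral

  encᶠ : List (Lits n) → Tree
  encᶠ = encodeList encᶜ

  index : Literal n → ℕ
  index l = toℕ (Literal.var l)

  -- With the flag set, literals on fixed variables count as good.
  good : Bool → Tree → Literal n → Bool
  good flag σ l = (val σ (index l) ≡ᵇ sign l) ∨ (flag ∧ fixed σ (index l))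

  mark : Lits n → Tree → Tree
  mark []      σ = σ
  mark (l ∷ C) σ = mark C (upd (index l) (head (at (index l) σ) ∙ yes′) σ)

  -- A position beyond the end of the clause leaves the state alone. So one alphabet of `k` letters
  -- serves clauses of every size up to `k`.
  flip : ℕ → Lits n → Tree → Tree
  flip i       []      σ = σ
  flip zero    (l ∷ C) σ = upd (index l) (encodeBool (sign l) ∙ nil) σ
  flip (suc i) (l ∷ C) σ = flip i C σ

  flips : ∀ {k t} → Vec (Fin k) t → List (Lits n) → Tree → Tree
  flips []      _       σ = σ
  flips (x ∷ w) []      σ = σ
  flips (x ∷ w) (C ∷ G) σ = flips w G (flip (toℕ x) C σ)

accessCost : ℕ → ℕ
accessCost n = n * 20

findCost : ℕ → ℕ → ℕ → ℕ
findCost n k m = suc m * (suc k * (accessCost n + 50) + 20)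

-- The clause found is wrapped in a cell, because the empty clause is itself encoded as `nil`.
data Found {n} (flag : Bool) (σ : Tree) (Fs : List (Lits n)) : Tree → Set where
  found : ∀ C → C ∈ Fs → any (good flag σ) C ≡ false → Found flag σ Fs (nil ∙ encᶜ C)
  none  : All (λ C → any (good flag σ) C ≡ true) Fs → Found flag σ Fs nil

encodeWord : ∀ {k t} → Vec (Fin k) t → Tree
encodeWord []      = nil
encodeWord (x ∷ w) = encodeℕ (toℕ x) ∙ encodeWord w

bit : Fin 2 → Bool
bit zero    = false
bit (suc _) = true

encodeStart : ∀ {b} → Vec (Fin 2) b → Tree
encodeStart []      = nil
encodeStart (x ∷ w) = (encodeBool (bit x) ∙ nil) ∙ encodeStart w

truth-encodeBool : ∀ b → truth (encodeBool b) ≡ b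
truth-encodeBool false = refl
truth-encodeBool true  = refl

prepend : Tree → Tree → Tree
prepend nil     σ = σ
prepend (x ∙ w) σ = x ∙ prepend w σ

-- Only the spine counts: prepending a word shares its entries.
size : Tree → ℕ
size nil     = 1
size (x ∙ w) = suc (size w)

module Subroutines (clauses gain block radius : ℕ) (walkTable startTable : Tree) where

  open SearchProgram clauses gain block radius walkTable startTable public
  open Evaluation searchProgram public

  module _ {g : Fin 15} {xs : Vec Tree (arities g)} {y : Tree} {c : ℕ} (d : ℕ) where

    finish₀ : Eval xs (bodies g) y c [] → {T (c ≤ᵇ d)} → Runs g xs y d
    finish₀ ev {ok} = runs-body ev (≤-trans (≤-reflexive (+-identityʳ c)) (≤ᵇ⇒≤ c d ok))

    finish₁ : ∀ {p} → Eval xs (bodies g) y c (p ∷ []) → {T (c ≤ᵇ d)} → Runs g xs y (d + p)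
    finish₁ {p} ev {ok} = runs-body ev (+-mono-≤ (≤ᵇ⇒≤ c d ok) (≤-reflexive (+-identityʳ p)))

    -- With the numeral on the right, the bound does not unfold during unification.
    finish₁′ : ∀ {p} → Eval xs (bodies g) y c (p ∷ []) → {T (c ≤ᵇ d)} → Runs g xs y (p + d)
    finish₁′ {p} ev {ok} = runs≤ (≤-reflexive (+-comm d p)) (finish₁ ev {ok})

    finish₂ : ∀ {p q} → Eval xs (bodies g) y c (p ∷ q ∷ []) → {T (c ≤ᵇ d)} → Runs g xs y (p + d + q)
    finish₂ {p} {q} ev {ok} = runs-body ev
      (≤-trans (+-monoˡ-≤ _ (≤ᵇ⇒≤ c d ok)) (≤-reflexive (lem d p q)))
      where
      lem : ∀ d p q → d + (p + (q + 0)) ≡ p + d + q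
      lem = solve-∀

    finish₃ : ∀ {p q r} → Eval xs (bodies g) y c (p ∷ q ∷ r ∷ []) → {T (c ≤ᵇ d)} →
              Runs g xs y (p + q + d + r)
    finish₃ {p} {q} {r} ev {ok} = runs-body ev
      (≤-trans (+-monoˡ-≤ _ (≤ᵇ⇒≤ c d ok)) (≤-reflexive (lem d p q r)))
      where
      lem : ∀ d p q r → d + (p + (q + (r + 0))) ≡ p + q + d + r
      lem = solve-∀

    finish₄ : ∀ {p q r s} → Eval xs (bodies g) y c (p ∷ q ∷ r ∷ s ∷ []) → {T (c ≤ᵇ d)} →
              Runs g xs y (p + (q + (r + s)) + d)
    finish₄ {p} {q} {r} {s} ev {ok} = runs-body ev (≤-trans (+-mono-≤ (≤ᵇ⇒≤ c d ok)
      (≤-reflexive (cong (λ x → p + (q + (r + x))) (+-identityʳ s)))) (≤-reflexive (+-comm d _)))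

  slack : ∀ {g xs y b} b′ → Runs g xs y b → Runs g xs y (b + b′)
  slack b′ = runs≤ (m≤m+n _ b′)

  slackˡ : ∀ {g xs y b} b′ → Runs g xs y b → Runs g xs y (b′ + b)
  slackˡ b′ = runs≤ (m≤n+m _ b′)

  get-runs : ∀ i σ → Runs getᶠ (encodeℕ i ∷ σ ∷ []) (at i σ) (suc i * 10)
  get-runs zero    σ = finish₀ 10 (iteᶠ (varᴱ _) refl (hdᴱ (varᴱ _)))
  get-runs (suc i) σ = finish₁ 10
    (iteᵀ (varᴱ _) refl (callᴱ (tlᴱ (varᴱ _) ∷ᴱ tlᴱ (varᴱ _) ∷ᴱ []ᴱ) (get-runs i (tail σ))))

  put-runs : ∀ i x σ → Runs putᶠ (encodeℕ i ∷ x ∷ σ ∷ []) (upd i x σ) (suc i * 20)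
  put-runs zero    x σ = finish₀ 20 (iteᶠ (varᴱ _) refl (consᴱ (varᴱ _) (tlᴱ (varᴱ _))))
  put-runs (suc i) x σ = finish₁ 20
    (iteᵀ (varᴱ _) refl (consᴱ (hdᴱ (varᴱ _))
      (callᴱ (tlᴱ (varᴱ _) ∷ᴱ varᴱ _ ∷ᴱ tlᴱ (varᴱ _) ∷ᴱ []ᴱ) (put-runs i x (tail σ)))))

  prepend-runs : ∀ w σ → Runs prependᶠ (w ∷ σ ∷ []) (prepend w σ) (size w * 10)
  prepend-runs nil     σ = finish₀ 10 (iteᶠ (varᴱ _) refl (varᴱ _))
  prepend-runs (x ∙ w) σ = finish₁ 10
    (iteᵀ (varᴱ _) refl (consᴱ (hdᴱ (varᴱ _))
      (callᴱ (tlᴱ (varᴱ _) ∷ᴱ varᴱ _ ∷ᴱ []ᴱ) (prepend-runs w σ))))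

  module _ {n : ℕ} where

    open Literal using (sign)

    access : ℕ
    access = accessCost n

    get-lit : ∀ (l : Literal n) σ → Runs getᶠ (encodeℕ (index l) ∷ σ ∷ []) (at (index l) σ) access
    get-lit l σ = runs≤ (*-mono-≤ (toℕ<n (Literal.var l)) (check {10} {20} _)) (get-runs (index l) σ)

    put-lit : ∀ (l : Literal n) x σ →
              Runs putᶠ (encodeℕ (index l) ∷ x ∷ σ ∷ []) (upd (index l) x σ) access
    put-lit l x σ = runs≤ (*-monoˡ-≤ 20 (toℕ<n (Literal.var l))) (put-runs (index l) x σ)

    literal-true : ∀ {v} {ρ : Vec Tree v} {e₁ e₂ x} b → Eval ρ e₁ x 2 [] → Eval ρ e₂ (encodeBool b) 3 [] →
      ∃ λ z → Eval ρ (ite e₁ e₂ (ite e₂ (constant nil) (constant yes′))) z 9 [] × truth z ≡ (truth x ≡ᵇ b)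
    literal-true {x = nil} true  p q = nil  , numeral≤ (check _) (iteᶠ p refl (iteᵀ q refl (constᴱ nil))) , refl
    literal-true {x = nil} false p q = yes′ , numeral≤ (check _) (iteᶠ p refl (iteᶠ q refl (constᴱ yes′))) , refl
    literal-true {x = _ ∙ _} b   p q = encodeBool b , numeral≤ (check _) (iteᵀ p refl q) , truth-encodeBool b

    flagged : ∀ {v} {ρ : Vec Tree v} {e₁ e₂ x} flag → Eval ρ e₁ (encodeBool flag) 1 [] → Eval ρ e₂ x 2 [] →
      ∃ λ z → Eval ρ (ite e₁ e₂ (constant nil)) z 4 [] × truth z ≡ (flag ∧ truth x)
    flagged false p q = nil , numeral≤ (check _) (iteᶠ p refl (constᴱ nil)) , refl
    flagged true  p q = _   , iteᵀ p refl q , refl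

    test-runs : ∀ C σ flag →
      Runs testᶠ (encᶜ C ∷ σ ∷ encodeBool flag ∷ []) (encodeBool (not (any (good flag σ) C)))
           (suc (length C) * (access + 50))
    test-runs []      σ flag = slack 0 (slackˡ access (finish₀ 50 (iteᶠ (varᴱ _) refl (constᴱ _))))
    test-runs (l ∷ C) σ flag
      with literal-true {ρ = at (index l) σ ∷ encᶜ (l ∷ C) ∷ σ ∷ encodeBool flag ∷ []}
             (sign l) (hdᴱ (varᴱ zero)) (tlᴱ (hdᴱ (varᴱ (suc zero))))
         | flagged {ρ = at (index l) σ ∷ encᶜ (l ∷ C) ∷ σ ∷ encodeBool flag ∷ []}
             flag (varᴱ (suc (suc (suc zero)))) (tlᴱ (varᴱ zero))
    ... | x , evx , tx≡ | y , evy , ty≡ with truth x in tx | truth y in ty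
    ... | true | _ = slack _ (finish₁′ 50
      (iteᵀ (varᴱ _) refl (letᴱ (callᴱ (hdᴱ (hdᴱ (varᴱ _)) ∷ᴱ varᴱ _ ∷ᴱ []ᴱ) (get-lit l σ))
        (iteᵀ evx tx (value≡ (cong (λ b → encodeBool (not (b ∨ any (good flag σ) C)))
                                   (cong (_∨ (flag ∧ fixed σ (index l))) tx≡))
                             (constᴱ nil))))))
    ... | false | true = slack _ (finish₁′ 50
      (iteᵀ (varᴱ _) refl (letᴱ (callᴱ (hdᴱ (hdᴱ (varᴱ _)) ∷ᴱ varᴱ _ ∷ᴱ []ᴱ) (get-lit l σ))
        (iteᶠ evx tx (iteᵀ evy ty (value≡ (cong₂ (λ a b → encodeBool (not ((a ∨ b) ∨ any (good flag σ) C))) tx≡ ty≡)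
                             (constᴱ nil)))))))
    ... | false | false = finish₂ 50
      (iteᵀ (varᴱ _) refl (letᴱ (callᴱ (hdᴱ (hdᴱ (varᴱ _)) ∷ᴱ varᴱ _ ∷ᴱ []ᴱ) (get-lit l σ))
        (iteᶠ evx tx (iteᶠ evy ty (value≡ (cong₂ (λ a b → encodeBool (not ((a ∨ b) ∨ any (good flag σ) C))) tx≡ ty≡)
           (callᴱ (tlᴱ (varᴱ _) ∷ᴱ varᴱ _ ∷ᴱ varᴱ _ ∷ᴱ []ᴱ) (test-runs C σ flag)))))))

    finding : ℕ → ℕ → ℕ
    finding = findCost n

    find-runs : ∀ k Fs σ flag → All (λ C → length C ≤ k) Fs →
      ∃ λ y → Runs findᶠ (encᶠ Fs ∷ σ ∷ encodeBool flag ∷ []) y (finding k (length Fs)) × Found flag σ Fs y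
    find-runs k []       σ flag [] = nil ,
      slack 0 (slackˡ (suc k * (access + 50)) (finish₀ 20 (iteᶠ (varᴱ _) refl (constᴱ _)))) ,
      none []
    find-runs k (C ∷ Fs) σ flag (C≤k ∷ Fs≤k) with find-runs k Fs σ flag Fs≤k | any (good flag σ) C in eq
    ... | _ | false = nil ∙ encᶜ C , slack (finding k (length Fs)) (finish₁′ 20
      (iteᵀ (varᴱ _) refl (iteᵀ (callᴱ (hdᴱ (varᴱ _) ∷ᴱ varᴱ _ ∷ᴱ varᴱ _ ∷ᴱ []ᴱ) test) (test≡ eq)
         (consᴱ (constᴱ _) (hdᴱ (varᴱ _)))))) , found C (here refl) eq
      where
      test = runs≤ (*-monoˡ-≤ (access + 50) (s≤s C≤k)) (test-runs C σ flag)
      test≡ : ∀ {b} → any (good flag σ) C ≡ b → truth (encodeBool (not (any (good flag σ) C))) ≡ not b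
      test≡ refl = truth-encodeBool _
    ... | y , run , result | true = y , finish₂ 20
      (iteᵀ (varᴱ _) refl (iteᶠ (callᴱ (hdᴱ (varᴱ _) ∷ᴱ varᴱ _ ∷ᴱ varᴱ _ ∷ᴱ []ᴱ) test) (test≡ eq)
         (callᴱ (tlᴱ (varᴱ _) ∷ᴱ varᴱ _ ∷ᴱ varᴱ _ ∷ᴱ []ᴱ) run))) , later result
      where
      test = runs≤ (*-monoˡ-≤ (access + 50) (s≤s C≤k)) (test-runs C σ flag)
      test≡ : ∀ {b} → any (good flag σ) C ≡ b → truth (encodeBool (not (any (good flag σ) C))) ≡ not b
      test≡ refl = truth-encodeBool _
      later : ∀ {y} → Found flag σ Fs y → Found flag σ (C ∷ Fs) y
      later (found D D∈ bad) = found D (there D∈) bad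
      later (none all)       = none (eq ∷ all)

    mark-runs : ∀ C σ → Runs markᶠ (encᶜ C ∷ σ ∷ []) (mark C σ) (suc (length C) * (access + access + 30))
    mark-runs []      σ = slack 0 (slackˡ (access + access) (finish₀ 30 (iteᶠ (varᴱ _) refl (varᴱ _))))
    mark-runs (l ∷ C) σ = finish₃ 30
      (iteᵀ (varᴱ _) refl (callᴱ (tlᴱ (varᴱ _) ∷ᴱ
         callᴱ (hdᴱ (hdᴱ (varᴱ _)) ∷ᴱ
                consᴱ (hdᴱ (callᴱ (hdᴱ (hdᴱ (varᴱ _)) ∷ᴱ varᴱ _ ∷ᴱ []ᴱ) (get-lit l σ))) (constᴱ _) ∷ᴱ
                varᴱ _ ∷ᴱ []ᴱ) (put-lit l _ σ) ∷ᴱ []ᴱ)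
        (mark-runs C (upd (index l) (head (at (index l) σ) ∙ yes′) σ))))

    flip-eval : ∀ i (C : Lits n) {w G σ} →
      Eval (at i (encᶜ C) ∷ w ∷ G ∷ σ ∷ [])
           (ite v₀ (call putᶠ (hd v₀ ∷ cons (tl v₀) (constant nil) ∷ v₃ ∷ [])) v₃)
           (flip i C σ) 20 (access ∷ [])
    flip-eval i [] {w} {G} {σ} = subst (λ x → Eval (x ∷ w ∷ G ∷ σ ∷ []) _ σ 20 (access ∷ []))
      (sym (at-nil i)) (widen (iteᶠ (varᴱ zero) refl (varᴱ (suc (suc (suc zero))))))
      where
      at-nil : ∀ i → at i nil ≡ nil
      at-nil zero    = refl
      at-nil (suc i) = at-nil i
      widen : ∀ {v} {ρ : Vec Tree v} {e x} → Eval ρ e x 3 [] → Eval ρ e x 20 (access ∷ [])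
      widen (eval s p (within s≤)) = eval s p (within (≤-trans s≤ (+-mono-≤ (check {3} {20} _) z≤n)))
    flip-eval zero (l ∷ C) = numeral≤ (check _)
      (iteᵀ (varᴱ _) refl (callᴱ (hdᴱ (varᴱ _) ∷ᴱ consᴱ (tlᴱ (varᴱ _)) (constᴱ _) ∷ᴱ varᴱ _ ∷ᴱ []ᴱ) (put-lit l _ _)))
    flip-eval (suc i) (l ∷ C) = flip-eval i C

    flips-runs : ∀ {k t} (w : Vec (Fin k) t) (G : List (Lits n)) σ → length G ≡ t →
      Runs flipsᶠ (encodeWord w ∷ encᶠ G ∷ σ ∷ []) (flips w G σ) (suc t * (k * 10 + access + 40))
    flips-runs {k} []      []      σ refl = slack 0 (slackˡ (k * 10 + access) (finish₀ 40 (iteᶠ (varᴱ _) refl (varᴱ _))))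
    flips-runs {k} (x ∷ w) (C ∷ G) σ refl = finish₃ 40
      (iteᵀ (varᴱ _) refl (callᴱ (tlᴱ (varᴱ _) ∷ᴱ tlᴱ (varᴱ _) ∷ᴱ
         letᴱ (callᴱ (hdᴱ (varᴱ _) ∷ᴱ hdᴱ (varᴱ _) ∷ᴱ []ᴱ)
                (runs≤ (*-monoˡ-≤ 10 (toℕ<n x)) (get-runs (toℕ x) (encᶜ C))))
              (flip-eval (toℕ x) C) ∷ᴱ []ᴱ)
        (flips-runs w G (flip (toℕ x) C σ) refl)))

open Literal using (sign)

-- States, models and distances

mismatch : Bool → Bool → ℕ
mismatch a b = ⟦ not (a ≡ᵇ b) ⟧

≡ᵇ-sound : ∀ a b → (a ≡ᵇ b) ≡ true → a ≡ b
≡ᵇ-sound true  true  _ = refl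
≡ᵇ-sound false false _ = refl

≡ᵇ-refl : ∀ a → (a ≡ᵇ a) ≡ true
≡ᵇ-refl true  = refl
≡ᵇ-refl false = refl

mismatch≤1 : ∀ a b → mismatch a b ≤ 1
mismatch≤1 a b with a ≡ᵇ b
... | true  = z≤n
... | false = ≤-refl

mismatch-≡ : ∀ {a b} → a ≡ b → mismatch a b ≡ 0
mismatch-≡ {a} refl rewrite ≡ᵇ-refl a = refl

mismatch-≢ : ∀ {a b} → a ≢ b → mismatch a b ≡ 1
mismatch-≢ {a} {b} a≢b with a ≡ᵇ b in eq
... | true  = contradiction (≡ᵇ-sound a b eq) a≢b
... | false = refl

-- The number `N` of compared variables may exceed `n`, as the blocks of a starting assignment can
-- run past the last variable. For the same reason models are total on ℕ.
dist : ℕ → Tree → (ℕ → Bool) → ℕ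
dist zero    σ β = 0
dist (suc N) σ β = mismatch (truth (head (head σ))) (β 0) + dist N (tail σ) (β ∘ suc)

dist-match : ∀ N i x σ {β} → truth (head x) ≡ β i → dist N (upd i x σ) β ≤ dist N σ β
dist-match zero    i       x σ x≡β = z≤n
dist-match (suc N) zero    x σ x≡β = ≤-trans (≤-reflexive (cong (_+ dist N (tail σ) _) (mismatch-≡ x≡β))) (m≤n+m _ _)
dist-match (suc N) (suc i) x σ x≡β = +-monoʳ-≤ _ (dist-match N i x (tail σ) x≡β)

dist-gain : ∀ {N i} x σ {β} → i < N → truth (head x) ≡ β i → val σ i ≢ β i →
            suc (dist N (upd i x σ) β) ≤ dist N σ β
dist-gain {suc N} {zero}  x σ {β} (s≤s i<N) x≡β σ≢β = ≤-reflexive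
  (trans (cong (λ m → suc (m + d)) (mismatch-≡ x≡β)) (sym (cong (_+ d) (mismatch-≢ σ≢β))))
  where
  d : ℕ
  d = dist N (tail σ) (β ∘ suc)
dist-gain {suc N} {suc i} x σ {β} (s≤s i<N) x≡β σ≢β =
  ≤-trans (≤-reflexive (sym (+-suc m _))) (+-monoʳ-≤ m (dist-gain x (tail σ) i<N x≡β σ≢β))
  where
  m : ℕ
  m = mismatch (truth (head (head σ))) (β 0)

dist-upd : ∀ N i x σ β → dist N (upd i x σ) β ≤ suc (dist N σ β)
dist-upd zero    i       x σ β = z≤n
dist-upd (suc N) zero    x σ β = +-mono-≤ (mismatch≤1 (truth (head x)) (β 0)) (m≤n+m _ _)
dist-upd (suc N) (suc i) x σ β =
  ≤-trans (+-monoʳ-≤ m (dist-upd N i x (tail σ) (β ∘ suc))) (≤-reflexive (+-suc m _))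
  where
  m : ℕ
  m = mismatch (truth (head (head σ))) (β 0)

dist-cong : ∀ N σ τ {β γ} → (∀ i → val σ i ≡ val τ i) → (∀ i → β i ≡ γ i) → dist N σ β ≡ dist N τ γ
dist-cong zero    σ τ σ≗τ β≗γ = refl
dist-cong (suc N) σ τ σ≗τ β≗γ =
  cong₂ _+_ (cong₂ mismatch (σ≗τ 0) (β≗γ 0)) (dist-cong N (tail σ) (tail τ) (σ≗τ ∘ suc) (β≗γ ∘ suc))

any-false : ∀ {A : Set} (p : A → Bool) xs → any p xs ≡ false → All (λ x → p x ≡ false) xs
any-false p []       eq = []
any-false p (x ∷ xs) eq with p x in px
... | false = px ∷ any-false p xs eq

any-true : ∀ {A : Set} (p : A → Bool) xs → any p xs ≡ true → Any (λ x → p x ≡ true) xs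
any-true p (x ∷ xs) eq with p x in px
... | true  = here px
... | false = there (any-true p xs eq)

any-true⁻ : ∀ {A : Set} (p : A → Bool) {xs} → Any (λ x → p x ≡ true) xs → any p xs ≡ true
any-true⁻ p {x ∷ xs} (here px) rewrite px = refl
any-true⁻ p {x ∷ xs} (there pxs) with p x
... | true  = refl
... | false = any-true⁻ p pxs

∨-false : ∀ {a b} → a ∨ b ≡ false → a ≡ false × b ≡ false
∨-false {false} eq = refl , eq

∨-trueʳ : ∀ a {b} → b ≡ true → a ∨ b ≡ true
∨-trueʳ true  _  = refl
∨-trueʳ false eq = eq

-- The invariant of the walk: marks are made on a separate copy of the state, and fixing sets in
-- only when the walk is abandoned.
Unfixed : Tree → Set
Unfixed σ = ∀ i → fixed σ i ≡ false

unfixed-upd : ∀ i x σ → truth (tail x) ≡ false → Unfixed σ → Unfixed (upd i x σ)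
unfixed-upd i x σ free unfixed j with i ≟ j
... | yes refl = trans (cong (truth ∘ tail) (at-upd i x σ)) free
... | no i≢j   = trans (cong (truth ∘ tail) (at-upd-≢ i j x σ i≢j)) (unfixed j)

fixed-upd : ∀ j x τ i → truth (tail x) ≡ true → fixed τ i ≡ true → fixed (upd j x τ) i ≡ true
fixed-upd j x τ i fix eq with j ≟ i
... | yes refl = trans (cong (truth ∘ tail) (at-upd j x τ)) fix
... | no j≢i   = trans (cong (truth ∘ tail) (at-upd-≢ j i x τ j≢i)) eq

module _ {n : ℕ} where

  SatL : (ℕ → Bool) → Literal n → Set
  SatL β l = β (index l) ≡ sign l

  SatC : (ℕ → Bool) → Lits n → Set
  SatC β = Any (SatL β)

  Model : (ℕ → Bool) → List (Lits n) → Set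
  Model β = All (SatC β)

  Occurs : ℕ → Lits n → Set
  Occurs i = Any (λ l → index l ≡ i)

  Disjoint : Lits n → Lits n → Set
  Disjoint C D = ∀ {i} → Occurs i C → Occurs i D → ⊥

  Violated : Tree → Lits n → Set
  Violated σ = All (λ l → val σ (index l) ≢ sign l)

  good-false : ∀ {flag σ} {l : Literal n} → good flag σ l ≡ false → val σ (index l) ≢ sign l
  good-false {l = l} eq σ≡ with () ← trans (sym (≡ᵇ-refl (sign l)))
    (trans (cong (_≡ᵇ sign l) (sym σ≡)) (proj₁ (∨-false eq)))

  unfixed-lit : ∀ {σ} {l : Literal n} → good true σ l ≡ false → fixed σ (index l) ≡ false
  unfixed-lit {σ} {l} eq = proj₂ (∨-false {val σ (index l) ≡ᵇ sign l} eq)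

  violated : ∀ {flag} σ C → any (good flag σ) C ≡ false → Violated σ C
  violated σ C bad = All.map (λ {l} → good-false {l = l}) (any-false _ C bad)

  all-good⇒model : ∀ {σ Fs} → All (λ C → any (good false σ) C ≡ true) Fs → Model (val σ) Fs
  all-good⇒model {σ} = All.map (λ {C} eq → sat C (any-true _ C eq))
    where
    sat : ∀ C → Any (λ l → good false σ l ≡ true) C → SatC (val σ) C
    sat (l ∷ C) (here ok)  with val σ (index l) ≡ᵇ sign l in eq
    ... | true = here (≡ᵇ-sound _ _ eq)
    sat (l ∷ C) (there ok) = there (sat C ok)

  -- Searching from a stable state branches over at most k - 1 literals.
  Stable : List (Lits n) → Tree → Set
  Stable Fs σ = All (λ C → any (good true σ) C ≡ true) Fs

  -- A literal on the updated variable is good because the variable is now fixed; all other literals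
  -- read the same cell as before.
  stable-upd : ∀ {Fs σ} i x → truth (tail x) ≡ true → Stable Fs σ → Stable Fs (upd i x σ)
  stable-upd {σ = σ} i x fix = All.map (λ {C} ok → any-true⁻ _ (lift C (any-true _ C ok)))
    where
    keep : ∀ l → good true σ l ≡ true → good true (upd i x σ) l ≡ true
    keep l ok with i ≟ index l
    ... | yes i≡l  = ∨-trueʳ _ (subst (λ j → fixed (upd i x σ) j ≡ true) i≡l (trans (cong (truth ∘ tail) (at-upd i x σ)) fix))
    ... | no i≢l   = trans (cong (λ c → (truth (head c) ≡ᵇ sign l) ∨ truth (tail c)) (at-upd-≢ i _ x σ i≢l)) ok
    lift : ∀ C → Any (λ l → good true σ l ≡ true) C → Any (λ l → good true (upd i x σ) l ≡ true) C
    lift (l ∷ C) (here ok)  = here (keep l ok)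
    lift (l ∷ C) (there ok) = there (lift C ok)

  free : Tree → Lits n → ℕ
  free σ []      = 0
  free σ (l ∷ C) = ⟦ not (fixed σ (index l)) ⟧ + free σ C

  free≤length : ∀ σ C → free σ C ≤ length C
  free≤length σ []      = z≤n
  free≤length σ (l ∷ C) with fixed σ (index l)
  ... | true  = ≤-trans (free≤length σ C) (n≤1+n _)
  ... | false = s≤s (free≤length σ C)

  -- Some literal is good only through the flag, so it lies on a fixed variable and is not branched
  -- on. This lowers the branching from `k` to `k - 1`.
  free<length : ∀ σ C → any (good true σ) C ≡ true → any (good false σ) C ≡ false → free σ C < length C
  free<length σ (l ∷ C) ok bad with val σ (index l) ≡ᵇ sign l | fixed σ (index l)
  ... | false | true  = s≤s (free≤length σ C)
  ... | false | false = s≤s (free<length σ C ok bad)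

  module _ (Fs : List (Lits n)) where

    -- A positive answer may come from any model, and `Q` only says which models must not be missed.
    -- With this asymmetry, alternatives combine by a plain disjunction.
    record Decides (Q : (ℕ → Bool) → Set) (a : Bool) : Set where
      constructor decides
      field
        sound    : a ≡ true → ∃ λ β → Model β Fs
        complete : ∀ β → Model β Fs → Q β → a ≡ true

  private variable
    Fs : List (Lits n)
    Q Q₁ Q₂ : (ℕ → Bool) → Set
    a : Bool

  decides-true : Decides Fs Q₁ true → Decides Fs Q true
  decides-true (decides sound _) = decides sound (λ _ _ _ → refl)

  decides-map : (∀ β → Model β Fs → Q β → Q₁ β) → Decides Fs Q₁ a → Decides Fs Q a
  decides-map f (decides sound complete) = decides sound (λ β m q → complete β m (f β m q))

  decides-else : (∀ β → Model β Fs → Q β → Q₁ β ⊎ Q₂ β) →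
                 Decides Fs Q₁ false → Decides Fs Q₂ a → Decides Fs Q a
  decides-else {Q = Q} {Q₁ = Q₁} {Q₂ = Q₂} {a = a} f (decides _ complete₁) (decides sound complete₂) = decides sound complete
    where
    either : ∀ β → Model β _ → Q₁ β ⊎ Q₂ β → a ≡ true
    either β m (inj₁ q) with () ← complete₁ β m q
    either β m (inj₂ q) = complete₂ β m q
    complete : ∀ β → Model β _ → Q β → a ≡ true
    complete β m q = either β m (f β m q)

  decides-no : (∀ β → Model β Fs → ¬ Q β) → Decides Fs Q false
  decides-no ¬Q = decides (λ ()) (λ β m q → contradiction q (¬Q β m))

  module Distance {N : ℕ} (n≤N : n ≤ N) where

    index<N : ∀ (l : Literal n) → index l < N
    index<N l = ≤-trans (toℕ<n (Literal.var l)) n≤N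

    set-gain : ∀ {β} (l : Literal n) f σ → SatL β l → val σ (index l) ≢ sign l →
               suc (dist N (upd (index l) (encodeBool (sign l) ∙ f) σ) β) ≤ dist N σ β
    set-gain l f σ sat σ≢ = dist-gain _ σ (index<N l) (trans (truth-encodeBool (sign l)) (sym sat))
                              (λ eq → σ≢ (trans eq sat))

    violated-distance : ∀ {β} σ C → Violated σ C → SatC β C → 0 < dist N σ β
    violated-distance σ (l ∷ C) (σ≢ ∷ _) (here sat) = ≤-trans (s≤s z≤n) (set-gain l nil σ sat σ≢)
    violated-distance σ (l ∷ C) (_ ∷ v) (there sat) = violated-distance σ C v sat

    Hits : (ℕ → Bool) → Lits n → ℕ → Set
    Hits β []      i       = ⊥
    Hits β (l ∷ C) zero    = SatL β l
    Hits β (l ∷ C) (suc i) = Hits β C i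

    hit : ∀ {β} C → SatC β C → ∃ λ i → i < length C × Hits β C i
    hit (l ∷ C) (here sat)  = 0 , s≤s z≤n , sat
    hit (l ∷ C) (there sat) with hit C sat
    ... | i , i< , h = suc i , s≤s i< , h

    flip-hit : ∀ {β} i (C : Lits n) σ → Violated σ C → Hits β C i → suc (dist N (flip i C σ) β) ≤ dist N σ β
    flip-hit zero    (l ∷ C) σ (σ≢ ∷ _) h = set-gain l nil σ h σ≢
    flip-hit (suc i) (l ∷ C) σ (_ ∷ v)  h = flip-hit i C σ v h

    flip-any : ∀ β i (C : Lits n) σ → dist N (flip i C σ) β ≤ suc (dist N σ β)
    flip-any β i       []      σ = n≤1+n _
    flip-any β zero    (l ∷ C) σ = dist-upd N (index l) _ σ β
    flip-any β (suc i) (l ∷ C) σ = flip-any β i C σ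

    flip-other : ∀ i (C : Lits n) σ {j} → ¬ Occurs j C → at j (flip i C σ) ≡ at j σ
    flip-other i       []      σ ∉ = refl
    flip-other zero    (l ∷ C) σ ∉ = at-upd-≢ _ _ _ σ (∉ ∘ here)
    flip-other (suc i) (l ∷ C) σ ∉ = flip-other i C σ (∉ ∘ there)

    -- Disjointness keeps the remaining clauses violated after a flip, so that the gains of
    -- successive flips add up.
    flip-violated : ∀ i (C : Lits n) σ D → Disjoint C D → Violated σ D → Violated (flip i C σ) D
    flip-violated i C σ []      disj []       = []
    flip-violated i C σ (l ∷ D) disj (σ≢ ∷ v) =
      (λ eq → σ≢ (trans (cong (truth ∘ head) (sym (flip-other i C σ (λ o → disj o (here refl))))) eq))
      ∷ flip-violated i C σ D (λ o o′ → disj o (there o′)) v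

    flip-all-violated : ∀ i (C : Lits n) σ {G} → All (Disjoint C) G → All (Violated σ) G → All (Violated (flip i C σ)) G
    flip-all-violated i C σ []       []       = []
    flip-all-violated i C σ (d ∷ ds) (v ∷ vs) = flip-violated i C σ _ d v ∷ flip-all-violated i C σ ds vs

    data AllHit (β : ℕ → Bool) {k} : ∀ {t} → List (Lits n) → Vec (Fin k) t → Set where
      []  : AllHit β [] []
      _∷_ : ∀ {t C G x} {u : Vec (Fin k) t} → Hits β C (toℕ x) → AllHit β G u → AllHit β (C ∷ G) (x ∷ u)

    -- The word `u` spells the right flips for `β`; it is unknown to the algorithm, which is why a
    -- code covering all words is tried.
    all-hit : ∀ {β k t} G → length G ≡ t → All (SatC β) G → All (λ C → length C ≤ k) G →
              ∃ λ (u : Vec (Fin k) t) → AllHit β G u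
    all-hit []      refl []         []         = [] , []
    all-hit {β} (C ∷ G) refl (sat ∷ sats) (C≤k ∷ G≤k) with hit C sat | all-hit G refl sats G≤k
    ... | i , i<C , h | u , hs =
      fromℕ< i<k ∷ u , subst (Hits β C) (sym (toℕ-fromℕ< i<k)) h ∷ hs
      where i<k = ≤-trans i<C C≤k

    -- Each letter on which w and u agree brings the state one step closer to β.
    flips-distance : ∀ {β k t s} (G : List (Lits n)) σ {w u : Vec (Fin k) t} → All (Violated σ) G → AllPairs Disjoint G →
                     AllHit β G u → Differ s w u → dist N (flips w G σ) β + t ≤ dist N σ β + (s + s)
    flips-distance [] σ v d [] [] = ≤-refl
    flips-distance {β} {t = suc t} {s} (C ∷ G) σ {x ∷ w} (v ∷ vs) (d ∷ ds) (h ∷ hs) (same differ) = begin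
      dist N (flips w G σ′) β + suc t        ≡⟨ +-suc _ t ⟩
      suc (dist N (flips w G σ′) β + t)      ≤⟨ s≤s (flips-distance G σ′ (flip-all-violated (toℕ x) C σ d vs) ds hs differ) ⟩
      suc (dist N σ′ β) + (s + s)            ≤⟨ +-monoˡ-≤ (s + s) (flip-hit (toℕ x) C σ v h) ⟩
      dist N σ β + (s + s)                   ∎
      where
      open ≤-Reasoning
      σ′ : Tree
      σ′ = flip (toℕ x) C σ
    flips-distance {β} {t = suc t} {suc s} (C ∷ G) σ {x ∷ w} (v ∷ vs) (d ∷ ds) (h ∷ hs) (diff differ) = begin
      dist N (flips w G σ′) β + suc t        ≡⟨ +-suc _ t ⟩
      suc (dist N (flips w G σ′) β + t)      ≤⟨ s≤s (flips-distance G σ′ (flip-all-violated (toℕ x) C σ d vs) ds hs differ) ⟩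
      suc (dist N σ′ β + (s + s))            ≤⟨ s≤s (+-monoˡ-≤ (s + s) (flip-any β (toℕ x) C σ)) ⟩
      2 + (dist N σ β + (s + s))             ≡⟨ lem (dist N σ β) s ⟩
      dist N σ β + (suc s + suc s)           ∎
      where
      open ≤-Reasoning
      lem : ∀ a s → 2 + (a + (s + s)) ≡ a + (suc s + suc s)
      lem = solve-∀
      σ′ : Tree
      σ′ = flip (toℕ x) C σ

  unfixed-flip : ∀ i (C : Lits n) σ → Unfixed σ → Unfixed (flip i C σ)
  unfixed-flip i       []      σ unfixed = unfixed
  unfixed-flip zero    (l ∷ C) σ unfixed = unfixed-upd _ _ σ refl unfixed
  unfixed-flip (suc i) (l ∷ C) σ unfixed = unfixed-flip i C σ unfixed

  unfixed-flips : ∀ {k t} (w : Vec (Fin k) t) (G : List (Lits n)) σ → Unfixed σ → Unfixed (flips w G σ)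
  unfixed-flips []      _       σ unfixed = unfixed
  unfixed-flips (x ∷ w) []      σ unfixed = unfixed
  unfixed-flips (x ∷ w) (C ∷ G) σ unfixed = unfixed-flips w G _ (unfixed-flip (toℕ x) C σ unfixed)

  val-mark : ∀ (C : Lits n) τ i → val (mark C τ) i ≡ val τ i
  val-mark []      τ i = refl
  val-mark (l ∷ C) τ i = trans (val-mark C _ i) (cell (index l) (yes′) τ i)
    where
    cell : ∀ j f τ i → val (upd j (head (at j τ) ∙ f) τ) i ≡ val τ i
    cell j f τ i with j ≟ i
    ... | yes refl = cong (truth ∘ head) (at-upd j _ τ)
    ... | no j≢i   = cong (truth ∘ head) (at-upd-≢ j i _ τ j≢i)

  fixed-mark⁻ : ∀ (C : Lits n) τ i → fixed (mark C τ) i ≡ true → fixed τ i ≡ true ⊎ Occurs i C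
  fixed-mark⁻ []      τ i eq = inj₁ eq
  fixed-mark⁻ (l ∷ C) τ i eq with fixed-mark⁻ C _ i eq
  ... | inj₂ o   = inj₂ (there o)
  ... | inj₁ eq′ with index l ≟ i
  ... | yes l≡i = inj₂ (here l≡i)
  ... | no l≢i  = inj₁ (trans (sym (cong (truth ∘ tail) (at-upd-≢ (index l) i _ τ l≢i))) eq′)

  fixed-mark : ∀ (C : Lits n) τ i → fixed τ i ≡ true ⊎ Occurs i C → fixed (mark C τ) i ≡ true
  fixed-mark []      τ i (inj₁ eq)          = eq
  fixed-mark (l ∷ C) τ i (inj₁ eq)          = fixed-mark C _ i (inj₁ (fixed-upd (index l) _ τ i refl eq))
  fixed-mark (l ∷ C) τ i (inj₂ (here refl)) =
    fixed-mark C _ i (inj₁ (cong (truth ∘ tail) (at-upd (index l) _ τ)))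
  fixed-mark (l ∷ C) τ i (inj₂ (there o))   = fixed-mark C _ i (inj₂ o)

letter : Bool → Fin 2
letter false = zero
letter true  = suc zero

truth-letter : ∀ c → truth (encodeBool (bit (letter c))) ≡ c
truth-letter false = refl
truth-letter true  = refl

word : ∀ b → (ℕ → Bool) → Vec (Fin 2) b
word zero    γ = []
word (suc b) γ = letter (γ 0) ∷ word b (γ ∘ suc)

prepend-distance : ∀ {b s σ} {w : Vec (Fin 2) b} N γ → Differ s w (word b γ) →
                   dist (b + N) (prepend (encodeStart w) σ) γ ≤ s + dist N σ (λ i → γ (b + i))
prepend-distance {zero} N γ [] = ≤-refl
prepend-distance {suc b} {σ = σ} N γ (same {v = w} differ) =
  ≤-trans (≤-reflexive (cong (_+ dist (b + N) (prepend (encodeStart w) σ) (γ ∘ suc)) (mismatch-≡ (truth-letter (γ 0)))))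
          (prepend-distance N (γ ∘ suc) differ)
prepend-distance {suc b} N γ (diff {x = x} differ) =
  +-mono-≤ (mismatch≤1 (truth (encodeBool (bit x))) (γ 0)) (prepend-distance N (γ ∘ suc) differ)

size-encodeStart : ∀ {b} (w : Vec (Fin 2) b) → size (encodeStart w) ≡ suc b
size-encodeStart []      = refl
size-encodeStart (x ∷ w) = cong suc (size-encodeStart w)

unfixed-prepend : ∀ {b} (w : Vec (Fin 2) b) σ → (∀ i → fixed σ i ≡ false) → ∀ i → fixed (prepend (encodeStart w) σ) i ≡ false
unfixed-prepend []      σ unfixed i       = unfixed i
unfixed-prepend (x ∷ w) σ unfixed zero    = refl
unfixed-prepend (x ∷ w) σ unfixed (suc i) = unfixed-prepend w σ unfixed i

-- Traces the counter of missing variables down to 0 in `m` rounds, with the truncated subtraction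
-- that `tls block` performs.
data Blocks (b : ℕ) : ℕ → ℕ → Set where
  done : Blocks b 0 0
  more : ∀ {n m} → Blocks b (suc n ∸ b) m → Blocks b (suc n) (suc m)

-- Runs of the program

module Costs (κ clauses gain block radius walks starts : ℕ) (n M : ℕ) where

  k access finding unit : ℕ
  k       = suc κ
  access  = accessCost n
  finding = findCost n k M
  unit    = access + access + 50

  searchCost : ℕ → ℕ
  searchCost zero    = suc k * unit + (finding + 20)
  searchCost (suc r) = suc k * unit + (finding + 20) + κ * searchCost r

  -- There are two branches per step; base 4 instead of 2 leaves the other half to pay for the step
  -- itself.
  bruteCost : ℕ → ℕ → ℕ
  bruteCost r x = 4 ^ x * (unit + searchCost r)

  collecting flipping : ℕ
  collecting = finding + suc k * (access + access + 30) + 60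
  flipping   = gain + suc clauses * (k * 10 + access + 40) + 60

  prepending : ℕ
  prepending = suc block * 10 + 60

  access+50≤unit : access + 50 ≤ unit
  access+50≤unit = +-monoˡ-≤ 50 (m≤m+n access access)

  50≤unit : 50 ≤ unit
  50≤unit = m≤n+m 50 (access + access)

  finding≤searchCost : ∀ r → finding + 20 ≤ searchCost r
  finding≤searchCost zero    = m≤n+m (finding + 20) (suc k * unit)
  finding≤searchCost (suc r) = ≤-trans (m≤n+m (finding + 20) (suc k * unit)) (m≤m+n _ _)

  searchCost-mono : .{{_ : NonZero κ}} → ∀ {r r′} → r ≤ r′ → searchCost r ≤ searchCost r′
  searchCost-mono {r′ = zero}   z≤n       = ≤-refl
  searchCost-mono {r′ = suc r′} z≤n       = m≤m+n (searchCost 0) _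
  searchCost-mono               (s≤s r≤r′) = +-monoʳ-≤ (searchCost 0) (*-monoʳ-≤ κ (searchCost-mono r≤r′))

  unit+searchCost≤bruteCost : ∀ r x → unit + searchCost r ≤ bruteCost r x
  unit+searchCost≤bruteCost r x = m≤n*m (unit + searchCost r) (4 ^ x) {{m^n≢0 4 x}}

  unit≤bruteCost : ∀ r x → unit ≤ bruteCost r x
  unit≤bruteCost r x = ≤-trans (m≤m+n unit (searchCost r)) (unit+searchCost≤bruteCost r x)

  bruteCost-suc : ∀ r x → bruteCost r x + bruteCost r x + (bruteCost r x + bruteCost r x) ≡ bruteCost r (suc x)
  bruteCost-suc r x = lem (4 ^ x) (unit + searchCost r)
    where
    lem : ∀ p b → p * b + p * b + (p * b + p * b) ≡ 4 * p * b
    lem = solve-∀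

  -- Unification in the specifications below would otherwise unfold these costs.
  opaque

    -- Meant for radii up to `gain * l`. The two outcomes of collecting exclude each other, yet both
    -- are charged, which keeps maxima out of the recurrence.
    walkCost : ℕ → ℕ
    walkCost zero    = searchCost 0 + 60
    walkCost (suc l) =
      clauses * collecting + (bruteCost (gain * suc l) (clauses * suc k)
                              + (suc walks * flipping + walks * walkCost l + 60)) + 60

    startCost : ℕ → ℕ → ℕ
    startCost L zero    = walkCost L + 60
    startCost L (suc m) = block + 2 * radius + 60 + (suc starts * prepending + starts * startCost L m)

    walkCost-suc : .{{_ : NonZero κ}} → ∀ {r} l → r ≤ gain * suc l →
      clauses * collecting + (bruteCost r (clauses * suc k) + (suc walks * flipping + walks * walkCost l + 60)) + 60
      ≤ walkCost (suc l)
    walkCost-suc l r≤ = +-monoˡ-≤ 60 (+-monoʳ-≤ (clauses * collecting)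
      (+-monoˡ-≤ (suc walks * flipping + walks * walkCost l + 60)
        (*-monoʳ-≤ (4 ^ (clauses * suc k)) (+-monoʳ-≤ unit (searchCost-mono r≤)))))

    walkCost-zero : .{{_ : NonZero κ}} → ∀ l → searchCost 0 + 60 ≤ walkCost (suc l)
    walkCost-zero l = ≤-trans (+-monoˡ-≤ 60 (begin
      searchCost 0              ≤⟨ m≤n+m (searchCost 0) unit ⟩
      unit + searchCost 0       ≤⟨ unit+searchCost≤bruteCost 0 (clauses * suc k) ⟩
      B                         ≤⟨ m≤m+n B X ⟩
      B + X                     ≤⟨ m≤n+m (B + X) (clauses * collecting) ⟩
      clauses * collecting + (B + X) ∎)) (walkCost-suc l z≤n)
      where
      open ≤-Reasoning
      B X : ℕ
      B = bruteCost 0 (clauses * suc k)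
      X = suc walks * flipping + walks * walkCost l + 60

    walkCost-base : searchCost 0 + 60 ≤ walkCost 0
    walkCost-base = ≤-refl

    startCost-zero : ∀ L → walkCost L + 60 ≤ startCost L 0
    startCost-zero L = ≤-refl

    startCost-suc : ∀ L m → block + 2 * radius + 60 + (suc starts * prepending + starts * startCost L m) ≤ startCost L (suc m)
    startCost-suc L m = ≤-refl

module Correctness (κ clauses gain block radius : ℕ) .{{_ : NonZero κ}}
                   (walk  : List (Vec (Fin (suc κ)) clauses))
                   (start : List (Vec (Fin 2) block)) where

  open Subroutines clauses gain block radius (encodeList encodeWord walk) (encodeList encodeStart start)
    hiding (access; finding)

  module Formula {n : ℕ} (Fs : List (Lits n)) (M : ℕ)
                 (Fs≤k : All (λ C → length C ≤ suc κ) Fs) (Fs≤M : length Fs ≤ M) where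

    open Costs κ clauses gain block radius (length walk) (length start) n M

    find : ∀ σ flag → ∃ λ y →
      Runs findᶠ (encᶠ Fs ∷ σ ∷ encodeBool flag ∷ []) y finding × Found flag σ Fs y
    find σ flag with find-runs k Fs σ flag Fs≤k
    ... | y , run , result = y , runs≤ (*-monoˡ-≤ _ (s≤s Fs≤M)) run , result

    DecidesAt : ∀ g → Vec Tree (arities g) → ℕ → ((ℕ → Bool) → Set) → Set
    DecidesAt g xs c Q = ∃ λ a → Runs g xs (encodeBool a) c × Decides Fs Q a

    weaken : ∀ {g xs c c′ Q} → c ≤ c′ → DecidesAt g xs c Q → DecidesAt g xs c′ Q
    weaken c≤c′ (a , run , dec) = a , runs≤ c≤c′ run , dec

    decides-at-map : ∀ {g xs c Q Q′} → (∀ β → Model β Fs → Q β → Q′ β) → DecidesAt g xs c Q′ → DecidesAt g xs c Q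
    decides-at-map f (a , run , dec) = a , run , decides-map f dec

    Agrees : Tree → (ℕ → Bool) → Set
    Agrees σ β = ∀ i → fixed σ i ≡ true → val σ i ≡ β i

    agrees-upd : ∀ {σ β} i x → truth (head x) ≡ β i → Agrees σ β → Agrees (upd i x σ) β
    agrees-upd {σ} i x x≡β agrees j fix with i ≟ j
    ... | yes refl = trans (cong (truth ∘ head) (at-upd i x σ)) x≡β
    ... | no i≢j   = trans (cong (truth ∘ head) (at-upd-≢ i j x σ i≢j))
                       (agrees j (trans (sym (cong (truth ∘ tail) (at-upd-≢ i j x σ i≢j))) fix))

    module Ball {N : ℕ} (n≤N : n ≤ N) where

      open Distance n≤N

      Near : ℕ → Tree → (ℕ → Bool) → Set
      Near r σ β = dist N σ β ≤ r × Agrees σ β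

      -- At radius 0 only `σ` itself is tested, since a violated clause puts every model at positive
      -- distance. The walk ends here from states that are not stable, hence the separate statement.
      search-zero : ∀ σ → DecidesAt searchᶠ (encodeℕ 0 ∷ σ ∷ encᶠ Fs ∷ []) (searchCost 0) (λ β → dist N σ β ≤ 0)
      search-zero σ with find σ false
      ... | _ , run , none good = true ,
        runs≤ (finding≤searchCost 0) (finish₁′ 20
          (letᴱ (callᴱ (varᴱ _ ∷ᴱ varᴱ _ ∷ᴱ constᴱ _ ∷ᴱ []ᴱ) run) (iteᶠ (varᴱ _) refl (constᴱ _)))) ,
        decides (λ _ → val σ , all-good⇒model good) (λ _ _ _ → refl)
      ... | _ , run , found C C∈Fs bad = false ,
        runs≤ (finding≤searchCost 0) (finish₁′ 20
          (letᴱ (callᴱ (varᴱ _ ∷ᴱ varᴱ _ ∷ᴱ constᴱ _ ∷ᴱ []ᴱ) run)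
                (iteᵀ (varᴱ _) refl (iteᶠ (varᴱ _) refl (constᴱ _))))) ,
        decides-no (λ β m d≤0 → <⇒≱ (violated-distance σ C (violated σ C bad) (All.lookup m C∈Fs)) d≤0)

      mutual

        search-runs : ∀ r σ → Stable Fs σ →
          DecidesAt searchᶠ (encodeℕ r ∷ σ ∷ encᶠ Fs ∷ []) (searchCost r) (Near r σ)
        search-runs zero σ stable with search-zero σ
        ... | a , run , dec = a , run , decides-map (λ _ _ → proj₁) dec
        search-runs (suc r) σ stable with find σ false
        ... | _ , run , none good = true ,
          runs≤ (finding≤searchCost (suc r)) (finish₁′ 20
            (letᴱ (callᴱ (varᴱ _ ∷ᴱ varᴱ _ ∷ᴱ constᴱ _ ∷ᴱ []ᴱ) run) (iteᶠ (varᴱ _) refl (constᴱ _)))) ,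
          decides (λ _ → val σ , all-good⇒model good) (λ _ _ _ → refl)
        ... | _ , run , found C C∈Fs bad with try-runs r σ stable C (violated σ C bad)
        ... | a , run′ , dec = a ,
          runs≤ cost (finish₂ 20
            (letᴱ (callᴱ (varᴱ _ ∷ᴱ varᴱ _ ∷ᴱ constᴱ _ ∷ᴱ []ᴱ) run)
                  (iteᵀ (varᴱ _) refl (iteᵀ (varᴱ _) refl
                    (callᴱ (tlᴱ (varᴱ _) ∷ᴱ tlᴱ (varᴱ _) ∷ᴱ varᴱ _ ∷ᴱ varᴱ _ ∷ᴱ []ᴱ) run′))))) ,
          decides-map (λ β m near → All.lookup m C∈Fs , near) dec
          where
          open ≤-Reasoning
          C≤k : length C ≤ k
          C≤k = All.lookup Fs≤k C∈Fs
          free≤κ : free σ C ≤ κ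
          free≤κ = ≤-pred (≤-trans (free<length σ C (All.lookup stable C∈Fs) bad) C≤k)
          cost : finding + 20 + (suc (length C) * unit + free σ C * searchCost r) ≤ searchCost (suc r)
          cost = begin
            finding + 20 + (suc (length C) * unit + free σ C * searchCost r)
              ≤⟨ +-monoʳ-≤ (finding + 20) (+-mono-≤ (*-monoˡ-≤ unit (s≤s C≤k)) (*-monoˡ-≤ (searchCost r) free≤κ)) ⟩
            finding + 20 + (suc k * unit + κ * searchCost r)
              ≡⟨ lem (finding + 20) (suc k * unit) (κ * searchCost r) ⟩
            searchCost (suc r) ∎
            where
            lem : ∀ a b c → a + (b + c) ≡ b + a + c
            lem = solve-∀

        -- A literal on a fixed variable is false under `σ`, hence under every `β` agreeing with it,
        -- and can be skipped. If `β` satisfies the flipped literal, the variable receives its value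
        -- in `β`, so fixing it preserves `Agrees`.
        try-runs : ∀ r σ → Stable Fs σ → ∀ C → Violated σ C →
          DecidesAt tryᶠ (encᶜ C ∷ encodeℕ r ∷ σ ∷ encᶠ Fs ∷ [])
            (suc (length C) * unit + free σ C * searchCost r) (λ β → SatC β C × Near (suc r) σ β)
        try-runs r σ stable [] [] = false ,
          runs≤ (≤-trans 50≤unit (≤-trans (m≤m+n unit 0) (m≤m+n (unit + 0) 0)))
            (finish₀ 50 (iteᶠ (varᴱ _) refl (constᴱ _))) ,
          decides-no λ { β m (() , _) }
        try-runs r σ stable (l ∷ C) (σ≢ ∷ v) with try-runs r σ stable C v | fixed σ (index l) in eq
        ... | a , run , dec | true = a ,
          runs≤ (lem access+50≤unit) (finish₂ 50
            (iteᵀ (varᴱ _) refl (iteᵀ (tlᴱ (callᴱ (hdᴱ (hdᴱ (varᴱ _)) ∷ᴱ varᴱ _ ∷ᴱ []ᴱ) (get-lit l σ))) eq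
              (callᴱ (tlᴱ (varᴱ _) ∷ᴱ varᴱ _ ∷ᴱ varᴱ _ ∷ᴱ varᴱ _ ∷ᴱ []ᴱ) run)))) ,
          decides-map agree dec
          where
          lem : ∀ {p q x y} → p ≤ q → p + (x + y) ≤ q + x + y
          lem {p} {q} {x} {y} p≤q = ≤-trans (+-monoˡ-≤ (x + y) p≤q) (≤-reflexive (sym (+-assoc q x y)))
          agree : ∀ β → Model β Fs → SatC β (l ∷ C) × Near (suc r) σ β → SatC β C × Near (suc r) σ β
          agree β m (here sat  , d , agrees) = contradiction (trans (agrees _ eq) sat) σ≢
          agree β m (there sat , near)       = sat , near
        ... | a , run , dec | false
          with search-runs r (upd (index l) (encodeBool (sign l) ∙ yes′) σ) (stable-upd (index l) _ refl stable)
        ... | true , run′ , dec′ = true ,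
          runs≤ (lem unit (searchCost r) _ _) (finish₃ 50
            (iteᵀ (varᴱ _) refl (iteᶠ (tlᴱ (callᴱ (hdᴱ (hdᴱ (varᴱ _)) ∷ᴱ varᴱ _ ∷ᴱ []ᴱ) (get-lit l σ))) eq
              (iteᵀ (callᴱ (varᴱ _ ∷ᴱ callᴱ (hdᴱ (hdᴱ (varᴱ _)) ∷ᴱ consᴱ (tlᴱ (hdᴱ (varᴱ _))) (constᴱ _) ∷ᴱ varᴱ _ ∷ᴱ []ᴱ)
                        (put-lit l _ σ) ∷ᴱ varᴱ _ ∷ᴱ []ᴱ) run′) refl (constᴱ _))))) ,
          decides-true dec′
          where
          lem : ∀ u s x y → u + s ≤ u + x + (s + y)
          lem u s x y = +-mono-≤ (m≤m+n u x) (m≤m+n s y)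
        ... | false , run′ , dec′ = a ,
          runs≤ (≤-reflexive (lem access (searchCost r) _ _)) (finish₄ 50
            (iteᵀ (varᴱ _) refl (iteᶠ (tlᴱ (callᴱ (hdᴱ (hdᴱ (varᴱ _)) ∷ᴱ varᴱ _ ∷ᴱ []ᴱ) (get-lit l σ))) eq
              (iteᶠ (callᴱ (varᴱ _ ∷ᴱ callᴱ (hdᴱ (hdᴱ (varᴱ _)) ∷ᴱ consᴱ (tlᴱ (hdᴱ (varᴱ _))) (constᴱ _) ∷ᴱ varᴱ _ ∷ᴱ []ᴱ)
                        (put-lit l _ σ) ∷ᴱ varᴱ _ ∷ᴱ []ᴱ) run′) refl
                (callᴱ (tlᴱ (varᴱ _) ∷ᴱ varᴱ _ ∷ᴱ varᴱ _ ∷ᴱ varᴱ _ ∷ᴱ []ᴱ) run))))) ,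
          decides-else closer dec′ dec
          where
          lem : ∀ a s x y → a + (a + (s + (x + y))) + 50 ≡ a + a + 50 + x + (s + y)
          lem = solve-∀
          closer : ∀ β → Model β Fs → SatC β (l ∷ C) × Near (suc r) σ β →
                   Near r (upd (index l) (encodeBool (sign l) ∙ yes′) σ) β ⊎ SatC β C × Near (suc r) σ β
          closer β m (here sat , d , agrees) =
            inj₁ (≤-pred (≤-trans (set-gain l yes′ σ sat σ≢) d) ,
                  agrees-upd (index l) _ (trans (truth-encodeBool (sign l)) (sym sat)) agrees)
          closer β m (there sat , near) = inj₂ (sat , near)

      -- Counts the rounds of `bruteᶠ`: one for each literal and one to discard each exhausted
      -- clause.
      volume : List (Lits n) → ℕ
      volume []      = 0
      volume (C ∷ G) = suc (length C) + volume G

      -- Marked variables that still occur in `G` await their values and need not agree with `β`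
      -- yet. For empty `G` this amounts to `Near r σ β`.
      NearUpTo : List (Lits n) → ℕ → Tree → (ℕ → Bool) → Set
      NearUpTo G r σ β = dist N σ β ≤ r × (∀ i → fixed σ i ≡ true → val σ i ≡ β i ⊎ Any (Occurs i) G)

      -- The right guess for a variable never increases the distance, so exhaustive assignment
      -- leaves the radius as it is.
      near-set : ∀ {C G r σ β} (l : Literal n) x → truth (head x) ≡ β (index l) →
                 NearUpTo ((l ∷ C) ∷ G) r σ β → NearUpTo (C ∷ G) r (upd (index l) x σ) β
      near-set {C} {G} {r} {σ} {β} l x x≡β (d , agrees) = ≤-trans (dist-match N (index l) x σ x≡β) d , agrees′
        where
        agrees′ : ∀ i → fixed (upd (index l) x σ) i ≡ true → val (upd (index l) x σ) i ≡ β i ⊎ Any (Occurs i) (C ∷ G)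
        agrees′ i fix with index l ≟ i
        ... | yes refl = inj₁ (trans (cong (truth ∘ head) (at-upd i x σ)) x≡β)
        ... | no l≢i with agrees i (trans (sym (cong (truth ∘ tail) (at-upd-≢ (index l) i x σ l≢i))) fix)
        ... | inj₁ eq                 = inj₁ (trans (cong (truth ∘ head) (at-upd-≢ (index l) i x σ l≢i)) eq)
        ... | inj₂ (here (here l≡i))  = contradiction l≡i l≢i
        ... | inj₂ (here (there o))   = inj₂ (here o)
        ... | inj₂ (there o)          = inj₂ (there o)

      brute-runs : ∀ r G σ → Stable Fs σ →
        DecidesAt bruteᶠ (encᶠ G ∷ encodeℕ r ∷ σ ∷ encᶠ Fs ∷ []) (bruteCost r (volume G)) (NearUpTo G r σ)
      brute-runs r [] σ stable with search-runs r σ stable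
      ... | a , run , dec = a ,
        runs≤ (≤-trans (≤-reflexive (+-comm (searchCost r) 50)) (≤-trans (+-monoˡ-≤ (searchCost r) 50≤unit) (m≤m+n _ 0)))
          (finish₁′ 50 (iteᶠ (varᴱ _) refl (callᴱ (varᴱ _ ∷ᴱ varᴱ _ ∷ᴱ varᴱ _ ∷ᴱ []ᴱ) run))) ,
        decides-map near dec
        where
        near : ∀ β → Model β Fs → NearUpTo [] r σ β → Near r σ β
        near β m (d , agrees) = d , λ i fix → agree (agrees i fix)
          where
          agree : ∀ {A : Set} {i} → A ⊎ Any (Occurs i) [] → A
          agree (inj₁ eq) = eq
      brute-runs r ([] ∷ G) σ stable with brute-runs r G σ stable
      ... | a , run , dec = a ,
        runs≤ cost
          (finish₁′ 50 (iteᵀ (varᴱ _) refl (iteᶠ (hdᴱ (varᴱ _)) refl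
            (callᴱ (tlᴱ (varᴱ _) ∷ᴱ varᴱ _ ∷ᴱ varᴱ _ ∷ᴱ varᴱ _ ∷ᴱ []ᴱ) run)))) ,
        decides-map near dec
        where
        B : ℕ
        B = bruteCost r (volume G)
        cost : B + 50 ≤ bruteCost r (volume ([] ∷ G))
        cost = ≤-trans (+-monoʳ-≤ B (≤-trans 50≤unit (unit≤bruteCost r (volume G))))
          (≤-trans (m≤m+n (B + B) (B + B)) (≤-reflexive (bruteCost-suc r (volume G))))
        near : ∀ β → Model β Fs → NearUpTo ([] ∷ G) r σ β → NearUpTo G r σ β
        near β m (d , agrees) = d , λ i fix → agree (agrees i fix)
          where
          agree : ∀ {A : Set} {i} → A ⊎ Any (Occurs i) ([] ∷ G) → A ⊎ Any (Occurs i) G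
          agree (inj₁ eq)        = inj₁ eq
          agree (inj₂ (there o)) = inj₂ o
      brute-runs r ((l ∷ C) ∷ G) σ stable
        with brute-runs r (C ∷ G) (upd (index l) (yes′ ∙ yes′) σ) (stable-upd (index l) _ refl stable)
           | brute-runs r (C ∷ G) (upd (index l) (nil ∙ yes′) σ) (stable-upd (index l) _ refl stable)
      ... | true , run , dec | _ = true ,
        runs≤ cost
          (finish₂ 50 (iteᵀ (varᴱ _) refl (iteᵀ (hdᴱ (varᴱ _)) refl
            (iteᵀ (callᴱ (consᴱ (tlᴱ (hdᴱ (varᴱ _))) (tlᴱ (varᴱ _)) ∷ᴱ varᴱ _ ∷ᴱ
                     callᴱ (hdᴱ (hdᴱ (hdᴱ (varᴱ _))) ∷ᴱ constᴱ _ ∷ᴱ varᴱ _ ∷ᴱ []ᴱ) (put-lit l _ σ) ∷ᴱ varᴱ _ ∷ᴱ []ᴱ) run)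
              refl (constᴱ _))))) ,
        decides-true dec
        where
        B : ℕ
        B = bruteCost r (volume (C ∷ G))
        cost : access + 50 + B ≤ bruteCost r (volume ((l ∷ C) ∷ G))
        cost = ≤-trans (+-monoˡ-≤ B (≤-trans access+50≤unit (unit≤bruteCost r (volume (C ∷ G)))))
          (≤-trans (m≤m+n (B + B) (B + B)) (≤-reflexive (bruteCost-suc r (volume (C ∷ G)))))
      ... | false , run , dec | a , run′ , dec′ = a ,
        runs≤ cost
          (finish₄ 50 (iteᵀ (varᴱ _) refl (iteᵀ (hdᴱ (varᴱ _)) refl
            (iteᶠ (callᴱ (consᴱ (tlᴱ (hdᴱ (varᴱ _))) (tlᴱ (varᴱ _)) ∷ᴱ varᴱ _ ∷ᴱ
                     callᴱ (hdᴱ (hdᴱ (hdᴱ (varᴱ _))) ∷ᴱ constᴱ _ ∷ᴱ varᴱ _ ∷ᴱ []ᴱ) (put-lit l _ σ) ∷ᴱ varᴱ _ ∷ᴱ []ᴱ) run)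
              refl
              (callᴱ (consᴱ (tlᴱ (hdᴱ (varᴱ _))) (tlᴱ (varᴱ _)) ∷ᴱ varᴱ _ ∷ᴱ
                     callᴱ (hdᴱ (hdᴱ (hdᴱ (varᴱ _))) ∷ᴱ constᴱ _ ∷ᴱ varᴱ _ ∷ᴱ []ᴱ) (put-lit l _ σ) ∷ᴱ varᴱ _ ∷ᴱ []ᴱ) run′))))) ,
        decides-else near dec dec′
        where
        B : ℕ
        B = bruteCost r (volume (C ∷ G))
        lem : ∀ a b → a + (b + (a + b)) + 50 ≡ a + a + 50 + (b + b)
        lem = solve-∀
        lem′ : ∀ b → b + (b + b) + b ≡ b + b + (b + b)
        lem′ = solve-∀
        cost : access + (B + (access + B)) + 50 ≤ bruteCost r (volume ((l ∷ C) ∷ G))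
        cost = begin
          access + (B + (access + B)) + 50   ≡⟨ lem access B ⟩
          unit + (B + B)                     ≤⟨ +-monoˡ-≤ (B + B) (unit≤bruteCost r (volume (C ∷ G))) ⟩
          B + (B + B)                        ≤⟨ m≤m+n _ B ⟩
          B + (B + B) + B                    ≡⟨ lem′ B ⟩
          B + B + (B + B)                    ≡⟨ bruteCost-suc r (volume (C ∷ G)) ⟩
          bruteCost r (volume ((l ∷ C) ∷ G)) ∎
          where open ≤-Reasoning
        near : ∀ β → Model β Fs → NearUpTo ((l ∷ C) ∷ G) r σ β →
               NearUpTo (C ∷ G) r (upd (index l) (yes′ ∙ yes′) σ) β ⊎
               NearUpTo (C ∷ G) r (upd (index l) (nil ∙ yes′) σ) β
        near β m near with β (index l) in eq
        ... | true  = inj₁ (near-set l (yes′ ∙ yes′) (sym eq) near)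
        ... | false = inj₂ (near-set l (nil ∙ yes′) (sym eq) near)

      volume≤ : ∀ {G} → All (_∈ Fs) G → volume G ≤ length G * suc k
      volume≤ []         = z≤n
      volume≤ (C∈ ∷ G⊆) = +-mono-≤ (s≤s (All.lookup Fs≤k C∈)) (volume≤ G⊆)

      record Collected (σ : Tree) (G : List (Lits n)) (τ : Tree) : Set where
        field
          values    : ∀ i → val τ i ≡ val σ i
          marked    : ∀ i → fixed τ i ≡ true → Any (Occurs i) G
          marks     : ∀ i → Any (Occurs i) G → fixed τ i ≡ true
          clauses⊆  : All (_∈ Fs) G
          violated′ : All (Violated σ) G
          disjoint  : AllPairs Disjoint G

      open Collected

      nothing-collected : ∀ {σ} → Unfixed σ → Collected σ [] σ
      nothing-collected unfixed .values i = refl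
      nothing-collected unfixed .marked i fix with () ← trans (sym fix) (unfixed i)
      nothing-collected unfixed .marks i ()
      nothing-collected unfixed .clauses⊆ = []
      nothing-collected unfixed .violated′ = []
      nothing-collected unfixed .disjoint = []

      -- A clause found with the flag set is false and avoids all marked variables. As the marks are
      -- exactly the variables of `G`, it is disjoint from everything collected.
      collect-one : ∀ {σ G τ C} → C ∈ Fs → any (good true τ) C ≡ false → Collected σ G τ →
                    Collected σ (C ∷ G) (mark C τ)
      collect-one {σ} {G} {τ} {C} C∈ bad col = record
        { values    = λ i → trans (val-mark C τ i) (values col i)
        ; marked    = λ i fix → occurs i (fixed-mark⁻ C τ i fix)
        ; marks     = λ { i (here o)  → fixed-mark C τ i (inj₂ o)
                        ; i (there o) → fixed-mark C τ i (inj₁ (marks col i o)) }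
        ; clauses⊆  = C∈ ∷ clauses⊆ col
        ; violated′ = All.map (λ {l} τ≢ σ≡ → τ≢ (trans (values col (index l)) σ≡)) (violated τ C bad) ∷ violated′ col
        ; disjoint  = apart (λ i o → marks col i o) ∷ disjoint col
        }
        where
        occurs : ∀ i → fixed τ i ≡ true ⊎ Occurs i C → Any (Occurs i) (C ∷ G)
        occurs i (inj₁ fix) = there (marked col i fix)
        occurs i (inj₂ o)   = here o
        unfixed : ∀ {i} → Occurs i C → fixed τ i ≡ false
        unfixed = go C (any-false _ C bad)
          where
          go : ∀ C {i} → All (λ l → good true τ l ≡ false) C → Occurs i C → fixed τ i ≡ false
          go (l ∷ C) (b ∷ bs) (here refl) = unfixed-lit {σ = τ} {l} b
          go (l ∷ C) (b ∷ bs) (there o)   = go C bs o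
        apart : ∀ {G} → (∀ i → Any (Occurs i) G → fixed τ i ≡ true) → All (Disjoint C) G
        apart {[]}    fix = []
        apart {D ∷ G} fix = (λ o o′ → contradiction (trans (sym (fix _ (here o′))) (unfixed o)) (λ ()))
                            ∷ apart (λ i o → fix i (there o))

      -- The mutual recursion of `walkᶠ`, `collectᶠ` and `branchᶠ` is cut by assuming the
      -- specification of the callee (here, and in `Walks`); only `walk-runs` closes the loop, by
      -- induction on the level.
      Branches : ℕ → ℕ → Tree → Set
      Branches c r σ = ∀ G → length G ≡ clauses → All (_∈ Fs) G → All (Violated σ) G → AllPairs Disjoint G →
        DecidesAt branchᶠ (encodeList encodeWord walk ∷ encᶠ G ∷ encodeℕ r ∷ σ ∷ encᶠ Fs ∷ []) c (λ β → dist N σ β ≤ r)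

      collect-runs : ∀ c r σ → Branches c r σ → ∀ missing G τ → length G + missing ≡ clauses → Collected σ G τ →
        DecidesAt collectᶠ (encodeℕ missing ∷ encᶠ G ∷ τ ∷ encodeℕ r ∷ σ ∷ encᶠ Fs ∷ [])
          (missing * collecting + (bruteCost r (clauses * suc k) + (c + 60))) (λ β → dist N σ β ≤ r)
      collect-runs c r σ branches zero G τ eq col
        with branches G (trans (sym (+-identityʳ _)) eq) (clauses⊆ col) (violated′ col) (disjoint col)
      ... | a , run , dec = a ,
        runs≤ (m≤n+m (c + 60) (bruteCost r (clauses * suc k))) (finish₁′ 60 (iteᶠ (varᴱ _) refl
          (callᴱ (constᴱ _ ∷ᴱ varᴱ _ ∷ᴱ varᴱ _ ∷ᴱ varᴱ _ ∷ᴱ varᴱ _ ∷ᴱ []ᴱ) run))) ,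
        dec
      collect-runs c r σ branches (suc missing) G τ eq col with find τ true
      ... | _ , run , found C C∈ bad
        with collect-runs c r σ branches missing (C ∷ G) (mark C τ) (trans (sym (+-suc _ missing)) eq) (collect-one C∈ bad col)
      ... | a , run′ , dec = a ,
        runs≤ (≤-reflexive (sym (+-assoc collecting (missing * collecting) _))) (finish₃ 60 (iteᵀ (varᴱ _) refl
          (letᴱ (callᴱ (varᴱ _ ∷ᴱ varᴱ _ ∷ᴱ constᴱ _ ∷ᴱ []ᴱ) run) (iteᵀ (varᴱ _) refl
            (callᴱ (tlᴱ (varᴱ _) ∷ᴱ consᴱ (tlᴱ (varᴱ _)) (varᴱ _) ∷ᴱ
                    callᴱ (tlᴱ (varᴱ _) ∷ᴱ varᴱ _ ∷ᴱ []ᴱ)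
                          (runs≤ (*-monoˡ-≤ (access + access + 30) (s≤s (All.lookup Fs≤k C∈))) (mark-runs C τ)) ∷ᴱ
                    varᴱ _ ∷ᴱ varᴱ _ ∷ᴱ varᴱ _ ∷ᴱ []ᴱ) run′))))) ,
        dec
      -- The collected family is maximal: the failed search `good` is literally `Stable Fs τ`, which
      -- is what exhaustive assignment and backtracking start from.
      collect-runs c r σ branches (suc missing) G τ eq col
          | _ , run , none good with brute-runs r G τ good
      ... | a , run′ , dec = a ,
        runs≤ cost (finish₂ 60 (iteᵀ (varᴱ _) refl
          (letᴱ (callᴱ (varᴱ _ ∷ᴱ varᴱ _ ∷ᴱ constᴱ _ ∷ᴱ []ᴱ) run) (iteᶠ (varᴱ _) refl
            (callᴱ (varᴱ _ ∷ᴱ varᴱ _ ∷ᴱ varᴱ _ ∷ᴱ varᴱ _ ∷ᴱ []ᴱ) run′))))) ,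
        decides-map near dec
        where
        near : ∀ β → Model β Fs → dist N σ β ≤ r → NearUpTo G r τ β
        near β m d = ≤-trans (≤-reflexive (dist-cong N τ σ (values col) (λ _ → refl))) d ,
                     λ i fix → inj₂ (marked col i fix)
        Z : ℕ
        Z = bruteCost r (clauses * suc k) + (c + 60)
        small : volume G ≤ clauses * suc k
        small = ≤-trans (volume≤ (clauses⊆ col)) (*-monoˡ-≤ (suc k) (≤-trans (m≤m+n (length G) (suc missing)) (≤-reflexive eq)))
        cost : finding + 60 + bruteCost r (volume G) ≤ suc missing * collecting + Z
        cost = +-mono-≤ (≤-trans (+-monoˡ-≤ 60 (m≤m+n finding (suc k * (access + access + 30))))
                                 (m≤m+n collecting (missing * collecting)))
                        (≤-trans (*-monoˡ-≤ (unit + searchCost r) (^-monoʳ-≤ 4 small)) (m≤m+n _ (c + 60)))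

      Walks : ℕ → ℕ → Set
      Walks c r = ∀ σ → Unfixed σ → DecidesAt walkᶠ (encodeℕ r ∷ σ ∷ encᶠ Fs ∷ []) c (λ β → dist N σ β ≤ r)

      branch-runs : ∀ c r (G : List (Lits n)) σ → Unfixed σ → length G ≡ clauses → Walks c (r ∸ gain) →
        ∀ (W : List (Vec (Fin k) clauses)) →
        DecidesAt branchᶠ (encodeList encodeWord W ∷ encᶠ G ∷ encodeℕ r ∷ σ ∷ encᶠ Fs ∷ [])
          (suc (length W) * flipping + length W * c) (λ β → Any (λ w → dist N (flips w G σ) β ≤ r ∸ gain) W)
      branch-runs c r G σ unfixed eq walks [] = false ,
        runs≤ (≤-trans (m≤n+m 60 (gain + suc clauses * (k * 10 + access + 40)))
                (≤-trans (m≤m+n flipping 0) (m≤m+n (flipping + 0) 0)))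
          (finish₀ 60 (iteᶠ (varᴱ _) refl (constᴱ _))) ,
        decides-no (λ { β m () })
      branch-runs c r G σ unfixed eq walks (w ∷ W)
        with walks (flips w G σ) (unfixed-flips w G σ unfixed) | branch-runs c r G σ unfixed eq walks W
      ... | true , run , dec | _ = true ,
        runs≤ (+-mono-≤ (m≤m+n flipping (suc (length W) * flipping)) (m≤m+n c (length W * c))) (finish₃ 60 (iteᵀ (varᴱ _) refl
          (iteᵀ (callᴱ (tls-encodeℕ gain (varᴱ _) ∷ᴱ
                  callᴱ (hdᴱ (varᴱ _) ∷ᴱ varᴱ _ ∷ᴱ varᴱ _ ∷ᴱ []ᴱ) (flips-runs w G σ eq) ∷ᴱ varᴱ _ ∷ᴱ []ᴱ) run)
            refl (constᴱ _)))) ,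
        decides-true dec
      ... | false , run , dec | a , run′ , dec′ = a ,
        runs≤ (≤-reflexive (lem gain (suc clauses * (k * 10 + access + 40)) c (suc (length W) * flipping) (length W * c)))
          (finish₄ 60 (iteᵀ (varᴱ _) refl
            (iteᶠ (callᴱ (tls-encodeℕ gain (varᴱ _) ∷ᴱ
                    callᴱ (hdᴱ (varᴱ _) ∷ᴱ varᴱ _ ∷ᴱ varᴱ _ ∷ᴱ []ᴱ) (flips-runs w G σ eq) ∷ᴱ varᴱ _ ∷ᴱ []ᴱ) run)
              refl
              (callᴱ (tlᴱ (varᴱ _) ∷ᴱ varᴱ _ ∷ᴱ varᴱ _ ∷ᴱ varᴱ _ ∷ᴱ varᴱ _ ∷ᴱ []ᴱ) run′)))) ,
        decides-else (λ { β m (here near) → inj₁ near ; β m (there near) → inj₂ near }) dec dec′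
        where
        lem : ∀ g f c x y → g + (f + (c + (x + y))) + 60 ≡ g + f + 60 + x + (c + y)
        lem = solve-∀

      module _ (s : ℕ) (clauses≡ : clauses ≡ gain + (s + s)) (covers : Covers s walk) where

        -- A codeword within `s` of the right flips `u` makes at least `clauses - s` steps towards
        -- `β` and at most `s` away from it, a net gain of at least `clauses - 2 s = gain`.
        covered : ∀ {r G σ β} → length G ≡ clauses → All (_∈ Fs) G → All (Violated σ) G → AllPairs Disjoint G →
                  Model β Fs → dist N σ β ≤ r → Any (λ w → dist N (flips w G σ) β ≤ r ∸ gain) walk
        covered {r} {G} {σ} {β} eq G⊆ vs ds m d
          with all-hit G eq (All.map (All.lookup m) G⊆) (All.map (All.lookup Fs≤k) G⊆)
        ... | u , hits = Any.map close (covers u)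
          where
          open ≤-Reasoning
          close : ∀ {w} → Differ s w u → dist N (flips w G σ) β ≤ r ∸ gain
          close {w} differ = m+n≤o⇒m≤o∸n (dist N (flips w G σ) β) (+-cancelʳ-≤ (s + s) (dist N (flips w G σ) β + gain) r (begin
            dist N (flips w G σ) β + gain + (s + s)    ≡⟨ +-assoc (dist N (flips w G σ) β) gain (s + s) ⟩
            dist N (flips w G σ) β + (gain + (s + s))  ≡⟨ cong (dist N (flips w G σ) β +_) clauses≡ ⟨
            dist N (flips w G σ) β + clauses           ≤⟨ flips-distance G σ vs ds hits differ ⟩
            dist N σ β + (s + s)                       ≤⟨ +-monoˡ-≤ (s + s) d ⟩
            r + (s + s)                                ∎))

        walk-zero : ∀ σ → DecidesAt walkᶠ (encodeℕ 0 ∷ σ ∷ encᶠ Fs ∷ []) (searchCost 0 + 60) (λ β → dist N σ β ≤ 0)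
        walk-zero σ with search-zero σ
        ... | a , run , dec = a ,
          finish₁′ 60 (iteᶠ (varᴱ _) refl (callᴱ (constᴱ _ ∷ᴱ varᴱ _ ∷ᴱ varᴱ _ ∷ᴱ []ᴱ) run)) , dec

        walk-collect : ∀ {c r σ Q} →
          DecidesAt collectᶠ (encodeℕ clauses ∷ nil ∷ σ ∷ encodeℕ (suc r) ∷ σ ∷ encᶠ Fs ∷ []) c Q →
          DecidesAt walkᶠ (encodeℕ (suc r) ∷ σ ∷ encᶠ Fs ∷ []) (c + 60) Q
        walk-collect (a , run , dec) = a ,
          finish₁′ 60 (iteᵀ (varᴱ _) refl
            (callᴱ (constᴱ _ ∷ᴱ constᴱ _ ∷ᴱ varᴱ _ ∷ᴱ varᴱ _ ∷ᴱ varᴱ _ ∷ᴱ varᴱ _ ∷ᴱ []ᴱ) run)) ,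
          dec

        walk-runs : ∀ l r → r ≤ gain * l → Walks (walkCost l) r
        walk-runs zero zero r≤ σ unfixed = weaken walkCost-base (walk-zero σ)
        walk-runs zero (suc r) r≤ σ unfixed with () ← ≤-trans r≤ (≤-reflexive (*-zeroʳ gain))
        walk-runs (suc l) zero r≤ σ unfixed = weaken (walkCost-zero l) (walk-zero σ)
        walk-runs (suc l) r@(suc _) r≤ σ unfixed = weaken (walkCost-suc l r≤)
          (walk-collect (collect-runs (suc (length walk) * flipping + length walk * walkCost l) r σ branches
            clauses [] σ refl (nothing-collected unfixed)))
          where
          r∸gain≤ : r ∸ gain ≤ gain * l
          r∸gain≤ = m≤n+o⇒m∸n≤o r gain (≤-trans r≤ (≤-reflexive (*-suc gain l)))
          branches : Branches (suc (length walk) * flipping + length walk * walkCost l) r σ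
          branches G eq G⊆ vs ds = decides-at-map (λ β m → covered eq G⊆ vs ds m)
            (branch-runs (walkCost l) r G σ unfixed eq (walk-runs l (r ∸ gain) r∸gain≤) walk)

    -- Blocks are prepended, so the last variables are assigned first: `σ` holds the `N` variables
    -- from `m * block` on, and is compared with the correspondingly shifted `β`.
    Starts : ℕ → ℕ → ℕ → ℕ → ℕ → Set
    Starts c v m N r = ∀ σ → Unfixed σ → DecidesAt startᶠ (encodeℕ v ∷ encodeℕ r ∷ σ ∷ encᶠ Fs ∷ []) c
      (λ β → dist N σ (λ i → β (m * block + i)) ≤ r)

    prepend-word : ∀ (w : Vec (Fin 2) block) σ →
      Runs prependᶠ (encodeStart w ∷ σ ∷ []) (prepend (encodeStart w) σ) (suc block * 10)
    prepend-word w σ = runs≤ (≤-reflexive (cong (_* 10) (size-encodeStart w))) (prepend-runs (encodeStart w) σ)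

    starts-runs : ∀ {c v m N r} σ → Unfixed σ → Starts c v m (block + N) r →
      ∀ (W : List (Vec (Fin 2) block)) →
      DecidesAt startsᶠ (encodeList encodeStart W ∷ encodeℕ v ∷ encodeℕ r ∷ σ ∷ encᶠ Fs ∷ [])
        (suc (length W) * prepending + length W * c)
        (λ β → Any (λ w → dist (block + N) (prepend (encodeStart w) σ) (λ i → β (m * block + i)) ≤ r) W)
    starts-runs σ unfixed starts [] = false ,
      runs≤ (≤-trans (m≤n+m 60 (suc block * 10)) (≤-trans (m≤m+n prepending 0) (m≤m+n (prepending + 0) 0)))
        (finish₀ 60 (iteᶠ (varᴱ _) refl (constᴱ _))) ,
      decides-no (λ { β m () })
    starts-runs {c} {m = m} σ unfixed starts (w ∷ W)
      with starts (prepend (encodeStart w) σ) (unfixed-prepend w σ unfixed) | starts-runs {m = m} σ unfixed starts W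
    ... | true , run , dec | _ = true ,
      runs≤ (+-mono-≤ (m≤m+n prepending (suc (length W) * prepending)) (m≤m+n c (length W * c))) (finish₂ 60 (iteᵀ (varᴱ _) refl
        (iteᵀ (callᴱ (varᴱ _ ∷ᴱ varᴱ _ ∷ᴱ callᴱ (hdᴱ (varᴱ _) ∷ᴱ varᴱ _ ∷ᴱ []ᴱ) (prepend-word w σ) ∷ᴱ varᴱ _ ∷ᴱ []ᴱ) run)
          refl (constᴱ _)))) ,
      decides-true dec
    ... | false , run , dec | a , run′ , dec′ = a ,
      runs≤ (≤-reflexive (lem (suc block * 10) c (suc (length W) * prepending) (length W * c))) (finish₃ 60 (iteᵀ (varᴱ _) refl
        (iteᶠ (callᴱ (varᴱ _ ∷ᴱ varᴱ _ ∷ᴱ callᴱ (hdᴱ (varᴱ _) ∷ᴱ varᴱ _ ∷ᴱ []ᴱ) (prepend-word w σ) ∷ᴱ varᴱ _ ∷ᴱ []ᴱ) run)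
          refl
          (callᴱ (tlᴱ (varᴱ _) ∷ᴱ varᴱ _ ∷ᴱ varᴱ _ ∷ᴱ varᴱ _ ∷ᴱ varᴱ _ ∷ᴱ []ᴱ) run′)))) ,
      decides-else (λ { β m (here near) → inj₁ near ; β m (there near) → inj₂ near }) dec dec′
      where
      lem : ∀ p c x y → p + c + 60 + (x + y) ≡ p + 60 + x + (c + y)
      lem = solve-∀

    module _ (s : ℕ) (clauses≡ : clauses ≡ gain + (s + s)) (walk-covers : Covers s walk)
             (start-covers : Covers radius start) where

      start-walk : ∀ {c r σ Q} → DecidesAt walkᶠ (encodeℕ r ∷ σ ∷ encᶠ Fs ∷ []) c Q →
        DecidesAt startᶠ (encodeℕ 0 ∷ encodeℕ r ∷ σ ∷ encᶠ Fs ∷ []) (c + 60) Q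
      start-walk (a , run , dec) = a ,
        finish₁′ 60 (iteᶠ (varᴱ _) refl (callᴱ (varᴱ _ ∷ᴱ varᴱ _ ∷ᴱ varᴱ _ ∷ᴱ []ᴱ) run)) , dec

      start-block : ∀ {c v r σ Q} →
        DecidesAt startsᶠ (encodeList encodeStart start ∷ encodeℕ (suc v ∸ block) ∷ encodeℕ (radius + r) ∷
                           σ ∷ encᶠ Fs ∷ []) c Q →
        DecidesAt startᶠ (encodeℕ (suc v) ∷ encodeℕ r ∷ σ ∷ encᶠ Fs ∷ []) (block + 2 * radius + 60 + c) Q
      start-block (a , run , dec) = a ,
        finish₃ 60 (iteᵀ (varᴱ _) refl
          (callᴱ (constᴱ _ ∷ᴱ tls-encodeℕ block (varᴱ _) ∷ᴱ nils-encodeℕ radius (varᴱ _) ∷ᴱ varᴱ _ ∷ᴱ varᴱ _ ∷ᴱ []ᴱ) run)) ,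
        dec

      -- Each block moves `block` into `N` and `radius` into `r`, so `N + m * block` and
      -- `r + m * radius` stay constant, and the bounds assumed at the root reach the walk
      -- unchanged.
      start-runs : ∀ L {v m} N r → Blocks block v m → n ≤ N + m * block → r + m * radius ≤ gain * L →
                   Starts (startCost L m) v m N r
      start-runs L N r done n≤ r≤ σ unfixed = weaken (startCost-zero L) (start-walk
        (Ball.walk-runs (≤-trans n≤ (≤-reflexive (+-identityʳ N))) s clauses≡ walk-covers L r
          (≤-trans (m≤m+n r 0) r≤) σ unfixed))
      start-runs L N r (more {m = m} blocks) n≤ r≤ σ unfixed = weaken (startCost-suc L m) (start-block
        (decides-at-map near
          (starts-runs {m = m} σ unfixed (start-runs L (block + N) (radius + r) blocks n≤′ r≤′) start)))
        where
        lem : ∀ a b c → a + (b + c) ≡ b + a + c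
        lem = solve-∀
        n≤′ : n ≤ block + N + m * block
        n≤′ = ≤-trans n≤ (≤-reflexive (lem N block (m * block)))
        r≤′ : radius + r + m * radius ≤ gain * L
        r≤′ = ≤-trans (≤-reflexive (sym (lem r radius (m * radius)))) r≤
        near : ∀ β → Model β Fs → dist N σ (λ i → β (suc m * block + i)) ≤ r →
               Any (λ w → dist (block + N) (prepend (encodeStart w) σ) (λ i → β (m * block + i)) ≤ radius + r) start
        near β _ d = Any.map close (start-covers (word block (λ i → β (m * block + i))))
          where
          close : ∀ {w} → Differ radius w (word block (λ i → β (m * block + i))) →
                  dist (block + N) (prepend (encodeStart w) σ) (λ i → β (m * block + i)) ≤ radius + r
          close differ = ≤-trans (prepend-distance N _ differ) (+-monoʳ-≤ radius
            (≤-trans (≤-reflexive (dist-cong N σ σ (λ _ → refl) (λ i → cong β (lem (m * block) block i)))) d))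

      search-runs : ∀ L {m} → Blocks block n m → n ≤ m * block → m * radius ≤ gain * L →
        ∃₂ λ a t → searchProgram on encodeℕ n ∙ encᶠ Fs returns encodeBool a in-steps t
                 × t ≤ 10 + (startCost L m + 0)
                 × ((a ≡ true → ∃ λ β → Model β Fs) × (∀ β → Model β Fs → a ≡ true))
      search-runs L blocks n≤ r≤ with start-runs L 0 0 blocks n≤ r≤ nil (λ i → cong (truth ∘ tail) (at-nil i))
        where
        at-nil : ∀ i → at i nil ≡ nil
        at-nil zero    = refl
        at-nil (suc i) = at-nil i
      ... | a , run , decides sound complete
        with numeral≤ {c′ = 10} (check _) (callᴱ {ρ = (encodeℕ n ∙ encᶠ Fs) ∷ []}
               {es = hd v₀ ∷ constant nil ∷ constant nil ∷ tl v₀ ∷ []}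
               (hdᴱ (varᴱ _) ∷ᴱ constᴱ _ ∷ᴱ constᴱ _ ∷ᴱ tlᴱ (varᴱ _) ∷ᴱ []ᴱ) run)
      -- With no variable assigned yet, every model is at distance 0.
      ... | eval t derivation (within t≤) = a , t , derivation , t≤ , sound , λ β m → complete β m z≤n

-- Polynomially many clauses

AllPairs-lookup : ∀ {A : Set} {R : A → A → Set} {xs} → AllPairs R xs → (∀ {x y} → R x y → R y x) →
                  ∀ i j → i ≢ j → R (lookup xs i) (lookup xs j)
AllPairs-lookup (_ ∷ _)    sym′ zero    zero    i≢j = contradiction refl i≢j
AllPairs-lookup (rx ∷ _)   sym′ zero    (suc j) _   = All.lookup rx (∈-lookup j)
AllPairs-lookup (rx ∷ _)   sym′ (suc i) zero    _   = sym′ (All.lookup rx (∈-lookup i))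
AllPairs-lookup (_ ∷ rest) sym′ (suc i) (suc j) i≢j = AllPairs-lookup rest sym′ i j (i≢j ∘ cong suc)

module _ {n : ℕ} where

  signCode : Bool → Fin 2
  signCode false = zero
  signCode true  = suc zero

  literalCode : Literal n → Fin (n * 2)
  literalCode (literal x b) = combine x (signCode b)

  literalCode-injective : ∀ l m → literalCode l ≡ literalCode m → l ≡ m
  literalCode-injective (literal x b) (literal y c) eq with combine-injective x (signCode b) y (signCode c) eq
  literalCode-injective (literal x false) (literal y false) eq | refl , _ = refl
  literalCode-injective (literal x true)  (literal y true)  eq | refl , _ = refl

  -- Clauses are padded to length `k` with the extra symbol `zero`, hence the alphabet of size
  -- `suc (n * 2)`.
  clauseCode : ∀ k → List (Literal n) → Fin (suc (n * 2) ^ k)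
  clauseCode zero    C       = zero
  clauseCode (suc k) []      = combine {suc (n * 2)} zero (clauseCode k [])
  clauseCode (suc k) (l ∷ C) = combine (suc (literalCode l)) (clauseCode k C)

  clauseCode-injective : ∀ k C D → length C ≤ k → length D ≤ k → clauseCode k C ≡ clauseCode k D → C ≡ D
  clauseCode-injective zero    []      []      _ _ _ = refl
  clauseCode-injective (suc k) []      []      _ _ _ = refl
  clauseCode-injective (suc k) []      (m ∷ D) _ _ eq
    with () ← proj₁ (combine-injective {suc (n * 2)} zero (clauseCode k []) (suc (literalCode m)) (clauseCode k D) eq)
  clauseCode-injective (suc k) (l ∷ C) []      _ _ eq
    with () ← proj₁ (combine-injective (suc (literalCode l)) (clauseCode k C) zero (clauseCode k []) eq)
  clauseCode-injective (suc k) (l ∷ C) (m ∷ D) (s≤s C≤k) (s≤s D≤k) eq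
    with combine-injective (suc (literalCode l)) (clauseCode k C) (suc (literalCode m)) (clauseCode k D) eq
  ... | l≡m , C≡D = cong₂ _∷_ (literalCode-injective l m (Fin.suc-injective l≡m)) (clauseCode-injective k C D C≤k D≤k C≡D)

  -- Time is measured in `n` alone, so scanning the formula has to be polynomial in `n`. Clauses
  -- that differ as sets differ as lists, and the padded code separates lists of length at most `k`.
  number-of-clauses : ∀ k (F : CNF n) → (k ≤-CNF) F → length (CNF.clauses F) ≤ suc (n * 2) ^ k
  number-of-clauses k F F≤k = injective⇒≤ {f = code} injective
    where
    cs = CNF.clauses F
    code : Fin (length cs) → Fin (suc (n * 2) ^ k)
    code i = clauseCode k (Clause.literals (lookup cs i))
    different : AllPairs (λ C D → Clause.literals C ≢ Clause.literals D) cs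
    different = AllPairs.map (λ {C} C≁D C≡D → C≁D (subst (Clause.literals C ∼[ set ]_) C≡D ∼-refl)) (CNF.distinct F)
      where
      ∼-refl : ∀ {C : List (Literal n)} → C ∼[ set ] C
      ∼-refl = ⇔.refl
    injective : ∀ {i j} → code i ≡ code j → i ≡ j
    injective {i} {j} eq with i Fin.≟ j
    ... | yes i≡j = i≡j
    ... | no  i≢j = contradiction
      (clauseCode-injective k _ _ (All.lookup F≤k (∈-lookup i)) (All.lookup F≤k (∈-lookup j)) eq)
      (AllPairs-lookup different (λ C≢D D≡C → C≢D (sym D≡C)) i j i≢j)

-- Running time

-- The inhomogeneous term grows at the same rate `c` as the recursion, so each of the `suc m` levels
-- contributes at most `h * c ^ m` in total.
geometric : ∀ (f : ℕ → ℕ) h c L → f 0 ≤ h → (∀ m → m < L → f (suc m) ≤ h * c ^ suc m + c * f m) →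
            ∀ m → m ≤ L → f m ≤ suc m * h * c ^ m
geometric f h c L f0 step zero    m≤L = ≤-trans f0 (≤-reflexive (lem h))
  where
  lem : ∀ h → h ≡ 1 * h * 1
  lem = solve-∀
geometric f h c L f0 step (suc m) m<L = begin
  f (suc m)                              ≤⟨ step m m<L ⟩
  h * c ^ suc m + c * f m                ≤⟨ +-monoʳ-≤ _ (*-monoʳ-≤ c (geometric f h c L f0 step m (<⇒≤ m<L))) ⟩
  h * c ^ suc m + c * (suc m * h * c ^ m) ≡⟨ lem h c m (c ^ m) ⟩
  suc (suc m) * h * c ^ suc m            ∎
  where
  open ≤-Reasoning
  lem : ∀ h c m p → h * (c * p) + c * (suc m * h * p) ≡ suc (suc m) * h * (c * p)
  lem = solve-∀

record Poly (f : ℕ → ℕ) : Set where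
  constructor poly
  field
    coefficient degree : ℕ
    bound              : ∀ n → f n ≤ coefficient * suc n ^ degree

module _ {f g : ℕ → ℕ} where

  poly-+ : Poly f → Poly g → Poly (λ n → f n + g n)
  poly-+ (poly c d f≤) (poly c′ d′ g≤) = poly (c + c′) (d + d′) λ n → begin
    f n + g n                                      ≤⟨ +-mono-≤ (f≤ n) (g≤ n) ⟩
    c * suc n ^ d + c′ * suc n ^ d′
      ≤⟨ +-mono-≤ (*-monoʳ-≤ c (^-monoʳ-≤ (suc n) (m≤m+n d d′))) (*-monoʳ-≤ c′ (^-monoʳ-≤ (suc n) (m≤n+m d′ d))) ⟩
    c * suc n ^ (d + d′) + c′ * suc n ^ (d + d′)   ≡⟨ *-distribʳ-+ (suc n ^ (d + d′)) c c′ ⟨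
    (c + c′) * suc n ^ (d + d′)                    ∎
    where open ≤-Reasoning

  poly-* : Poly f → Poly g → Poly (λ n → f n * g n)
  poly-* (poly c d f≤) (poly c′ d′ g≤) = poly (c * c′) (d + d′) λ n → begin
    f n * g n                            ≤⟨ *-mono-≤ (f≤ n) (g≤ n) ⟩
    c * suc n ^ d * (c′ * suc n ^ d′)    ≡⟨ lem c c′ (suc n ^ d) (suc n ^ d′) ⟩
    c * c′ * (suc n ^ d * suc n ^ d′)    ≡⟨ cong (c * c′ *_) (^-distribˡ-+-* (suc n) d d′) ⟨
    c * c′ * suc n ^ (d + d′)            ∎
    where
    open ≤-Reasoning
    lem : ∀ c c′ p q → c * p * (c′ * q) ≡ c * c′ * (p * q)
    lem = solve-∀

  poly-≤ : (∀ n → f n ≤ g n) → Poly g → Poly f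
  poly-≤ f≤g (poly c d g≤) = poly c d (λ n → ≤-trans (f≤g n) (g≤ n))

poly-const : ∀ c → Poly (λ _ → c)
poly-const c = poly c 0 (λ n → ≤-reflexive (sym (*-identityʳ c)))

poly-id : Poly (λ n → n)
poly-id = poly 1 1 (λ n → ≤-trans (n≤1+n n) (≤-reflexive (lem n)))
  where
  lem : ∀ n → suc n ≡ 1 * (suc n * 1)
  lem = solve-∀

poly-suc : ∀ {f} → Poly f → Poly (λ n → suc (f n))
poly-suc p = poly-+ (poly-const 1) p

poly-^ : ∀ {f} k → Poly f → Poly (λ n → f n ^ k)
poly-^ zero    p = poly-const 1
poly-^ (suc k) p = poly-* p (poly-^ k p)

-- The number of blocks is `n` divided by the block length, rounded up; the recursion takes fuel
-- because `n ∸ b` is not structurally smaller.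
count-blocks : ∀ b n → ∃ λ m → Blocks (suc b) n m × n ≤ m * suc b × m * suc b ≤ n + suc b
count-blocks b n = go n n ≤-refl
  where
  go : ∀ fuel n → n ≤ fuel → ∃ λ m → Blocks (suc b) n m × n ≤ m * suc b × m * suc b ≤ n + suc b
  go _          zero    _            = 0 , done , z≤n , z≤n
  go (suc fuel) (suc n) (s≤s n≤fuel) with go fuel (n ∸ b) (≤-trans (m∸n≤m n b) n≤fuel)
  ... | m , blocks , n≤ , ≤n = suc m , more blocks ,
    s≤s (≤-trans (m≤n+m∸n n b) (+-monoʳ-≤ b n≤)) , upper
    where
    open ≤-Reasoning
    upper : suc m * suc b ≤ suc n + suc b
    upper with b ≤? n
    ... | yes b≤n = begin
      suc b + m * suc b            ≤⟨ +-monoʳ-≤ (suc b) ≤n ⟩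
      suc b + (n ∸ b + suc b)      ≡⟨ lem b (n ∸ b) ⟩
      suc (b + (n ∸ b)) + suc b    ≡⟨ cong (λ x → suc x + suc b) (m+[n∸m]≡n b≤n) ⟩
      suc n + suc b                ∎
      where
      lem : ∀ b x → suc b + (x + suc b) ≡ suc (b + x) + suc b
      lem = solve-∀
    ... | no b≰n = last-block blocks (m≤n⇒m∸n≡0 (<⇒≤ (≰⇒> b≰n)))
      where
      last-block : ∀ {v m} → Blocks (suc b) v m → v ≡ 0 → suc m * suc b ≤ suc n + suc b
      last-block done refl = ≤-trans (≤-reflexive (+-identityʳ (suc b))) (m≤n+m (suc b) (suc n))

module ClosedForms (κ clauses gain block radius walks starts : ℕ) (n M : ℕ)
                   .{{_ : NonZero κ}} .{{_ : NonZero starts}}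
                   (Z : ℕ) (walks≤Z : walks ≤ Z) (κ^gain≤Z : κ ^ gain ≤ Z) where

  open Costs κ clauses gain block radius walks starts n M
  open ≤-Reasoning

  searchCost≤ : ∀ r → searchCost r ≤ suc r * searchCost 0 * κ ^ r
  searchCost≤ r = geometric searchCost (searchCost 0) κ r ≤-refl
    (λ m _ → +-monoˡ-≤ (κ * searchCost m) (m≤m*n (searchCost 0) (κ ^ suc m) {{m^n≢0 κ (suc m)}})) r ≤-refl

  instance
    Z≢0 : NonZero Z
    Z≢0 = >-nonZero (≤-trans (m^n>0 κ gain) κ^gain≤Z)

  walkOverhead : ℕ → ℕ
  walkOverhead L = clauses * collecting + 4 ^ (clauses * suc k) * (unit + suc (gain * L) * searchCost 0)
                   + (suc walks * flipping + 120)

  search≤Z : ∀ L l → l ≤ L → searchCost (gain * l) ≤ suc (gain * L) * searchCost 0 * Z ^ l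
  search≤Z L l l≤L = begin
    searchCost (gain * l)                              ≤⟨ searchCost≤ (gain * l) ⟩
    suc (gain * l) * searchCost 0 * κ ^ (gain * l)
      ≤⟨ *-monoˡ-≤ (κ ^ (gain * l)) (*-monoˡ-≤ (searchCost 0) (s≤s (*-monoʳ-≤ gain l≤L))) ⟩
    suc (gain * L) * searchCost 0 * κ ^ (gain * l)     ≡⟨ cong (suc (gain * L) * searchCost 0 *_) (^-*-assoc κ gain l) ⟨
    suc (gain * L) * searchCost 0 * (κ ^ gain) ^ l     ≤⟨ *-monoʳ-≤ (suc (gain * L) * searchCost 0) (^-monoˡ-≤ l κ^gain≤Z) ⟩
    suc (gain * L) * searchCost 0 * Z ^ l              ∎

  opaque
    unfolding Costs.walkCost

    walkCost≤ : ∀ L → walkCost L ≤ suc L * walkOverhead L * Z ^ L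
    walkCost≤ L = geometric walkCost (walkOverhead L) Z L initial step L ≤-refl
      where
      S Q : ℕ
      S = searchCost 0
      Q = 4 ^ (clauses * suc k)
      initial : walkCost 0 ≤ walkOverhead L
      initial = +-mono-≤
        (≤-trans (≤-trans (m≤m+n S _) (m≤n+m (suc (gain * L) * S) unit))
          (≤-trans (m≤n*m (unit + suc (gain * L) * S) Q {{m^n≢0 4 (clauses * suc k)}})
                   (m≤n+m (Q * (unit + suc (gain * L) * S)) (clauses * collecting))))
        (≤-trans (m≤n+m 60 60) (m≤n+m 120 (suc walks * flipping)))
      absorb : ∀ x m → x ≤ x * Z ^ m
      absorb x m = m≤m*n x (Z ^ m) {{m^n≢0 Z m}}
      lem : ∀ a q s c w r → a + (q * s + (c + w + 60)) + r ≡ a + q * s + (c + (60 + r)) + w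
      lem = solve-∀
      lem′ : ∀ a q u s c z → a * z + q * (u * z + s * z) + (c * z + 120 * z) ≡ (a + q * (u + s) + (c + 120)) * z
      lem′ = solve-∀
      step : ∀ m → m < L → walkCost (suc m) ≤ walkOverhead L * Z ^ suc m + Z * walkCost m
      step m m<L = begin
        walkCost (suc m)
          ≡⟨ lem (clauses * collecting) Q (unit + searchCost (gain * suc m)) (suc walks * flipping) (walks * walkCost m) 60 ⟩
        clauses * collecting + Q * (unit + searchCost (gain * suc m)) + (suc walks * flipping + 120) + walks * walkCost m
          ≤⟨ +-mono-≤ (+-mono-≤ (+-mono-≤ (absorb (clauses * collecting) (suc m))
                       (*-monoʳ-≤ Q (+-mono-≤ (absorb unit (suc m)) (search≤Z L (suc m) m<L))))
                       (+-mono-≤ (absorb (suc walks * flipping) (suc m)) (absorb 120 (suc m))))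
                      (*-monoˡ-≤ (walkCost m) walks≤Z) ⟩
        clauses * collecting * Z ^ suc m + Q * (unit * Z ^ suc m + suc (gain * L) * S * Z ^ suc m)
          + (suc walks * flipping * Z ^ suc m + 120 * Z ^ suc m) + Z * walkCost m
          ≡⟨ cong (_+ Z * walkCost m) (lem′ (clauses * collecting) Q unit (suc (gain * L) * S)
                 (suc walks * flipping) (Z ^ suc m)) ⟩
        walkOverhead L * Z ^ suc m + Z * walkCost m ∎

  startOverhead : ℕ
  startOverhead = block + 2 * radius + 60 + suc starts * prepending + 60

  opaque
    unfolding Costs.startCost

    startCost≤ : ∀ L m → startCost L m ≤ suc m * (startOverhead + suc L * walkOverhead L) * (Z ^ L * starts ^ m)
    startCost≤ L m = begin
      startCost L m
        ≤⟨ geometric (startCost L) (startOverhead + walkCost L) starts m initial step m ≤-refl ⟩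
      suc m * (startOverhead + walkCost L) * starts ^ m
        ≤⟨ *-monoˡ-≤ (starts ^ m) (*-monoʳ-≤ (suc m) (+-mono-≤ (m≤m*n startOverhead (Z ^ L) {{m^n≢0 Z L}}) (walkCost≤ L))) ⟩
      suc m * (startOverhead * Z ^ L + suc L * walkOverhead L * Z ^ L) * starts ^ m
        ≡⟨ lem (suc m) startOverhead (suc L * walkOverhead L) (Z ^ L) (starts ^ m) ⟩
      suc m * (startOverhead + suc L * walkOverhead L) * (Z ^ L * starts ^ m) ∎
      where
      lem : ∀ m a b z s → m * (a * z + b * z) * s ≡ m * (a + b) * (z * s)
      lem = solve-∀
      initial : walkCost L + 60 ≤ startOverhead + walkCost L
      initial = ≤-trans (≤-reflexive (+-comm (walkCost L) 60))
        (+-monoˡ-≤ (walkCost L) (m≤n+m 60 (block + 2 * radius + 60 + suc starts * prepending)))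
      step : ∀ i → i < m → startCost L (suc i) ≤ (startOverhead + walkCost L) * starts ^ suc i + starts * startCost L i
      step i _ = begin
        startCost L (suc i)
          ≡⟨ +-assoc (block + 2 * radius + 60) (suc starts * prepending) _ ⟨
        block + 2 * radius + 60 + suc starts * prepending + starts * startCost L i
          ≤⟨ +-monoˡ-≤ _ (≤-trans (m≤m+n _ 60) (m≤m+n startOverhead (walkCost L))) ⟩
        startOverhead + walkCost L + starts * startCost L i
          ≤⟨ +-monoˡ-≤ _ (m≤m*n (startOverhead + walkCost L) (starts ^ suc i) {{m^n≢0 starts (suc i)}}) ⟩
        (startOverhead + walkCost L) * starts ^ suc i + starts * startCost L i ∎

-- The algorithm and its total cost

literals : ∀ {n} → CNF n → List (Lits n)
literals F = map Clause.literals (CNF.clauses F)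

encode-literals : ∀ {n} (F : CNF n) → encodeCNF F ≡ encodeℕ n ∙ encᶠ (literals F)
encode-literals {n} F = cong (encodeℕ n ∙_) (go (CNF.clauses F))
  where
  go : ∀ cs → encodeList encodeClause cs ≡ encᶠ (map Clause.literals cs)
  go []       = refl
  go (C ∷ cs) = cong (encodeClause C ∙_) (go cs)

model⇒satisfiable : ∀ {n} (F : CNF n) β → Model β (literals F) → Satisfiable F
model⇒satisfiable F β model = (λ i → β (toℕ i)) , All.map⁻ model

satisfiable⇒model : ∀ {n} (F : CNF n) → Satisfiable F → ∃ λ β → Model β (literals F)
satisfiable⇒model {n} F (α , sat) = β , All.map⁺ (All.map (Any.map (λ {l} → trans (β≡α (Literal.var l)))) sat)
  where
  β : ℕ → Bool
  β i with i <? n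
  ... | yes i<n = α (fromℕ< i<n)
  ... | no _    = false
  β≡α : ∀ x → β (toℕ x) ≡ α x
  β≡α x with toℕ x <? n
  ... | yes x<n = cong α (fromℕ<-toℕ x x<n)
  ... | no x≮n  = contradiction (toℕ<n x) x≮n

module Algorithm (κ A B X Y : ℕ) .{{_ : NonZero κ}} .{{_ : NonZero A}} .{{_ : NonZero B}} .{{_ : NonZero X}} .{{_ : NonZero Y}}
                 (B≤A : B ≤ A) (κB≤A : κ * B ≤ A) (W : WalkCode κ A B) (S : StartCode A B X Y) where

  module W = WalkCode W
  module S = StartCode S

  k gain clauses block walks starts Z : ℕ
  k       = suc κ
  gain    = suc W.gain
  clauses = gain + (W.radius + W.radius)
  block   = suc S.block⁻
  walks   = length W.code
  starts  = length S.code
  -- Lowering the radius by `gain` costs a factor `walks` in the walk and `κ ^ gain` in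
  -- backtracking; `Z` dominates both.
  Z       = walks ⊔ κ ^ gain

  instance
    starts≢0 : NonZero starts
    starts≢0 = covers-nonempty S.covers

  maxClauses blocks levels : ℕ → ℕ
  maxClauses n = suc (n * 2) ^ k
  blocks n     = proj₁ (count-blocks S.block⁻ n)
  -- The successor rounds up, so that `gain * levels n` is at least the total radius of all blocks.
  levels n     = suc (blocks n * S.radius / gain)

  module C (n : ℕ) = Costs κ clauses gain block S.radius walks starts n (maxClauses n)
  module F (n : ℕ) = ClosedForms κ clauses gain block S.radius walks starts n (maxClauses n)
                       Z (m≤m⊔n walks (κ ^ gain)) (m≤n⊔m walks (κ ^ gain))

  time : ℕ → ℕ
  time n = 10 + (C.startCost n (levels n) (blocks n) + 0)

  open SearchProgram clauses gain block S.radius (encodeList encodeWord W.code) (encodeList encodeStart S.code)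
    public using (searchProgram)
  open Correctness κ clauses gain block S.radius W.code S.code

  blocks*block≤ : ∀ n → blocks n * block ≤ n + block
  blocks*block≤ n = proj₂ (proj₂ (proj₂ (count-blocks S.block⁻ n)))

  radius≤levels : ∀ n → blocks n * S.radius ≤ gain * levels n
  radius≤levels n = begin
    d                              ≡⟨ m≡m%n+[m/n]*n d gain ⟩
    d % gain + d / gain * gain ≤⟨ +-monoˡ-≤ _ (<⇒≤ (m%n<n d gain)) ⟩
    gain + d / gain * gain         ≡⟨ *-comm (levels n) gain ⟩
    gain * levels n                ∎
    where
    open ≤-Reasoning
    d : ℕ
    d = blocks n * S.radius

  levels≤ : ∀ n → gain * levels n ≤ blocks n * S.radius + gain
  levels≤ n = begin
    gain * levels n                     ≡⟨ *-comm gain (levels n) ⟩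
    gain + d / gain * gain              ≤⟨ +-monoʳ-≤ gain (m/n*n≤m d gain) ⟩
    gain + d                            ≡⟨ +-comm gain d ⟩
    d + gain                            ∎
    where
    open ≤-Reasoning
    d : ℕ
    d = blocks n * S.radius

  solves : searchProgram Solves k -SAT-InTime time
  solves {n} F F≤k
    with Formula.search-runs (literals F) (maxClauses n) (All.map⁺ F≤k)
           (≤-trans (≤-reflexive (length-map Clause.literals (CNF.clauses F))) (number-of-clauses k F F≤k))
           W.radius refl W.covers S.covers (levels n)
           (proj₁ (proj₂ (count-blocks S.block⁻ n))) (proj₁ (proj₂ (proj₂ (count-blocks S.block⁻ n)))) (radius≤levels n)
  ... | a , t , run , t≤ , sound , complete =
    a , t , subst (λ x → searchProgram on x returns encodeBool a in-steps t) (sym (encode-literals F)) run ,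
    mk⇔ (λ a≡true → model⇒satisfiable F (proj₁ (sound a≡true)) (proj₂ (sound a≡true)))
        (λ sat → complete (proj₁ (satisfiable⇒model F sat)) (proj₂ (satisfiable⇒model F sat))) ,
    t≤

  factor : ℕ → ℕ
  factor n = 10 + suc (blocks n) * (F.startOverhead n + suc (levels n) * F.walkOverhead n (levels n))

  time≤ : ∀ n → time n ≤ factor n * (Z ^ levels n * starts ^ blocks n)
  time≤ n = begin
    10 + (C.startCost n (levels n) (blocks n) + 0)   ≡⟨ cong (10 +_) (+-identityʳ (C.startCost n (levels n) (blocks n))) ⟩
    10 + C.startCost n (levels n) (blocks n)         ≤⟨ +-mono-≤ (m≤m*n 10 E {{E≢0}}) (F.startCost≤ n (levels n) (blocks n)) ⟩
    10 * E + P * E                                   ≡⟨ *-distribʳ-+ E 10 P ⟨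
    factor n * E                                     ∎
    where
    open ≤-Reasoning
    E P : ℕ
    E = Z ^ levels n * starts ^ blocks n
    P = suc (blocks n) * (F.startOverhead n + suc (levels n) * F.walkOverhead n (levels n))
    E≢0 : NonZero E
    E≢0 = m*n≢0 (Z ^ levels n) (starts ^ blocks n) {{m^n≢0 Z (levels n) {{F.Z≢0 n}}}} {{m^n≢0 starts (blocks n)}}

  blocks-poly : Poly blocks
  blocks-poly = poly-≤ (λ n → ≤-trans (m≤m*n (blocks n) block) (blocks*block≤ n)) (poly-+ poly-id (poly-const block))

  levels-poly : Poly levels
  levels-poly = poly-≤ (λ n → ≤-trans (m≤n*m (levels n) gain) (levels≤ n))
                  (poly-+ (poly-* blocks-poly (poly-const S.radius)) (poly-const gain))

  access-poly : Poly accessCost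
  access-poly = poly-* poly-id (poly-const 20)

  unit-poly : Poly C.unit
  unit-poly = poly-+ (poly-+ access-poly access-poly) (poly-const 50)

  finding-poly : Poly C.finding
  finding-poly = poly-* (poly-suc (poly-^ k (poly-suc (poly-* poly-id (poly-const 2)))))
    (poly-+ (poly-* (poly-const (suc k)) (poly-+ access-poly (poly-const 50))) (poly-const 20))

  search-poly : Poly (λ n → C.searchCost n 0)
  search-poly = poly-+ (poly-* (poly-const (suc k)) unit-poly) (poly-+ finding-poly (poly-const 20))

  collecting-poly : Poly C.collecting
  collecting-poly = poly-+ (poly-+ finding-poly
    (poly-* (poly-const (suc k)) (poly-+ (poly-+ access-poly access-poly) (poly-const 30)))) (poly-const 60)

  flipping-poly : Poly C.flipping
  flipping-poly = poly-+ (poly-+ (poly-const gain)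
    (poly-* (poly-const (suc clauses)) (poly-+ (poly-+ (poly-const (k * 10)) access-poly) (poly-const 40)))) (poly-const 60)

  walkOverhead-poly : Poly (λ n → F.walkOverhead n (levels n))
  walkOverhead-poly = poly-+ (poly-+ (poly-* (poly-const clauses) collecting-poly)
      (poly-* (poly-const (4 ^ (clauses * suc k)))
        (poly-+ unit-poly (poly-* (poly-suc (poly-* (poly-const gain) levels-poly)) search-poly))))
    (poly-+ (poly-* (poly-const (suc walks)) flipping-poly) (poly-const 120))

  factor-poly : Poly factor
  factor-poly = poly-+ (poly-const 10) (poly-* (poly-suc blocks-poly)
    -- `startOverhead` involves only constants of the program and is the same for every `n`; the
    -- argument 0 is arbitrary.
    (poly-+ (poly-const (F.startOverhead 0)) (poly-* (poly-suc levels-poly) walkOverhead-poly)))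

  -- That is `Z ≤ λ ^ gain`: for the code by its size, for backtracking because `κ ≤ λ`.
  Z-gain : Z * B ^ gain ≤ A ^ gain
  Z-gain = ≤-trans (≤-reflexive (*-distribʳ-⊔ (B ^ gain) walks (κ ^ gain)))
              (⊔-lub W.size (≤-trans (≤-reflexive (sym (*-^-distrib κ B gain))) (^-monoˡ-≤ gain κB≤A)))

  -- Rounding up to whole levels adds at most `gain` to the radius, and rounding up to whole blocks
  -- adds at most `block` variables; both cost a constant factor.
  overshoot : ℕ
  overshoot = A ^ gain * X ^ block

  -- For `R = m * S.radius`, `Z ^ L` is at most `λ ^ R` up to a factor `λ ^ gain`, and the start
  -- code bounds `starts ^ m * λ ^ R` by `(X / Y) ^ (m * block)`. Multiplying by `A ^ R * B ^ R`
  -- keeps the argument in ℕ.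
  exponential : ∀ n → Z ^ levels n * starts ^ blocks n * Y ^ n ≤ overshoot * X ^ n
  exponential n = *-cancelˡ-≤ (A ^ R * B ^ R) {{m*n≢0 (A ^ R) (B ^ R) {{m^n≢0 A R}} {{m^n≢0 B R}}}} (begin
    A ^ R * B ^ R * (Z ^ L * s ^ m * Y ^ n)
      -- The factors `B ^ e` and `Y ^ f`, at least 1, complete the exponents `R` and `n` to
      -- `gain * L` and `m * block`.
      ≤⟨ *-monoʳ-≤ (A ^ R * B ^ R) (m≤m*n (Z ^ L * s ^ m * Y ^ n) (B ^ e * Y ^ f)
           {{m*n≢0 (B ^ e) (Y ^ f) {{m^n≢0 B e}} {{m^n≢0 Y f}}}}) ⟩
    A ^ R * B ^ R * (Z ^ L * s ^ m * Y ^ n * (B ^ e * Y ^ f))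
      ≡⟨ lem (A ^ R) (B ^ R) (Z ^ L) (s ^ m) (Y ^ n) (B ^ e) (Y ^ f) ⟩
    Z ^ L * (B ^ R * B ^ e) * (s ^ m * A ^ R * (Y ^ n * Y ^ f))
      ≡⟨ cong₂ (λ x y → Z ^ L * x * (s ^ m * A ^ R * y)) (split B R e (gain * L) R+e) (split Y n f (m * block) n+f) ⟩
    Z ^ L * B ^ (gain * L) * (s ^ m * A ^ R * Y ^ (m * block))
      ≤⟨ *-mono-≤ walking starting ⟩
    A ^ (gain * L) * (X ^ (m * block) * B ^ R)
      ≡⟨ cong₂ (λ x y → x * (y * B ^ R)) (split A R e (gain * L) R+e) (split X n f (m * block) n+f) ⟨
    A ^ R * A ^ e * (X ^ n * X ^ f * B ^ R)
      ≤⟨ *-mono-≤ (*-monoʳ-≤ (A ^ R) (^-monoʳ-≤ A e≤)) (*-monoˡ-≤ (B ^ R) (*-monoʳ-≤ (X ^ n) (^-monoʳ-≤ X f≤))) ⟩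
    A ^ R * A ^ gain * (X ^ n * X ^ block * B ^ R)
      ≡⟨ lem′ (A ^ R) (A ^ gain) (X ^ n) (X ^ block) (B ^ R) ⟩
    A ^ R * B ^ R * (overshoot * X ^ n) ∎)
    where
    open ≤-Reasoning
    m L R e f s : ℕ
    m = blocks n
    L = levels n
    R = m * S.radius
    e = gain * L ∸ R
    f = m * block ∸ n
    s = starts
    R+e : R + e ≡ gain * L
    R+e = m+[n∸m]≡n (radius≤levels n)
    n+f : n + f ≡ m * block
    n+f = m+[n∸m]≡n (proj₁ (proj₂ (proj₂ (count-blocks S.block⁻ n))))
    e≤ : e ≤ gain
    e≤ = m≤n+o⇒m∸n≤o (gain * L) R (levels≤ n)
    f≤ : f ≤ block
    f≤ = m≤n+o⇒m∸n≤o (m * block) n (blocks*block≤ n)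
    split : ∀ x a b c → a + b ≡ c → x ^ a * x ^ b ≡ x ^ c
    split x a b c eq = trans (sym (^-distribˡ-+-* x a b)) (cong (x ^_) eq)
    walking : Z ^ L * B ^ (gain * L) ≤ A ^ (gain * L)
    walking = begin
      Z ^ L * B ^ (gain * L)     ≡⟨ cong (Z ^ L *_) (^-*-assoc B gain L) ⟨
      Z ^ L * (B ^ gain) ^ L     ≡⟨ *-^-distrib Z (B ^ gain) L ⟨
      (Z * B ^ gain) ^ L         ≤⟨ ^-monoˡ-≤ L Z-gain ⟩
      (A ^ gain) ^ L             ≡⟨ ^-*-assoc A gain L ⟩
      A ^ (gain * L)             ∎
    power : ∀ x a → (x ^ a) ^ m ≡ x ^ (m * a)
    power x a = trans (^-*-assoc x a m) (cong (x ^_) (*-comm a m))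
    starting : s ^ m * A ^ R * Y ^ (m * block) ≤ X ^ (m * block) * B ^ R
    starting = begin
      s ^ m * A ^ R * Y ^ (m * block)
        ≡⟨ cong₂ (λ x y → s ^ m * x * y) (power A S.radius) (power Y block) ⟨
      s ^ m * (A ^ S.radius) ^ m * (Y ^ block) ^ m
        ≡⟨ trans (*-^-distrib (s * A ^ S.radius) (Y ^ block) m) (cong (_* (Y ^ block) ^ m) (*-^-distrib s (A ^ S.radius) m)) ⟨
      (s * A ^ S.radius * Y ^ block) ^ m
        ≤⟨ ^-monoˡ-≤ m S.size ⟩
      (X ^ block * B ^ S.radius) ^ m
        ≡⟨ *-^-distrib (X ^ block) (B ^ S.radius) m ⟩
      (X ^ block) ^ m * (B ^ S.radius) ^ m
        ≡⟨ cong₂ _*_ (power X block) (power B S.radius) ⟩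
      X ^ (m * block) * B ^ R ∎
    lem : ∀ a b z s y e f → a * b * (z * s * y * (e * f)) ≡ z * (b * e) * (s * a * (y * f))
    lem = solve-∀
    lem′ : ∀ a g x c b → a * g * (x * c * b) ≡ a * b * (g * c * x)
    lem′ = solve-∀

  running-time : ∃₂ λ c d → ∀ n → time n * Y ^ n ≤ c * suc n ^ d * X ^ n
  running-time = coefficient * overshoot , degree , λ n → begin
    time n * Y ^ n                                             ≤⟨ *-monoˡ-≤ (Y ^ n) (time≤ n) ⟩
    factor n * (Z ^ levels n * starts ^ blocks n) * Y ^ n      ≡⟨ *-assoc (factor n) (Z ^ levels n * starts ^ blocks n) (Y ^ n) ⟩
    factor n * (Z ^ levels n * starts ^ blocks n * Y ^ n)      ≤⟨ *-mono-≤ (bound n) (exponential n) ⟩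
    coefficient * suc n ^ degree * (overshoot * X ^ n)         ≡⟨ lem coefficient (suc n ^ degree) overshoot (X ^ n) ⟩
    coefficient * overshoot * suc n ^ degree * X ^ n           ∎
    where
    open ≤-Reasoning
    open Poly factor-poly
    lem : ∀ c p o x → c * p * (o * x) ≡ c * o * p * x
    lem = solve-∀

k-SAT-in-time : ∀ κ X Y .{{_ : NonZero κ}} .{{_ : NonZero Y}} → 2 * κ * Y < suc κ * X →
  ∃₂ λ P T → P Solves suc κ -SAT-InTime T × ∃₂ λ c d → ∀ n → T n * Y ^ n ≤ c * suc n ^ d * X ^ n
k-SAT-in-time κ X Y below = searchProgram , time , solves , running-time
  where
  A B : ℕ
  -- Here `λ = κ + 1 / (2 * Y)`, close enough to `κ` for `rate`.
  A = suc (κ * (2 * Y))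
  B = 2 * Y
  instance
    B≢0 : NonZero B
    B≢0 = m*n≢0 2 Y
    X≢0 : NonZero X
    X≢0 = positive X below
      where
      positive : ∀ X → 2 * κ * Y < suc κ * X → NonZero X
      positive zero    below = contradiction (≤-trans below (≤-reflexive (*-zeroʳ (suc κ)))) (λ ())
      positive (suc X) below = _
  B≤A : B ≤ A
  B≤A = ≤-trans (m≤n*m B κ) (n≤1+n _)
  open Algorithm κ A B X Y B≤A (n≤1+n _) (walkCode κ A B B≤A (drift κ B)) (startCode A B X Y (rate κ X Y below))

-- Rational bounds

fromℕ : ℕ → ℚ
fromℕ a = ℤ.+ a ℚ./ 1

toℚᵘ-fromℕ : ∀ a → toℚᵘ (fromℕ a) ℚᵘ.≃ mkℚᵘ (ℤ.+ a) 0
toℚᵘ-fromℕ a = ℚ.toℚᵘ-fromℚᵘ (mkℚᵘ (ℤ.+ a) 0)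

fromℕ-* : ∀ a b → fromℕ (a * b) ≡ fromℕ a ℚ.* fromℕ b
fromℕ-* a b = ℚ.toℚᵘ-injective (begin
  toℚᵘ (fromℕ (a * b))                  ≈⟨ toℚᵘ-fromℕ (a * b) ⟩
  mkℚᵘ (ℤ.+ (a * b)) 0                    ≈⟨ *≡* (cong (ℤ._* ℤ.+ 1) (ℤ.pos-* a b)) ⟩
  mkℚᵘ (ℤ.+ a) 0 ℚᵘ.* mkℚᵘ (ℤ.+ b) 0          ≈⟨ ℚᵘ.*-cong (toℚᵘ-fromℕ a) (toℚᵘ-fromℕ b) ⟨
  toℚᵘ (fromℕ a) ℚᵘ.* toℚᵘ (fromℕ b)      ≈⟨ ℚ.toℚᵘ-homo-* (fromℕ a) (fromℕ b) ⟨
  toℚᵘ (fromℕ a ℚ.* fromℕ b)              ∎)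
  where open import Relation.Binary.Reasoning.Setoid ℚᵘ.≃-setoid

fromℕ-mono-≤ : ∀ {a b} → a ≤ b → fromℕ a ℚ.≤ fromℕ b
fromℕ-mono-≤ {a} {b} a≤b = ℚ.toℚᵘ-cancel-≤ (ℚᵘ.≤-respˡ-≃ (ℚᵘ.≃-sym (toℚᵘ-fromℕ a))
  (ℚᵘ.≤-respʳ-≃ (ℚᵘ.≃-sym (toℚᵘ-fromℕ b)) (*≤* (ℤ.*-monoʳ-≤-nonNeg (ℤ.+ 1) (ℤ.+≤+ a≤b)))))

*-denominator : ∀ q X → ↥ q ≡ ℤ.+ X → q ℚ.* fromℕ (↧ₙ q) ≡ fromℕ X
*-denominator q@record{} X ↥q≡X = ℚ.toℚᵘ-injective (begin
  toℚᵘ (q ℚ.* fromℕ (↧ₙ q))               ≈⟨ ℚ.toℚᵘ-homo-* q (fromℕ (↧ₙ q)) ⟩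
  toℚᵘ q ℚᵘ.* toℚᵘ (fromℕ (↧ₙ q))         ≈⟨ ℚᵘ.*-congˡ {toℚᵘ q} (toℚᵘ-fromℕ (↧ₙ q)) ⟩
  toℚᵘ q ℚᵘ.* mkℚᵘ (↧ q) 0                ≈⟨ *≡* numerators ⟩
  mkℚᵘ (ℤ.+ X) 0                            ≈⟨ toℚᵘ-fromℕ X ⟨
  toℚᵘ (fromℕ X)                          ∎)
  where
  open import Relation.Binary.Reasoning.Setoid ℚᵘ.≃-setoid
  numerators : ↥ q ℤ.* ↧ q ℤ.* ℤ.+ 1 ≡ ℤ.+ X ℤ.* ℚᵘ.↧ (toℚᵘ q ℚᵘ.* mkℚᵘ (↧ q) 0)
  numerators = trans (ℤ.*-identityʳ _) (cong₂ ℤ._*_ ↥q≡X (cong ℤ.+_ (sym (*-identityʳ (↧ₙ q)))))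

^-denominator : ∀ q X → ↥ q ≡ ℤ.+ X → ∀ n → q ^ℚ n ℚ.* fromℕ (↧ₙ q ^ n) ≡ fromℕ (X ^ n)
^-denominator q X ↥q≡X zero    = refl
^-denominator q X ↥q≡X (suc n) = begin
  q ℚ.* q ^ℚ n ℚ.* fromℕ (Y * Y ^ n)                  ≡⟨ cong (q ℚ.* q ^ℚ n ℚ.*_) (fromℕ-* Y (Y ^ n)) ⟩
  q ℚ.* q ^ℚ n ℚ.* (fromℕ Y ℚ.* fromℕ (Y ^ n))          ≡⟨ interchange q (q ^ℚ n) (fromℕ Y) (fromℕ (Y ^ n)) ⟩
  q ℚ.* fromℕ Y ℚ.* (q ^ℚ n ℚ.* fromℕ (Y ^ n))          ≡⟨ cong₂ ℚ._*_ (*-denominator q X ↥q≡X) (^-denominator q X ↥q≡X n) ⟩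
  fromℕ X ℚ.* fromℕ (X ^ n)                             ≡⟨ fromℕ-* X (X ^ n) ⟨
  fromℕ (X ^ suc n)                                     ∎
  where
  open ≡-Reasoning
  Y : ℕ
  Y = ↧ₙ q

-- Multiplication by the positive number `Y ^ n` turns `q ^ℚ n` into `X ^ n`, and the inequality
-- becomes one between natural numbers.
bound-in-ℚ : ∀ q X → ↥ q ≡ ℤ.+ X → (T : ℕ → ℕ) →
  (∃₂ λ c d → ∀ n → T n * ↧ₙ q ^ n ≤ c * suc n ^ d * X ^ n) → T ∈O* (q ^ℚ_)
bound-in-ℚ q X ↥q≡X T (c , d , T≤) = c , d , λ n → ℚ.*-cancelʳ-≤-pos (fromℕ (Y ^ n)) {{pos n}} (begin
  fromℕ (T n) ℚ.* fromℕ (Y ^ n)                                 ≡⟨ fromℕ-* (T n) (Y ^ n) ⟨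
  fromℕ (T n * Y ^ n)                                         ≤⟨ fromℕ-mono-≤ (T≤ n) ⟩
  fromℕ (c * suc n ^ d * X ^ n)                           ≡⟨ fromℕ-* (c * suc n ^ d) (X ^ n) ⟩
  fromℕ (c * suc n ^ d) ℚ.* fromℕ (X ^ n)                   ≡⟨ cong (fromℕ (c * suc n ^ d) ℚ.*_) (^-denominator q X ↥q≡X n) ⟨
  fromℕ (c * suc n ^ d) ℚ.* (q ^ℚ n ℚ.* fromℕ (Y ^ n))      ≡⟨ ℚ.*-assoc (fromℕ (c * suc n ^ d)) (q ^ℚ n) (fromℕ (Y ^ n)) ⟨
  fromℕ (c * suc n ^ d) ℚ.* q ^ℚ n ℚ.* fromℕ (Y ^ n)        ∎)
  where
  open ℚ.≤-Reasoning
  Y : ℕ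
  Y = ↧ₙ q
  pos : ∀ n → ℚ.Positive (fromℕ (Y ^ n))
  pos n = ℚ.normalize-pos (Y ^ n) 1 {{_}} {{m^n≢0 Y n}}

positive-numerator : ∀ a b κ i → ℤ.+ a ℤ.* ℤ.+ b ℤ.< i ℤ.* ℤ.+ suc κ → ∃ λ X → i ≡ ℤ.+ X × a * b < suc κ * X
positive-numerator a b κ (ℤ.+ X) a*b< = X , refl ,
  subst (a * b <_) (*-comm X (suc κ))
    (ℤ.drop‿+<+ (subst₂ ℤ._<_ (sym (ℤ.pos-* a b)) (sym (ℤ.pos-* X (suc κ))) a*b<))
positive-numerator a b κ -[1+ x ] a*b< with () ← subst (ℤ._< _) (sym (ℤ.pos-* a b)) a*b<

-- `base` is a quotient in lowest terms; as an unnormalised fraction its numerator and denominator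
-- are visible, and the comparison is a cross multiplication.
exceeds-base : ∀ κ q → base (suc κ) ℚ.< q → ∃ λ X → ↥ q ≡ ℤ.+ X × 2 * κ * ↧ₙ q < suc κ * X
exceeds-base κ q@record{} base<q = positive-numerator (2 * κ) (↧ₙ q) κ (↥ q)
  (ℚᵘ.drop-*<* (ℚᵘ.<-respˡ-≃ (ℚ.toℚᵘ-fromℚᵘ (mkℚᵘ (ℤ.+ (2 * κ)) κ)) (ℚ.toℚᵘ-mono-< {base (suc κ)} {q} base<q)))

k-SAT-above-base : ∀ κ .{{_ : NonZero κ}} q → base (suc κ) ℚ.< q →
  ∃₂ λ P T → P Solves suc κ -SAT-InTime T × T ∈O* (q ^ℚ_)
k-SAT-above-base κ q base<q = from-numerator (exceeds-base κ q base<q)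
  where
  from-numerator : (∃ λ X → ↥ q ≡ ℤ.+ X × 2 * κ * ↧ₙ q < suc κ * X) →
                   ∃₂ λ P T → P Solves suc κ -SAT-InTime T × T ∈O* (q ^ℚ_)
  from-numerator (X , ↥q≡X , below) = in-ℚ (k-SAT-in-time κ X (↧ₙ q) below)
    where
    in-ℚ : (∃₂ λ P T → P Solves suc κ -SAT-InTime T ×
              ∃₂ λ c d → ∀ n → T n * ↧ₙ q ^ n ≤ c * suc n ^ d * X ^ n) →
           ∃₂ λ P T → P Solves suc κ -SAT-InTime T × T ∈O* (q ^ℚ_)
    in-ℚ (P , T , solves , T≤) = P , T , solves , bound-in-ℚ q X ↥q≡X T T≤

theorem5 : (k : ℕ) .{{_ : NonZero k}} → 2 ≤ k →
    (ε : ℚ) → 0ℚ ℚ.< ε →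
    ∃₂ λ (P : Program) (T : ℕ → ℕ) →
    P Solves k -SAT-InTime T × T ∈O* (λ n → (base k ℚ.+ ε) ^ℚ n)
theorem5 (suc zero) (s≤s ())
theorem5 (suc κ@(suc _)) _ ε 0<ε = k-SAT-above-base κ (base (suc κ) ℚ.+ ε)
  (subst (ℚ._< base (suc κ) ℚ.+ ε) (ℚ.+-identityʳ (base (suc κ))) (ℚ.+-monoʳ-< (base (suc κ)) 0<ε))
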